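{- There exist absolute constants $\beta,\eta>0$ such that the following holds for all sufficiently large $n$. Let $p=p(n)\in(0,1)$ satisfy $p\geq 2^{ -0.99n}$, and let $G$ be the graph of the random polytope $P_{n,p}$. Then with high probability $h(G)\geq \beta$, and moreover every $A\subseteq V(G)$ with $|A|\leq \eta\,|V(G)|$ satisfies $e_G(A,V(G)\setminus A)\geq |A|$.
   Context: For $p\in(0,1)$, let $U$ be a random subset of $\{0,1\}^n$ in which each point is included independently with probability $p$; the random $0/1$-polytope $P_{n,p}$ is the convex hull of $U$ in $\mathbb{R}^n$ (its vertex set is exactly $U$). The graph $G_P$ of a polytope $P$ has as vertices the $0$-dimensional faces of $P$ and as edges the $1$-dimensional faces of $P$. For a graph $G$ with vertex set $V$, $e_G(S,T)$ denotes the number of edges with one endpoint in $S$ and the other in $T$, and the edge expansion is $h(G)=\min\{e_G(S,V\setminus S)/|S| : S\subseteq V,\ 1\leq |S|\leq |V|/2\}$. An event holds with high probability if its probability tends to $1$ as $n\to\infty$.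
   Formalization: The probabilities p(n) are taken to be rational numbers in (0,1), where the English statement allows arbitrary real p(n). -}

module Defs where

open import Data.Bool using (Bool; true; false; not)
open import Data.Nat as ℕ using (ℕ; zero; suc)
open import Data.Integer using (+_)
open import Data.Rational using (ℚ; 0ℚ; 1ℚ; _+_; _*_; _-_; _<_; _≤_; _/_)
open import Data.List using (List; []; _∷_; _++_; map; length; filterᵇ; foldr)
open import Data.List.Membership.Propositional using (_∈_)
open import Data.List.Relation.Unary.Unique.Propositional using (Unique)
open import Data.Vec using (Vec; []; _∷_)
open import Data.Product using (_×_; _,_; Σ; ∃; ∃-syntax)
open import Relation.Binary.PropositionalEquality using (_≡_; _≢_)

Point : ℕ → Set
Point n = Vec Bool n

cube : (n : ℕ) → List (Point n)
cube zero = [] ∷ []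
cube (suc n) = map (true ∷_) (cube n) ++ map (false ∷_) (cube n)

-- All sublists of a list: for the cube these are exactly the subsets of {0,1}^n,
-- each listed once (elements in cube order).
sublists : {A : Set} → List A → List (List A)
sublists [] = [] ∷ []
sublists (x ∷ xs) = map (x ∷_) (sublists xs) ++ sublists xs

pow : ℚ → ℕ → ℚ
pow q zero = 1ℚ
pow q (suc k) = q * pow q k

ℕtoℚ : ℕ → ℚ
ℕtoℚ k = + k / 1

-- Probability of the outcome U (a subset of {0,1}^n) in the model P_{n,p}:
-- p^|U| (1-p)^(2^n - |U|).
weight : (n : ℕ) → ℚ → List (Point n) → ℚ
weight n p U = pow p (length U) * pow (1ℚ - p) (2 ℕ.^ n ℕ.∸ length U)

dot : {n : ℕ} → Vec ℚ n → Point n → ℚ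
dot [] [] = 0ℚ
dot (c ∷ cs) (true ∷ xs) = c + dot cs xs
dot (c ∷ cs) (false ∷ xs) = dot cs xs

-- u v is an edge (1-dimensional face) of conv(U): u ≠ v are in U and some linear
-- functional c attains its maximum over U exactly at {u, v}.
IsEdge : {n : ℕ} → List (Point n) → Point n → Point n → Set
IsEdge {n} U u v =
  u ∈ U × v ∈ U × u ≢ v ×
  Σ (Vec ℚ n) (λ c → dot c u ≡ dot c v ×
     ((w : Point n) → w ∈ U → w ≢ u → w ≢ v → dot c w < dot c u))

-- Subset A of U given by a selector a (every subset of U arises this way).
sub : {n : ℕ} → (Point n → Bool) → List (Point n) → List (Point n)
sub a U = filterᵇ a U

-- e_G(A, V \ A) ≥ k : there are k distinct edges between A = sub a U and U \ A,
-- each recorded as the ordered pair (endpoint in A, endpoint outside A).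
EdgesAtLeast : {n : ℕ} → List (Point n) → (Point n → Bool) → ℕ → Set
EdgesAtLeast {n} U a k =
  Σ (List (Point n × Point n)) (λ es →
    Unique es × k ℕ.≤ length es ×
    ((u v : Point n) → (u , v) ∈ es →
       a u ≡ true × a v ≡ false × IsEdge U u v))

ExpansionAtLeast : {n : ℕ} → List (Point n) → ℚ → Set
ExpansionAtLeast {n} U β =
  (a : Point n → Bool) →
  1 ℕ.≤ length (sub a U) → 2 ℕ.* length (sub a U) ℕ.≤ length U →
  ∃[ k ] (β * ℕtoℚ (length (sub a U)) ≤ ℕtoℚ k × EdgesAtLeast U a k)

SmallSetsExpand : {n : ℕ} → List (Point n) → ℚ → Set
SmallSetsExpand {n} U η =
  (a : Point n → Bool) →
  ℕtoℚ (length (sub a U)) ≤ η * ℕtoℚ (length U) →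
  EdgesAtLeast U a (length (sub a U))

GoodEvent : {n : ℕ} → ℚ → ℚ → List (Point n) → Set
GoodEvent β η U = ExpansionAtLeast U β × SmallSetsExpand U η

selectedWeight : (n : ℕ) → ℚ → (List (Point n) → Bool) → ℚ
selectedWeight n p sel =
  foldr (λ U acc → (if′ sel U then weight n p U else 0ℚ) + acc) 0ℚ (sublists (cube n))
  where
    if′_then_else_ : Bool → ℚ → ℚ → ℚ
    if′ true then x else y = x
    if′ false then x else y = y

ProbAtLeast : (n : ℕ) → ℚ → (List (Point n) → Set) → ℚ → Set
ProbAtLeast n p E r =
  Σ (List (Point n) → Bool) (λ sel →
    ((U : List (Point n)) → U ∈ sublists (cube n) → sel U ≡ true → E U) ×
    r ≤ selectedWeight n p sel)

{-# OPTIONS --safe #-}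
module Submission where

-- Split {0,1}ⁿ = {0,1}ᵐ × {0,1}ᵏ with 2ᵏ p between two constants, so that the 2ᵐ fibres ("blocks") of U have constant
-- expected size; since p ≥ 2^(−0.99 n), m grows linearly in n.  With high probability every x ∈ {0,1}ᵐ has at most m/64
-- neighbours with an empty block, and its neighbouring blocks contain at most C m points in total: both bounds fail at a
-- given x with probability O(2^(−2m)), which beats the 2ᵐ choices of x.
--
-- Two kinds of edges of the polytope suffice.  A point u is joined to the nearest point (in Hamming distance) of every
-- nonempty neighbouring block, and in a block met by both sides of a partition U = A ∪ B a closest pair of points of A
-- and B is joined.  Let X, Y be the sets of blocks met by A, B and e the number of edges found between A and B.  Then
-- (a) |A| ≤ O(e/m + |X|), because each point of A has about m edges, which are cut or lead to blocks in X;
-- (b) e is at least the number of cube edges between X and Y \ X;  (c) e ≥ |X ∩ Y|.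
-- As empty blocks are locally sparse, assigning them by majority vote turns (b) into the edge-isoperimetric inequality
-- of {0,1}ᵐ: up to a factor 2, e ≥ t |X| whenever |X| ≤ 2^(m − t − 2).

-- All edges of a random polytope are hard to describe, but one edge is certified by one functional;
-- so only edges with an explicit functional are counted. The block size is a compromise. Larger
-- blocks raise the constant in (a). In smaller ones emptiness is too likely: a block of expected
-- size at least 256 is empty with probability at most 2^(-256), so that m/64 empty neighbours are
-- rare enough for a union bound over exponentially many x. Two regimes need separate care. If A and
-- B both meet nearly all blocks, (b) may be void, since almost every block can be mixed; then (c)
-- takes over. For small sets the bound e ≥ |A| has constant 1, whereas (a) loses a factor of order
-- C on |X|. Only the logarithmic gain of the isoperimetric inequality repairs this: with t = 4C the
-- boundary outweighs the loss, which makes η of order 2^(-4C). Majority voting must not create many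
-- new boundary edges. This is a local argument: a boundary edge at an empty block is charged to
-- edges between X and the rest near it, and each of those is close to few empty blocks.

-- Finite sums, and the cube as a graph.

module FiniteSums where

  open import Defs using (cube)
  open import Data.Bool using (Bool; true; false; not; _∧_)
  open import Data.Bool.Properties using (not-involutive)
  open import Data.Nat
  open import Data.Nat.Properties
  open import Data.Nat.Tactic.RingSolver using (solve-∀)
  open import Data.Fin using (Fin; zero; suc)
  open import Data.List using (List; []; _∷_; _++_; map; length)
  open import Data.List.Membership.Propositional using (_∈_)
  open import Data.List.Membership.Propositional.Properties using (∈-map⁺; ∈-++⁺ˡ; ∈-++⁺ʳ)
  open import Data.List.Relation.Unary.Any using (here; there)
  open import Data.List.Properties using (length-map; length-++)
  open import Data.Vec using (Vec; []; _∷_) renaming (_++_ to _⊕_)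
  open import Relation.Binary.PropositionalEquality using (_≡_; refl; sym; trans; cong; cong₂)

  private
    variable
      I J : Set
      m k : ℕ

  ∑ : List I → (I → ℕ) → ℕ
  ∑ [] f = 0
  ∑ (x ∷ xs) f = f x + ∑ xs f

  ∑-cong : (xs : List I) {f g : I → ℕ} → (∀ x → f x ≡ g x) → ∑ xs f ≡ ∑ xs g
  ∑-cong [] h = refl
  ∑-cong (x ∷ xs) h = cong₂ _+_ (h x) (∑-cong xs h)

  ∑-mono : (xs : List I) {f g : I → ℕ} → (∀ x → f x ≤ g x) → ∑ xs f ≤ ∑ xs g
  ∑-mono [] h = z≤n
  ∑-mono (x ∷ xs) h = +-mono-≤ (h x) (∑-mono xs h)

  ∑-+ : (xs : List I) (f g : I → ℕ) → ∑ xs (λ x → f x + g x) ≡ ∑ xs f + ∑ xs g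
  ∑-+ [] f g = refl
  ∑-+ (x ∷ xs) f g = trans (cong ((f x + g x) +_) (∑-+ xs f g)) (shuffle (f x) (g x) (∑ xs f) (∑ xs g))
    where
    shuffle : ∀ a b c d → (a + b) + (c + d) ≡ (a + c) + (b + d)
    shuffle = solve-∀

  ∑∑-+ : (xs : List I) (ys : List J) (f g : I → J → ℕ) →
          ∑ xs (λ x → ∑ ys (λ y → f x y + g x y)) ≡ ∑ xs (λ x → ∑ ys (f x)) + ∑ xs (λ x → ∑ ys (g x))
  ∑∑-+ xs ys f g = trans (∑-cong xs (λ x → ∑-+ ys (f x) (g x))) (∑-+ xs _ _)

  ∑-*ˡ : (c : ℕ) (xs : List I) (f : I → ℕ) → ∑ xs (λ x → c * f x) ≡ c * ∑ xs f
  ∑-*ˡ c [] f = sym (*-zeroʳ c)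
  ∑-*ˡ c (x ∷ xs) f = trans (cong (c * f x +_) (∑-*ˡ c xs f)) (sym (*-distribˡ-+ c (f x) (∑ xs f)))

  ∑-*ʳ : (c : ℕ) (xs : List I) (f : I → ℕ) → ∑ xs (λ x → f x * c) ≡ ∑ xs f * c
  ∑-*ʳ c xs f = trans (∑-cong xs (λ x → *-comm (f x) c)) (trans (∑-*ˡ c xs f) (*-comm c (∑ xs f)))

  ∑-0 : (xs : List I) → ∑ xs (λ _ → 0) ≡ 0
  ∑-0 [] = refl
  ∑-0 (x ∷ xs) = ∑-0 xs

  ∑-const : (xs : List I) (c : ℕ) → ∑ xs (λ _ → c) ≡ length xs * c
  ∑-const [] c = refl
  ∑-const (x ∷ xs) c = cong (c +_) (∑-const xs c)

  ∑-swap : (xs : List I) (ys : List J) (f : I → J → ℕ) →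
           ∑ xs (λ x → ∑ ys (f x)) ≡ ∑ ys (λ y → ∑ xs (λ x → f x y))
  ∑-swap [] ys f = sym (∑-0 ys)
  ∑-swap (x ∷ xs) ys f =
    trans (cong (∑ ys (f x) +_) (∑-swap xs ys f)) (sym (∑-+ ys (f x) _))

  ∑-++ : (xs ys : List I) (f : I → ℕ) → ∑ (xs ++ ys) f ≡ ∑ xs f + ∑ ys f
  ∑-++ [] ys f = refl
  ∑-++ (x ∷ xs) ys f = trans (cong (f x +_) (∑-++ xs ys f)) (sym (+-assoc (f x) _ _))

  ∑-map : (g : I → J) (xs : List I) (f : J → ℕ) → ∑ (map g xs) f ≡ ∑ xs (λ x → f (g x))
  ∑-map g [] f = refl
  ∑-map g (x ∷ xs) f = cong (f (g x) +_) (∑-map g xs f)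

  ∑-∈ : {xs : List I} (f : I → ℕ) {x : I} → x ∈ xs → f x ≤ ∑ xs f
  ∑-∈ {xs = x ∷ xs} f (here refl) = m≤m+n (f x) _
  ∑-∈ {xs = y ∷ xs} f (there x∈) = ≤-trans (∑-∈ f x∈) (m≤n+m _ (f y))

  Q : ℕ → Set
  Q = Vec Bool

  ι : Bool → ℕ
  ι true = 1
  ι false = 0

  ι-∧ : ∀ a b → ι (a ∧ b) ≡ ι a * ι b
  ι-∧ true b = sym (+-identityʳ (ι b))
  ι-∧ false b = refl

  ι≤1 : ∀ a → ι a ≤ 1
  ι≤1 true = ≤-refl
  ι≤1 false = z≤n

  fins : (m : ℕ) → List (Fin m)
  fins zero = []
  fins (suc m) = zero ∷ map suc (fins m)

  length-fins : ∀ m → length (fins m) ≡ m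
  length-fins zero = refl
  length-fins (suc m) = cong suc (trans (length-map suc (fins m)) (length-fins m))

  ∑-fins-suc : (f : Fin (suc m) → ℕ) → ∑ (fins (suc m)) f ≡ f zero + ∑ (fins m) (λ i → f (suc i))
  ∑-fins-suc {m} f = cong (f zero +_) (∑-map suc (fins m) f)

  ∑-fins-const : ∀ m c → ∑ (fins m) (λ _ → c) ≡ m * c
  ∑-fins-const m c = trans (∑-const (fins m) c) (cong (_* c) (length-fins m))

  ∈-cube : (x : Q m) → x ∈ cube m
  ∈-cube [] = here refl
  ∈-cube {suc m} (true ∷ x) = ∈-++⁺ˡ (∈-map⁺ (true ∷_) (∈-cube x))
  ∈-cube {suc m} (false ∷ x) = ∈-++⁺ʳ (map (true ∷_) (cube m)) (∈-map⁺ (false ∷_) (∈-cube x))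

  length-cube : ∀ m → length (cube m) ≡ 2 ^ m
  length-cube zero = refl
  length-cube (suc m) = trans (length-++ (map (true ∷_) (cube m)))
    (cong₂ _+_ (trans (length-map (true ∷_) (cube m)) (length-cube m))
      (trans (length-map (false ∷_) (cube m)) (trans (length-cube m) (sym (+-identityʳ (2 ^ m))))))

  ∑-cube-suc : (f : Q (suc m) → ℕ) →
               ∑ (cube (suc m)) f ≡ ∑ (cube m) (λ x → f (true ∷ x)) + ∑ (cube m) (λ x → f (false ∷ x))
  ∑-cube-suc {m} f = trans (∑-++ (map (true ∷_) (cube m)) (map (false ∷_) (cube m)) f)
    (cong₂ _+_ (∑-map (true ∷_) (cube m) f) (∑-map (false ∷_) (cube m) f))

  ∑-cube-+ : ∀ m (f : Q (m + k) → ℕ) →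
             ∑ (cube (m + k)) f ≡ ∑ (cube m) (λ x → ∑ (cube k) (λ p → f (x ⊕ p)))
  ∑-cube-+ zero f = sym (+-identityʳ _)
  ∑-cube-+ (suc m) f = trans (∑-cube-suc f)
    (trans (cong₂ _+_ (∑-cube-+ m (λ x → f (true ∷ x))) (∑-cube-+ m (λ x → f (false ∷ x))))
           (sym (∑-cube-suc {m} _)))

  ∑-cube-const : ∀ m c → ∑ (cube m) (λ _ → c) ≡ 2 ^ m * c
  ∑-cube-const m c = trans (∑-const (cube m) c) (cong (_* c) (length-cube m))

  flip : Fin m → Q m → Q m
  flip zero (b ∷ x) = not b ∷ x
  flip (suc i) (b ∷ x) = b ∷ flip i x

  flip² : (i : Fin m) (x : Q m) → flip i (flip i x) ≡ x
  flip² zero (b ∷ x) = cong (_∷ x) (not-involutive b)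
  flip² (suc i) (b ∷ x) = cong (b ∷_) (flip² i x)

  flip-comm : (i j : Fin m) (x : Q m) → flip i (flip j x) ≡ flip j (flip i x)
  flip-comm zero zero (b ∷ x) = refl
  flip-comm zero (suc j) (b ∷ x) = refl
  flip-comm (suc i) zero (b ∷ x) = refl
  flip-comm (suc i) (suc j) (b ∷ x) = cong (b ∷_) (flip-comm i j x)

  ∑-flip : (i : Fin m) (f : Q m → ℕ) → ∑ (cube m) (λ x → f (flip i x)) ≡ ∑ (cube m) f
  ∑-flip {suc m} zero f = trans (∑-cube-suc {m} _) (trans (+-comm (∑ (cube m) (λ x → f (false ∷ x))) _) (sym (∑-cube-suc f)))
  ∑-flip {suc m} (suc i) f = trans (∑-cube-suc {m} _)
    (trans (cong₂ _+_ (∑-flip i (λ x → f (true ∷ x))) (∑-flip i (λ x → f (false ∷ x)))) (sym (∑-cube-suc f)))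

  -- For each direction `i`, substituting `flip i x` for `x` permutes the cube and is its own
  -- inverse; this reverses all directed edges.
  ∑-edge-swap : (f : Q m → Q m → ℕ) →
    ∑ (cube m) (λ x → ∑ (fins m) (λ i → f x (flip i x))) ≡ ∑ (cube m) (λ x → ∑ (fins m) (λ i → f (flip i x) x))
  ∑-edge-swap {m} f = trans (∑-swap (cube m) (fins m) _) (trans
    (∑-cong (fins m) λ i → trans (sym (∑-flip i (λ x → f x (flip i x))))
       (∑-cong (cube m) λ x → cong (f (flip i x)) (flip² i x)))
    (∑-swap (fins m) (cube m) _))

-- The edge-isoperimetric inequality of the cube.

module Isoperimetry where

  open FiniteSums
  open import Defs using (cube)
  open import Data.Bool using (Bool; true; false; not; _∨_)
  open import Data.Nat
  open import Data.Nat.Properties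
  open import Data.Nat.Tactic.RingSolver using (solve-∀)
  open import Data.Fin using (zero; suc)
  open import Data.List using ([]; _∷_)
  open import Data.Vec using ([]; _∷_)
  open import Data.Product using (∃-syntax; _×_; _,_)
  open import Data.Sum using (inj₁; inj₂)
  open import Relation.Nullary using (yes; no)
  open import Relation.Binary.PropositionalEquality using (_≡_; refl; sym; trans; cong; cong₂; subst; subst₂)

  private
    variable
      m : ℕ

  ∣_∣ : (Q m → Bool) → ℕ
  ∣_∣ {m} X = ∑ (cube m) (λ x → ι (X x))

  ∂ : (Q m → Bool) → (Q m → Bool) → ℕ
  ∂ {m} X Y = ∑ (cube m) (λ x → ∑ (fins m) (λ i → ι (X x) * ι (Y (flip i x))))

  ∁ : (Q m → Bool) → Q m → Bool
  ∁ X x = not (X x)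

  ∂-sym : (X Y : Q m → Bool) → ∂ X Y ≡ ∂ Y X
  ∂-sym {m} X Y = trans (∑-edge-swap (λ x y → ι (X x) * ι (Y y)))
    (∑-cong (cube m) λ x → ∑-cong (fins m) λ i → *-comm (ι (X (flip i x))) (ι (Y x)))

  -- The lower bound e ≥ m N − φ(N), where φ interpolates N log₂ N linearly between powers of two.
  data Isop (m N e : ℕ) : Set where
    empty : N ≡ 0 → Isop m N e
    chord : ∃[ r ] (2 ^ r ≤ N × N < 2 ^ suc r × m * N + 2 ^ suc r ≤ e + (2 + r) * N) → Isop m N e

  Isop-mono : ∀ {m N e e'} → e ≤ e' → Isop m N e → Isop m N e'
  Isop-mono le (empty z) = empty z
  Isop-mono {N = N} le (chord (r , lo , hi , h)) = chord (r , lo , hi , ≤-trans h (+-monoˡ-≤ ((2 + r) * N) le))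

  2*2^ : ∀ r → 2 ^ suc r ≡ 2 ^ r + 2 ^ r
  2*2^ r = cong (2 ^ r +_) (+-identityʳ (2 ^ r))

  bracket-unique : ∀ {s t a b} → 2 ^ t ≤ b → b ≤ a → a < 2 ^ suc s → t ≤ s
  bracket-unique {s} {t} lo b≤a hi with t ≤? s
  ... | yes p = p
  ... | no p with () ← <-irrefl refl (<-≤-trans hi (≤-trans (^-monoʳ-≤ 2 (≰⇒> p)) (≤-trans lo b≤a)))

  -- Two half-cubes carry `a` ≥ `b` points, and at least a - b of the edges between the halves leave
  -- the set. The claim is thus φ(a + b) ≥ φ(a) + φ(b) + 2b. As φ(N) is the maximum over r of the
  -- chords (2 + r)N - 2^(r+1), passing to the bracket that contains a + b only helps.
  Isop-merge : ∀ {m a b e₁ e₂ d} → b ≤ a → a ≤ b + d →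
               Isop m a e₁ → Isop m b e₂ → Isop (suc m) (a + b) (e₁ + e₂ + d)
  Isop-merge b≤a a≤b+d (empty refl) (empty refl) = empty refl
  Isop-merge z≤n a≤b+d (empty refl) (chord (r , lo , hi , h)) with () ← <⇒≱ (m^n>0 2 r) lo
  Isop-merge {m} {a} {_} {e₁} {e₂} {d} b≤a a≤d (chord (r , lo , hi , h)) (empty refl)
    rewrite +-identityʳ a = chord (r , lo , hi , (begin
      a + m * a + 2 ^ suc r          ≡⟨ +-assoc a (m * a) _ ⟩
      a + (m * a + 2 ^ suc r)        ≤⟨ +-mono-≤ a≤d h ⟩
      d + (e₁ + (2 + r) * a)         ≤⟨ +-monoˡ-≤ _ (m≤m+n d e₂) ⟩
      d + e₂ + (e₁ + (2 + r) * a)    ≡⟨ shuffle d e₂ e₁ _ ⟩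
      e₁ + e₂ + d + (2 + r) * a      ∎))
    where
    open ≤-Reasoning
    shuffle : ∀ d e f g → d + e + (f + g) ≡ f + e + d + g
    shuffle = solve-∀
  Isop-merge {m} {a} {b} {e₁} {e₂} {d} b≤a a≤b+d (chord (s , slo , shi , sh)) (chord (t , tlo , thi , th))
    with m≤n⇒m<n∨m≡n (bracket-unique {s} {t} tlo b≤a shi)
  ... | inj₂ refl = chord (suc s ,
        subst (_≤ a + b) (sym (2*2^ s)) (+-mono-≤ slo tlo) ,
        subst (a + b <_) (sym (2*2^ (suc s))) (+-mono-< shi thi) , (begin
      suc m * (a + b) + 2 ^ (2 + s)                                   ≡⟨ cong (suc m * (a + b) +_) (2*2^ (suc s)) ⟩
      suc m * (a + b) + (2 ^ suc s + 2 ^ suc s)                       ≡⟨ e₃ m a b (2 ^ suc s) ⟩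
      (m * a + 2 ^ suc s) + (m * b + 2 ^ suc s) + (a + b)             ≤⟨ +-mono-≤ (+-mono-≤ sh th) (+-monoˡ-≤ b a≤b+d) ⟩
      (e₁ + (2 + s) * a) + (e₂ + (2 + s) * b) + (b + d + b)           ≤⟨ +-monoʳ-≤ ((e₁ + (2 + s) * a) + (e₂ + (2 + s) * b)) (+-monoʳ-≤ (b + d) b≤a) ⟩
      (e₁ + (2 + s) * a) + (e₂ + (2 + s) * b) + (b + d + a)           ≡⟨ e₄ e₁ e₂ s a b d ⟩
      e₁ + e₂ + d + (2 + suc s) * (a + b)                             ∎))
    where
    open ≤-Reasoning
    e₃ : ∀ m a b p → suc m * (a + b) + (p + p) ≡ (m * a + p) + (m * b + p) + (a + b)
    e₃ = solve-∀
    e₄ : ∀ e₁ e₂ s a b d → (e₁ + (2 + s) * a) + (e₂ + (2 + s) * b) + (b + d + a) ≡ e₁ + e₂ + d + (2 + suc s) * (a + b)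
    e₄ = solve-∀
  ... | inj₁ t<s = pick (a + b <? 2 ^ suc s)
    where
    open ≤-Reasoning
    e₅ : ∀ m a b p q → suc m * (a + b) + p + q ≡ (m * a + p) + (m * b + q) + (a + b)
    e₅ = solve-∀
    e₆ : ∀ e₁ e₂ s t a b d → (e₁ + (2 + s) * a) + (e₂ + (2 + t) * b) + (b + d + b) ≡ e₁ + e₂ + d + (2 + s) * a + (3 + t) * b + b
    e₆ = solve-∀
    e₇ : ∀ x s a b p → x + (2 + s) * a + (2 + s) * b + p ≡ x + (2 + s) * (a + b) + p
    e₇ = solve-∀
    -- The chord of `b` plus 2b is (3 + t)b + (b - 2^(t+1)); b < 2^(t+1) and t < s bring it below (2
    -- + s)b.
    line : suc m * (a + b) + 2 ^ suc s ≤ e₁ + e₂ + d + (2 + s) * (a + b)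
    line = +-cancelʳ-≤ (2 ^ suc t) _ _ (begin
      suc m * (a + b) + 2 ^ suc s + 2 ^ suc t                  ≡⟨ e₅ m a b _ _ ⟩
      (m * a + 2 ^ suc s) + (m * b + 2 ^ suc t) + (a + b)      ≤⟨ +-mono-≤ (+-mono-≤ sh th) (+-monoˡ-≤ b a≤b+d) ⟩
      (e₁ + (2 + s) * a) + (e₂ + (2 + t) * b) + (b + d + b)    ≡⟨ e₆ e₁ e₂ s t a b d ⟩
      e₁ + e₂ + d + (2 + s) * a + (3 + t) * b + b              ≤⟨ +-mono-≤ (+-monoʳ-≤ (e₁ + e₂ + d + (2 + s) * a) (*-monoˡ-≤ b (s≤s (s≤s t<s)))) (<⇒≤ thi) ⟩
      e₁ + e₂ + d + (2 + s) * a + (2 + s) * b + 2 ^ suc t      ≡⟨ e₇ (e₁ + e₂ + d) s a b _ ⟩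
      e₁ + e₂ + d + (2 + s) * (a + b) + 2 ^ suc t              ∎)
    pick : _ → Isop (suc m) (a + b) (e₁ + e₂ + d)
    pick (yes p) = chord (s , ≤-trans slo (m≤m+n a b) , p , line)
    -- The sum has left the bracket of `a`. The next chord exceeds this one by (a + b) - 2^(s+1),
    -- which is nonnegative here.
    pick (no p) = chord (suc s , ≮⇒≥ p ,
      subst (a + b <_) (sym (2*2^ (suc s))) (+-mono-<-≤ shi (≤-trans b≤a (<⇒≤ shi))) , (begin
      suc m * (a + b) + 2 ^ (2 + s)                            ≡⟨ cong (suc m * (a + b) +_) (2*2^ (suc s)) ⟩
      suc m * (a + b) + (2 ^ suc s + 2 ^ suc s)                ≡⟨ +-assoc (suc m * (a + b)) _ _ ⟨
      suc m * (a + b) + 2 ^ suc s + 2 ^ suc s                  ≤⟨ +-mono-≤ line (≮⇒≥ p) ⟩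
      e₁ + e₂ + d + (2 + s) * (a + b) + (a + b)                ≡⟨ e₈ (e₁ + e₂ + d) s (a + b) ⟩
      e₁ + e₂ + d + (2 + suc s) * (a + b)                      ∎))
      where
      e₈ : ∀ x s n → x + (2 + s) * n + n ≡ x + (2 + suc s) * n
      e₈ = solve-∀

  ι-diff : ∀ a b → ι a ≤ ι b + ι a * ι (not b)
  ι-diff true true = s≤s z≤n
  ι-diff true false = s≤s z≤n
  ι-diff false b = z≤n

  ∂∁-suc : (X : Q (suc m) → Bool) →
    ∂ X (∁ X) ≡ (∂ (λ x → X (true ∷ x)) (∁ (λ x → X (true ∷ x))) + ∂ (λ x → X (false ∷ x)) (∁ (λ x → X (false ∷ x))))
              + (∑ (cube m) (λ x → ι (X (true ∷ x)) * ι (not (X (false ∷ x))))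
              + ∑ (cube m) (λ x → ι (X (false ∷ x)) * ι (not (X (true ∷ x)))))
  ∂∁-suc {m} X = trans (∑-cube-suc {m} _) (trans (cong₂ _+_ (half true) (half false)) (shuffle (D true) (E true) (D false) (E false)))
    where
    D E : Bool → ℕ
    D b = ∑ (cube m) (λ x → ι (X (b ∷ x)) * ι (not (X (not b ∷ x))))
    E b = ∂ (λ x → X (b ∷ x)) (∁ (λ x → X (b ∷ x)))
    half : ∀ b → ∑ (cube m) (λ x → ∑ (fins (suc m)) (λ i → ι (X (b ∷ x)) * ι (not (X (flip i (b ∷ x)))))) ≡ D b + E b
    half b = trans (∑-cong (cube m) λ x → ∑-fins-suc {m} _) (∑-+ (cube m) _ _)
    shuffle : ∀ a b c d → (a + b) + (c + d) ≡ (b + d) + (a + c)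
    shuffle = solve-∀

  isop : ∀ m (X : Q m → Bool) → Isop m ∣ X ∣ (∂ X (∁ X))
  isop zero X with X []
  ... | true = chord (0 , s≤s z≤n , s≤s (s≤s z≤n) , s≤s (s≤s z≤n))
  ... | false = empty refl
  isop (suc m) X = subst₂ (Isop (suc m)) (sym (∑-cube-suc (λ x → ι (X x)))) (sym (∂∁-suc X)) merged
    where
    X₁ X₀ : Q m → Bool
    X₁ x = X (true ∷ x)
    X₀ x = X (false ∷ x)
    diff : (Y Z : Q m → Bool) → ∣ Y ∣ ≤ ∣ Z ∣ + ∑ (cube m) (λ x → ι (Y x) * ι (not (Z x)))
    diff Y Z = ≤-trans (∑-mono (cube m) λ x → ι-diff (Y x) (Z x)) (≤-reflexive (∑-+ (cube m) _ _))
    E = ∂ X₁ (∁ X₁) + ∂ X₀ (∁ X₀) +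
      (∑ (cube m) (λ x → ι (X₁ x) * ι (not (X₀ x))) + ∑ (cube m) (λ x → ι (X₀ x) * ι (not (X₁ x))))
    merged : Isop (suc m) (∣ X₁ ∣ + ∣ X₀ ∣) E
    -- Of the edges between the halves, only those that start in the larger half are kept.
    merged with ≤-total ∣ X₀ ∣ ∣ X₁ ∣
    ... | inj₁ le = Isop-mono (+-monoʳ-≤ (∂ X₁ (∁ X₁) + ∂ X₀ (∁ X₀)) (m≤m+n _ _))
          (Isop-merge le (diff X₁ X₀) (isop m X₁) (isop m X₀))
    ... | inj₂ le = subst (λ N → Isop (suc m) N E) (+-comm ∣ X₀ ∣ ∣ X₁ ∣)
          (Isop-mono (+-mono-≤ (≤-reflexive (+-comm (∂ X₀ (∁ X₀)) (∂ X₁ (∁ X₁)))) (m≤n+m _ _))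
            (Isop-merge le (diff X₀ X₁) (isop m X₀) (isop m X₁)))

  -- With a = m - t, every N ≤ 2^a has φ(N) ≤ aN: in a bracket r < a because N < 2^(r+1) gives φ(N)
  -- ≤ (r + 1)N, and in the bracket r = a because N can only be 2^a.
  edge-isoperimetry : ∀ t (X : Q m → Bool) → t ≤ m → 2 ^ t * ∣ X ∣ ≤ 2 ^ m → t * ∣ X ∣ ≤ ∂ X (∁ X)
  edge-isoperimetry {m} t X t≤m small' with isop m X
  ... | empty z rewrite z | *-zeroʳ t = z≤n
  ... | chord (r , lo , hi , h) = +-cancelʳ-≤ (a * N + 2 ^ suc r) _ _ (begin
      t * N + (a * N + 2 ^ suc r)    ≡⟨ e₁ t a N _ ⟩
      (a + t) * N + 2 ^ suc r        ≡⟨ cong (λ m → m * N + 2 ^ suc r) a+t ⟩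
      m * N + 2 ^ suc r              ≤⟨ h ⟩
      e + (2 + r) * N                ≤⟨ +-monoʳ-≤ e bound ⟩
      e + (a * N + 2 ^ suc r)        ∎)
    where
    open ≤-Reasoning
    a = m ∸ t
    a+t : a + t ≡ m
    a+t = m∸n+n≡m t≤m
    N = ∣ X ∣
    e = ∂ X (∁ X)
    small : N ≤ 2 ^ a
    small = *-cancelˡ-≤ (2 ^ t) {{m^n≢0 2 t}} (≤-trans small' (≤-reflexive
      (trans (cong (2 ^_) (trans (sym a+t) (+-comm a t))) (^-distribˡ-+-* 2 t a))))
    e₁ : ∀ t a n p → t * n + (a * n + p) ≡ (a + t) * n + p
    e₁ = solve-∀
    e₂ : ∀ r n → (2 + r) * n ≡ r * n + (n + n)
    e₂ = solve-∀
    e₃ : ∀ r n → (2 + r) * n ≡ suc r * n + n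
    e₃ = solve-∀
    r≤a : r ≤ a
    r≤a = bracket-unique {a} {r} lo small (^-monoʳ-< 2 (s≤s (s≤s z≤n)) (n<1+n a))
    bound : (2 + r) * N ≤ a * N + 2 ^ suc r
    bound with m≤n⇒m<n∨m≡n r≤a
    ... | inj₂ refl = ≤-trans (≤-reflexive (e₂ r N)) (+-monoʳ-≤ (r * N)
            (≤-trans (+-mono-≤ small small) (≤-reflexive (sym (2*2^ r)))))
    ... | inj₁ r<a = ≤-trans (≤-reflexive (e₃ r N)) (+-mono-≤ (*-monoˡ-≤ N r<a) (<⇒≤ hi))

-- Deciding a locally sparse set of vertices by majority vote.

module MajorityExtension where

  open FiniteSums
  open Isoperimetry
  open import Defs using (cube)
  open import Data.Bool using (Bool; true; false; not; _∧_; _∨_; T)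
  open import Data.Bool.Properties using (∨-comm)
  open import Data.Nat
  open import Data.Nat.Properties
  open import Data.Nat.Tactic.RingSolver using (solve-∀)
  open import Data.Fin using (Fin)
  open import Data.Product using (_,_)
  open import Data.Unit using (tt)
  open import Data.Empty using (⊥-elim)
  open import Relation.Nullary using (yes; no)
  open import Relation.Binary.PropositionalEquality using (_≡_; refl; sym; trans; cong; cong₂; subst; subst₂)

  private
    variable
      m : ℕ

  deg : (Q m → Bool) → Q m → ℕ
  deg {m} X x = ∑ (fins m) (λ i → ι (X (flip i x)))

  ι-guard : ∀ b {p q} → (b ≡ true → p ≤ q) → ι b * p ≤ ι b * q
  ι-guard true h = *-monoʳ-≤ 1 (h refl)
  ι-guard false h = z≤n

  ∑∑-deg : (Y : Q m → Bool) → ∑ (cube m) (deg Y) ≡ m * ∣ Y ∣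
  ∑∑-deg {m} Y = trans (∑-swap (cube m) (fins m) _)
    (trans (∑-cong (fins m) λ i → ∑-flip i (λ x → ι (Y x))) (∑-fins-const m ∣ Y ∣))

  module Partition (X Z : Q m → Bool) (disjoint : ∀ x → X x ∧ Z x ≡ false)
                   (sparse : ∀ x → 64 * deg (λ y → not (X y ∨ Z y)) x ≤ m) where

    O : Q m → Bool
    O x = not (X x ∨ Z x)

    -- Counts X-Z edges once for each end adjacent to `x`. These pay for the boundary edges that
    -- deciding `x` may create.
    D : Q m → ℕ
    D x = ∑ (fins m) (λ j → ∑ (fins m) (λ l →
      ι (X (flip j x)) * ι (Z (flip l (flip j x))) + ι (Z (flip j x)) * ι (X (flip l (flip j x)))))

    DXZ DZX : Q m → ℕ
    DXZ x = ∑ (fins m) (λ j → ∑ (fins m) (λ l → ι (X (flip j x)) * ι (Z (flip l (flip j x)))))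
    DZX x = ∑ (fins m) (λ j → ∑ (fins m) (λ l → ι (Z (flip j x)) * ι (X (flip l (flip j x)))))

    D≡ : ∀ x → D x ≡ DXZ x + DZX x
    D≡ x = ∑∑-+ (fins m) (fins m) _ _

    deg-total : ∀ x → deg X x + deg Z x + deg O x ≡ m
    deg-total x = trans (sym (trans (∑-+ (fins m) _ _) (cong (_+ deg O x) (∑-+ (fins m) _ _))))
      (trans (∑-cong (fins m) λ i → one (X (flip i x)) (Z (flip i x)) (disjoint (flip i x)))
        (trans (∑-fins-const m 1) (*-identityʳ m)))
      where
      one : ∀ p q → p ∧ q ≡ false → ι p + ι q + ι (not (p ∨ q)) ≡ 1
      one true false _ = refl
      one false true _ = refl
      one false false _ = refl

    many : ∀ x → 63 * m ≤ 64 * (deg X x + deg Z x)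
    many x = +-cancelʳ-≤ (64 * deg O x) _ _ (begin
      63 * m + 64 * deg O x                        ≤⟨ +-monoʳ-≤ (63 * m) (sparse x) ⟩
      63 * m + m                                   ≡⟨ +-comm (63 * m) m ⟩
      64 * m                                       ≡⟨ cong (64 *_) (deg-total x) ⟨
      64 * (deg X x + deg Z x + deg O x)           ≡⟨ *-distribˡ-+ 64 (deg X x + deg Z x) (deg O x) ⟩
      64 * (deg X x + deg Z x) + 64 * deg O x      ∎)
      where open ≤-Reasoning

    majority : ∀ x {a b} → deg X x + deg Z x ≡ b + a → b ≤ a → 63 * m ≤ 128 * a
    majority x {a} {b} eq b≤a = begin
      63 * m                    ≤⟨ many x ⟩
      64 * (deg X x + deg Z x)  ≡⟨ cong (64 *_) eq ⟩
      64 * (b + a)              ≤⟨ *-monoʳ-≤ 64 (+-monoˡ-≤ a b≤a) ⟩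
      64 * (a + a)              ≡⟨ e a ⟩
      128 * a                   ∎
      where
      open ≤-Reasoning
      e : ∀ a → 64 * (a + a) ≡ 128 * a
      e = solve-∀

    -- Around a vertex x outside X ∪ Z whose neighbours are mostly in X, every neighbour in Z (or in an extension
    -- of Z by vertices with mostly Z-neighbours) forces about m/3 of the X–Z edges at distance one from x.
    module _ (x : Q m) (maj : deg Z x ≤ deg X x) where
      private
        a = deg X x
        b = deg Z x
        open ≤-Reasoning

      -- Count the squares at `x` with one neighbour in X and the other in Z. A fourth corner in Z
      -- or X completes an X-Z edge counted by `D`; a fourth corner in O is one of the at most m/64
      -- undecided neighbours of the Z-vertex. This leaves 63/128 - 1/64 = 61/128, which exceeds
      -- 1/3.
      deg-Z-bound : m * b ≤ 3 * D x
      deg-Z-bound = *-cancelˡ-≤ 61 (begin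
        61 * (m * b)        ≤⟨ +-cancelʳ-≤ (2 * (m * b)) _ _ step ⟩
        128 * D x           ≤⟨ *-monoˡ-≤ (D x) (m≤m+n 128 55) ⟩
        183 * D x           ≡⟨ *-assoc 61 3 (D x) ⟩
        61 * (3 * D x)      ∎)
        where
        ZO = ∑ (fins m) (λ l → ι (Z (flip l x)) * deg O (flip l x))
        64ZO : 64 * ZO ≤ m * b
        64ZO = begin
          64 * ZO                                                         ≡⟨ ∑-*ˡ 64 (fins m) _ ⟨
          ∑ (fins m) (λ l → 64 * (ι (Z (flip l x)) * deg O (flip l x)))   ≤⟨ ∑-mono (fins m) (λ l → pt (ι (Z (flip l x))) (sparse (flip l x))) ⟩
          ∑ (fins m) (λ l → m * ι (Z (flip l x)))                         ≡⟨ ∑-*ˡ m (fins m) _ ⟩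
          m * b                                                           ∎
          where
          e : ∀ z d → 64 * (z * d) ≡ z * (64 * d)
          e = solve-∀
          pt : ∀ z {d} → 64 * d ≤ m → 64 * (z * d) ≤ m * z
          pt z {d} h = ≤-trans (≤-reflexive (e z d)) (≤-trans (*-monoʳ-≤ z h) (≤-reflexive (*-comm z m)))
        corner : ∀ p q r s → ι p * ι q ≤ ι p * ι s + ι q * ι r + ι q * ι (not (r ∨ s))
        corner true true true true = s≤s z≤n
        corner true true true false = s≤s z≤n
        corner true true false true = s≤s z≤n
        corner true true false false = s≤s z≤n
        corner true false r s = z≤n
        corner false q r s = z≤n
        ab : a * b ≤ D x + ZO
        ab = begin
          a * b
            ≡⟨ ∑-*ʳ b (fins m) _ ⟨
          ∑ (fins m) (λ j → ι (X (flip j x)) * b)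
            ≡⟨ ∑-cong (fins m) (λ j → sym (∑-*ˡ (ι (X (flip j x))) (fins m) _)) ⟩
          ∑ (fins m) (λ j → ∑ (fins m) (λ l → ι (X (flip j x)) * ι (Z (flip l x))))
            ≤⟨ ∑-mono (fins m) (λ j → ∑-mono (fins m) (λ l →
                 subst (λ w → ι (X (flip j x)) * ι (Z (flip l x)) ≤ ι (X (flip j x)) * ι (Z (flip l (flip j x)))
                            + ι (Z (flip l x)) * ι (X w) + ι (Z (flip l x)) * ι (O w)) (flip-comm l j x)
                   (corner (X (flip j x)) (Z (flip l x)) (X (flip l (flip j x))) (Z (flip l (flip j x)))))) ⟩
          ∑ (fins m) (λ j → ∑ (fins m) (λ l → ι (X (flip j x)) * ι (Z (flip l (flip j x)))
               + ι (Z (flip l x)) * ι (X (flip j (flip l x))) + ι (Z (flip l x)) * ι (O (flip j (flip l x)))))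
            ≡⟨ trans (∑∑-+ (fins m) (fins m) _ _) (cong₂ _+_ (∑∑-+ (fins m) (fins m) _ _) refl) ⟩
          DXZ x + ∑ (fins m) (λ j → ∑ (fins m) (λ l → ι (Z (flip l x)) * ι (X (flip j (flip l x)))))
            + ∑ (fins m) (λ j → ∑ (fins m) (λ l → ι (Z (flip l x)) * ι (O (flip j (flip l x)))))
            ≡⟨ cong₂ _+_ (cong (DXZ x +_) (∑-swap (fins m) (fins m) _))
                 (trans (∑-swap (fins m) (fins m) _) (∑-cong (fins m) (λ l → ∑-*ˡ (ι (Z (flip l x))) (fins m) _))) ⟩
          DXZ x + DZX x + ZO
            ≡⟨ cong (_+ ZO) (D≡ x) ⟨
          D x + ZO ∎
        e₁ : ∀ m b → 61 * (m * b) + 2 * (m * b) ≡ (63 * m) * b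
        e₁ = solve-∀
        e₂ : ∀ d z → 128 * (d + z) ≡ 128 * d + 2 * (64 * z)
        e₂ = solve-∀
        step : 61 * (m * b) + 2 * (m * b) ≤ 128 * D x + 2 * (m * b)
        step = begin
          61 * (m * b) + 2 * (m * b)   ≡⟨ e₁ m b ⟩
          (63 * m) * b                 ≤⟨ *-monoˡ-≤ b (majority x (+-comm a b) maj) ⟩
          (128 * a) * b                ≡⟨ *-assoc 128 a b ⟩
          128 * (a * b)                ≤⟨ *-monoʳ-≤ 128 ab ⟩
          128 * (D x + ZO)             ≡⟨ e₂ (D x) ZO ⟩
          128 * D x + 2 * (64 * ZO)    ≤⟨ +-monoʳ-≤ (128 * D x) (*-monoʳ-≤ 2 64ZO) ⟩
          128 * D x + 2 * (m * b)      ∎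

      module _ (V : Q m → Bool) (V⊆O : ∀ y → V y ≡ true → O y ≡ true)
               (Vmaj : ∀ y → V y ≡ true → deg X y ≤ deg Z y) where

        -- Let y = `flip i x` be in V. The directions in which `x` sees X overlap those in which y
        -- sees Z, and each common direction gives an X-Z edge parallel to xy. As V lies in O, at
        -- most m/64 such y exist, so the errors add up to at most 2mb, which `deg-Z-bound` absorbs.
        deg-V-bound : m * deg V x ≤ 3 * D x
        deg-V-bound = *-cancelˡ-≤ 61 (begin
          61 * (m * t)                ≤⟨ step ⟩
          128 * D x + 2 * (m * b)     ≤⟨ +-monoʳ-≤ (128 * D x) (*-monoʳ-≤ 2 deg-Z-bound) ⟩
          128 * D x + 2 * (3 * D x)   ≡⟨ e₀ (D x) ⟩
          134 * D x                   ≤⟨ *-monoˡ-≤ (D x) (m≤m+n 134 49) ⟩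
          183 * D x                   ≡⟨ *-assoc 61 3 (D x) ⟩
          61 * (3 * D x)              ∎)
          where
          e₀ : ∀ d → 128 * d + 2 * (3 * d) ≡ 134 * d
          e₀ = solve-∀
          t = deg V x
          64t : 64 * t ≤ m
          64t = ≤-trans (*-monoʳ-≤ 64 (∑-mono (fins m) λ i → sub (V (flip i x)) (O (flip i x)) (V⊆O (flip i x)))) (sparse x)
            where
            sub : ∀ p q → (p ≡ true → q ≡ true) → ι p ≤ ι q
            sub true q h rewrite h refl = ≤-refl
            sub false q h = z≤n
          S : Fin m → ℕ
          S i = ∑ (fins m) (λ j → ι (X (flip j x)) * ι (Z (flip i (flip j x))))
          square : ∀ p q → ι p + ι q ≤ 1 + ι p * ι q
          square true true = s≤s (s≤s z≤n)
          square true false = s≤s z≤n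
          square false true = s≤s z≤n
          square false false = z≤n
          share : ∀ i → a + deg Z (flip i x) ≤ m + S i
          share i = begin
            a + deg Z (flip i x)
              ≡⟨ ∑-+ (fins m) _ _ ⟨
            ∑ (fins m) (λ j → ι (X (flip j x)) + ι (Z (flip j (flip i x))))
              ≤⟨ ∑-mono (fins m) (λ j → subst (λ w → ι (X (flip j x)) + ι (Z w) ≤ 1 + ι (X (flip j x)) * ι (Z (flip i (flip j x))))
                   (flip-comm i j x) (square (X (flip j x)) (Z (flip i (flip j x))))) ⟩
            ∑ (fins m) (λ j → 1 + ι (X (flip j x)) * ι (Z (flip i (flip j x))))
              ≡⟨ trans (∑-+ (fins m) _ _) (cong (_+ S i) (trans (∑-fins-const m 1) (*-identityʳ m))) ⟩
            m + S i ∎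
          e₁ : ∀ m b → 61 * m + (128 * m + 128 * b) ≡ 2 * (63 * m) + 63 * m + 128 * b
          e₁ = solve-∀
          e₂ : ∀ a b z → 2 * (64 * (a + b)) + 128 * z + 128 * b ≡ 128 * (a + z) + 256 * b
          e₂ = solve-∀
          e₃ : ∀ m s b → 128 * (m + s) + 256 * b ≡ (128 * s + 128 * b) + (128 * m + 128 * b)
          e₃ = solve-∀
          -- The bound 63m/128 on both sets of directions would not force an overlap. Using a ≥
          -- 63m/64 - b for `x` does, at the price of the error term in `b`.
          at : ∀ i → V (flip i x) ≡ true → 61 * m ≤ 128 * S i + 128 * b
          at i v = +-cancelʳ-≤ (128 * m + 128 * b) _ _ (begin
            61 * m + (128 * m + 128 * b)                            ≡⟨ e₁ m b ⟩
            2 * (63 * m) + 63 * m + 128 * b                         ≤⟨ +-monoˡ-≤ (128 * b) (+-mono-≤ (*-monoʳ-≤ 2 (many x))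
                                                                         (majority (flip i x) refl (Vmaj (flip i x) v))) ⟩
            2 * (64 * (a + b)) + 128 * deg Z (flip i x) + 128 * b   ≡⟨ e₂ a b _ ⟩
            128 * (a + deg Z (flip i x)) + 256 * b                  ≤⟨ +-monoˡ-≤ (256 * b) (*-monoʳ-≤ 128 (share i)) ⟩
            128 * (m + S i) + 256 * b                               ≡⟨ e₃ m (S i) b ⟩
            (128 * S i + 128 * b) + (128 * m + 128 * b)             ∎)
          v : Fin m → ℕ
          v i = ι (V (flip i x))
          SD : ∑ (fins m) S ≤ D x
          SD = ≤-trans (≤-reflexive (∑-swap (fins m) (fins m) _)) (≤-trans (m≤m+n (DXZ x) (DZX x)) (≤-reflexive (sym (D≡ x))))
          e₄ : ∀ m t → 61 * (m * t) ≡ t * (61 * m)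
          e₄ = solve-∀
          e₅ : ∀ b t → t * (128 * b) ≡ 2 * (64 * t * b)
          e₅ = solve-∀
          step : 61 * (m * t) ≤ 128 * D x + 2 * (m * b)
          step = begin
            61 * (m * t)                                                          ≡⟨ e₄ m t ⟩
            t * (61 * m)                                                          ≡⟨ ∑-*ʳ (61 * m) (fins m) _ ⟨
            ∑ (fins m) (λ i → v i * (61 * m))                                     ≤⟨ ∑-mono (fins m) (λ i → ι-guard (V (flip i x)) (at i)) ⟩
            ∑ (fins m) (λ i → v i * (128 * S i + 128 * b))                        ≡⟨ ∑-cong (fins m) (λ i → *-distribˡ-+ (v i) (128 * S i) (128 * b)) ⟩
            ∑ (fins m) (λ i → v i * (128 * S i) + v i * (128 * b))                ≡⟨ ∑-+ (fins m) _ _ ⟩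
            ∑ (fins m) (λ i → v i * (128 * S i)) + ∑ (fins m) (λ i → v i * (128 * b))
              ≤⟨ +-mono-≤ (∑-mono (fins m) (λ i → ≤-trans (*-monoˡ-≤ (128 * S i) (ι≤1 (V (flip i x)))) (≤-reflexive (*-identityˡ (128 * S i)))))
                   (≤-reflexive (∑-*ʳ (128 * b) (fins m) v)) ⟩
            ∑ (fins m) (λ i → 128 * S i) + t * (128 * b)                          ≡⟨ cong₂ _+_ (∑-*ˡ 128 (fins m) S) (e₅ b t) ⟩
            128 * ∑ (fins m) S + 2 * (64 * t * b)                                 ≤⟨ +-mono-≤ (*-monoʳ-≤ 128 SD) (*-monoʳ-≤ 2 (*-monoˡ-≤ b 64t)) ⟩
            128 * D x + 2 * (m * b)                                               ∎

    -- Seen from the edges: an X-Z edge is counted by the undecided neighbours of its two ends, at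
    -- most m/64 for each.
    ∑OD : 64 * ∑ (cube m) (λ x → ι (O x) * D x) ≤ m * (2 * ∂ X Z)
    ∑OD = begin
      64 * ∑ (cube m) (λ x → ι (O x) * D x)
        ≡⟨ cong (64 *_) (∑-cong (cube m) (λ x → sym (∑-*ˡ (ι (O x)) (fins m) _))) ⟩
      64 * ∑ (cube m) (λ x → ∑ (fins m) (λ j → ι (O x) * h (flip j x)))
        ≡⟨ cong (64 *_) (∑-edge-swap (λ x y → ι (O x) * h y)) ⟩
      64 * ∑ (cube m) (λ x → ∑ (fins m) (λ j → ι (O (flip j x)) * h x))
        ≡⟨ cong (64 *_) (∑-cong (cube m) (λ x → ∑-*ʳ (h x) (fins m) _)) ⟩
      64 * ∑ (cube m) (λ x → deg O x * h x)
        ≡⟨ ∑-*ˡ 64 (cube m) _ ⟨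
      ∑ (cube m) (λ x → 64 * (deg O x * h x))
        ≤⟨ ∑-mono (cube m) (λ x → ≤-trans (≤-reflexive (sym (*-assoc 64 (deg O x) (h x)))) (*-monoˡ-≤ (h x) (sparse x))) ⟩
      ∑ (cube m) (λ x → m * h x)
        ≡⟨ ∑-*ˡ m (cube m) h ⟩
      m * ∑ (cube m) h
        ≡⟨ cong (m *_) (∑∑-+ (cube m) (fins m) _ _) ⟩
      m * (∂ X Z + ∂ Z X)
        ≡⟨ cong (m *_) (cong (∂ X Z +_) (trans (∂-sym Z X) (sym (+-identityʳ (∂ X Z))))) ⟩
      m * (2 * ∂ X Z) ∎
      where
      open ≤-Reasoning
      h : Q m → ℕ
      h w = ∑ (fins m) (λ l → ι (X w) * ι (Z (flip l w)) + ι (Z w) * ι (X (flip l w)))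

  ≤ᵇ-true : ∀ {a b} → (a ≤ᵇ b) ≡ true → a ≤ b
  ≤ᵇ-true {a} {b} h = ≤ᵇ⇒≤ a b (subst T (sym h) tt)

  ≤ᵇ-false : ∀ {a b} → (a ≤ᵇ b) ≡ false → b ≤ a
  ≤ᵇ-false {a} {b} h with b ≤? a
  ... | yes p = p
  ... | no p = ⊥-elim (subst T h (≤⇒≤ᵇ (<⇒≤ (≰⇒> p))))

  record Extension {m} (X Z : Q m → Bool) : Set where
    field
      X̂ : Q m → Bool
      X⊆X̂ : ∀ x → X x ≡ true → X̂ x ≡ true
      Z⊆∁X̂ : ∀ x → Z x ≡ true → X̂ x ≡ false
      size : ∣ X̂ ∣ ≤ 4 * ∣ X ∣
      boundary : ∂ X̂ (∁ X̂) ≤ 2 * ∂ X Z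

  module _ (X Z : Q m → Bool) (disjoint : ∀ x → X x ∧ Z x ≡ false)
           (sparse : ∀ x → 64 * deg (λ y → not (X y ∨ Z y)) x ≤ m) .{{_ : NonZero m}} where
    private
      open module P = Partition X Z disjoint sparse
      open ≤-Reasoning

      disjoint' : ∀ x → Z x ∧ X x ≡ false
      disjoint' x with X x | Z x | disjoint x
      ... | true | false | _ = refl
      ... | false | true | _ = refl
      ... | false | false | _ = refl

      sparse' : ∀ x → 64 * deg (λ y → not (Z y ∨ X y)) x ≤ m
      sparse' x = ≤-trans (≤-reflexive (cong (64 *_) (∑-cong (fins m) λ i → cong (λ b → ι (not b)) (∨-comm (Z (flip i x)) (X (flip i x)))))) (sparse x)

      -- Exchanging the two sides gives the bounds at vertices that are voted into the complement.
      module P' = Partition Z X disjoint' sparse'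

      D-sym : ∀ x → P'.D x ≡ D x
      D-sym x = ∑-cong (fins m) λ j → ∑-cong (fins m) λ l → +-comm (ι (Z (flip j x)) * ι (X (flip l (flip j x)))) _

      V W X̂ : Q m → Bool
      V x = O x ∧ (deg Z x ≤ᵇ deg X x)
      W x = O x ∧ not (deg Z x ≤ᵇ deg X x)
      X̂ x = X x ∨ V x

      V-maj : ∀ x → V x ≡ true → deg Z x ≤ deg X x
      V-maj x h with O x | deg Z x ≤ᵇ deg X x in eq
      ... | true | true = ≤ᵇ-true eq

      W-maj : ∀ x → W x ≡ true → deg X x ≤ deg Z x
      W-maj x h with O x | deg Z x ≤ᵇ deg X x in eq
      ... | true | false = ≤ᵇ-false eq

      X̂-split : ∀ x → ι (X̂ x) ≤ ι (X x) + ι (V x)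
      X̂-split x with X x | V x
      ... | true | b = s≤s z≤n
      ... | false | b = ≤-refl

      ∁X̂-split : ∀ x → ι (∁ X̂ x) ≤ ι (Z x) + ι (W x)
      ∁X̂-split x with X x | Z x | deg Z x ≤ᵇ deg X x
      ... | true | _ | _ = z≤n
      ... | false | true | _ = s≤s z≤n
      ... | false | false | true = z≤n
      ... | false | false | false = s≤s z≤n

      deg-split : {A B C : Q m → Bool} → (∀ x → ι (A x) ≤ ι (B x) + ι (C x)) → ∀ x → deg A x ≤ deg B x + deg C x
      deg-split h x = ≤-trans (∑-mono (fins m) λ i → h (flip i x)) (≤-reflexive (∑-+ (fins m) _ _))

      ∧-left : ∀ {a b} → a ∧ b ≡ true → a ≡ true
      ∧-left {true} h = refl

      O-sym : ∀ x → O x ≡ true → P'.O x ≡ true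
      O-sym x h with X x | Z x
      ... | false | false = refl

      three-three : ∀ {m a b d} → m * a ≤ 3 * d → m * b ≤ 3 * d → m * (a + b) ≤ 6 * d
      three-three {m} {a} {b} {d} p q = ≤-trans (≤-reflexive (*-distribˡ-+ m a b))
        (≤-trans (+-mono-≤ p q) (≤-reflexive (sym (*-distribʳ-+ d 3 3))))

      bound-V : ∀ x → V x ≡ true → m * deg (∁ X̂) x ≤ 6 * D x
      bound-V x v = ≤-trans (*-monoʳ-≤ m (deg-split {∁ X̂} {Z} {W} ∁X̂-split x))
        (three-three {m} {deg Z x} {deg W x} {D x} (deg-Z-bound x (V-maj x v))
          (deg-V-bound x (V-maj x v) W (λ y → ∧-left) W-maj))

      bound-W : ∀ x → W x ≡ true → m * deg X̂ x ≤ 6 * D x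
      bound-W x w = ≤-trans (*-monoʳ-≤ m (deg-split {X̂} {X} {V} X̂-split x))
        (three-three {m} {deg X x} {deg V x} {D x} (subst (λ d → m * deg X x ≤ 3 * d) (D-sym x) (P'.deg-Z-bound x (W-maj x w)))
          (subst (λ d → m * deg V x ≤ 3 * d) (D-sym x)
            (P'.deg-V-bound x (W-maj x w) V (λ y h → O-sym y (∧-left h)) V-maj)))

      extra : ℕ
      extra = ∑ (cube m) (λ x → ι (V x) * deg (∁ X̂) x + ι (W x) * deg X̂ x)

      -- An undecided vertex contributes at most 6D/m edges, and D summed over O is at most m/32
      -- times `∂ X Z`; so the fraction is at most 12/64.
      extra≤ : extra ≤ ∂ X Z
      extra≤ = *-cancelˡ-≤ 64 (*-cancelˡ-≤ m (begin
        m * (64 * extra)                                      ≡⟨ e₁ m extra ⟩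
        64 * (m * extra)                                      ≡⟨ cong (64 *_) (∑-*ˡ m (cube m) _) ⟨
        64 * ∑ (cube m) (λ x → m * (ι (V x) * deg (∁ X̂) x + ι (W x) * deg X̂ x))
                                                              ≤⟨ *-monoʳ-≤ 64 (∑-mono (cube m) pt) ⟩
        64 * ∑ (cube m) (λ x → 6 * (ι (O x) * D x))           ≡⟨ cong (64 *_) (∑-*ˡ 6 (cube m) _) ⟩
        64 * (6 * ∑ (cube m) (λ x → ι (O x) * D x))           ≡⟨ e₂ (∑ (cube m) (λ x → ι (O x) * D x)) ⟩
        6 * (64 * ∑ (cube m) (λ x → ι (O x) * D x))           ≤⟨ *-monoʳ-≤ 6 ∑OD ⟩
        6 * (m * (2 * ∂ X Z))                                 ≡⟨ e₃ m (∂ X Z) ⟩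
        m * (12 * ∂ X Z)                                      ≤⟨ *-monoʳ-≤ m (*-monoˡ-≤ (∂ X Z) (m≤m+n 12 52)) ⟩
        m * (64 * ∂ X Z)                                      ∎))
        where
        e₁ : ∀ m x → m * (64 * x) ≡ 64 * (m * x)
        e₁ = solve-∀
        e₂ : ∀ x → 64 * (6 * x) ≡ 6 * (64 * x)
        e₂ = solve-∀
        e₃ : ∀ m d → 6 * (m * (2 * d)) ≡ m * (12 * d)
        e₃ = solve-∀
        e₄ : ∀ m p → m * p ≡ m * (1 * p + 0)
        e₄ = solve-∀
        e₅ : ∀ r → 6 * r ≡ 6 * (1 * r)
        e₅ = solve-∀
        cases : ∀ o s p q r → (o ∧ s ≡ true → m * p ≤ 6 * r) → (o ∧ not s ≡ true → m * q ≤ 6 * r) →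
                m * (ι (o ∧ s) * p + ι (o ∧ not s) * q) ≤ 6 * (ι o * r)
        cases true true p q r h _ = subst₂ _≤_ (e₄ m p) (e₅ r) (h refl)
        cases true false p q r _ h = subst₂ _≤_ (cong (m *_) (sym (*-identityˡ q))) (e₅ r) (h refl)
        cases false s p q r _ _ = ≤-reflexive (*-zeroʳ m)
        pt : ∀ x → m * (ι (V x) * deg (∁ X̂) x + ι (W x) * deg X̂ x) ≤ 6 * (ι (O x) * D x)
        pt x = cases (O x) (deg Z x ≤ᵇ deg X x) _ _ _ (bound-V x) (bound-W x)

      -- A boundary edge between decided vertices is an X-Z edge. Any other is charged to its inner
      -- end in V or its outer end in W.
      edge-split : ∀ x y → ι (X̂ x) * ι (∁ X̂ y) ≤ ι (X x) * ι (Z y) + (ι (V x) * ι (∁ X̂ y) + ι (W y) * ι (X̂ x))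
      edge-split x y = go (X x) (V x) (ι≤1 (∁ X̂ y)) (∁X̂-split y)
        where
        go : ∀ p v {ŷ z w} → ŷ ≤ 1 → ŷ ≤ z + w → ι (p ∨ v) * ŷ ≤ ι p * z + (ι v * ŷ + w * ι (p ∨ v))
        go true v {ŷ} {z} {w} _ h = begin
          1 * ŷ                            ≡⟨ *-identityˡ ŷ ⟩
          ŷ                                ≤⟨ h ⟩
          z + w                            ≤⟨ +-mono-≤ (≤-reflexive (sym (*-identityˡ z))) (≤-trans (≤-reflexive (sym (*-identityʳ w))) (m≤n+m (w * 1) _)) ⟩
          1 * z + (ι v * ŷ + w * 1)        ∎
        go false true _ _ = m≤m+n _ _
        go false false _ _ = z≤n

      boundary-X̂ : ∂ X̂ (∁ X̂) ≤ 2 * ∂ X Z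
      boundary-X̂ = begin
        ∂ X̂ (∁ X̂)
          ≤⟨ ∑-mono (cube m) (λ x → ∑-mono (fins m) (λ i → edge-split x (flip i x))) ⟩
        ∑ (cube m) (λ x → ∑ (fins m) (λ i → ι (X x) * ι (Z (flip i x)) + (ι (V x) * ι (∁ X̂ (flip i x)) + ι (W (flip i x)) * ι (X̂ x))))
          ≡⟨ trans (∑∑-+ (cube m) (fins m) _ _) (cong (∂ X Z +_) (∑∑-+ (cube m) (fins m) _ _)) ⟩
        ∂ X Z + (∂ V (∁ X̂) + ∑ (cube m) (λ x → ∑ (fins m) (λ i → ι (W (flip i x)) * ι (X̂ x))))
          ≡⟨ cong (λ s → ∂ X Z + (∂ V (∁ X̂) + s)) (sym (∑-edge-swap (λ x y → ι (W x) * ι (X̂ y)))) ⟩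
        ∂ X Z + (∂ V (∁ X̂) + ∂ W X̂)
          ≡⟨ cong (∂ X Z +_) (trans (cong₂ _+_ (∑-cong (cube m) (λ x → ∑-*ˡ (ι (V x)) (fins m) _))
               (∑-cong (cube m) (λ x → ∑-*ˡ (ι (W x)) (fins m) _))) (sym (∑-+ (cube m) _ _))) ⟩
        ∂ X Z + extra
          ≤⟨ +-monoʳ-≤ (∂ X Z) extra≤ ⟩
        ∂ X Z + ∂ X Z
          ≡⟨ cong (∂ X Z +_) (+-identityʳ (∂ X Z)) ⟨
        2 * ∂ X Z ∎

      -- Count the V-X edges twice: a vertex of V has at least 63m/128 neighbours in X, and 128/63 <
      -- 3.
      V-small : ∣ V ∣ ≤ 3 * ∣ X ∣
      V-small = *-cancelˡ-≤ 63 (*-cancelˡ-≤ m (begin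
        m * (63 * ∣ V ∣)                              ≡⟨ e₁ m ∣ V ∣ ⟩
        ∣ V ∣ * (63 * m)                              ≡⟨ ∑-*ʳ (63 * m) (cube m) _ ⟨
        ∑ (cube m) (λ x → ι (V x) * (63 * m))         ≤⟨ ∑-mono (cube m) (λ x → ≤-trans
                                                           (ι-guard (V x) (λ v → majority x (+-comm (deg X x) _) (V-maj x v)))
                                                           (≤-trans (*-monoˡ-≤ _ (ι≤1 (V x))) (≤-reflexive (*-identityˡ _)))) ⟩
        ∑ (cube m) (λ x → 128 * deg X x)              ≡⟨ ∑-*ˡ 128 (cube m) _ ⟩
        128 * ∑ (cube m) (deg X)                      ≡⟨ cong (128 *_) (∑∑-deg X) ⟩
        128 * (m * ∣ X ∣)                             ≤⟨ *-monoˡ-≤ (m * ∣ X ∣) (m≤m+n 128 61) ⟩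
        189 * (m * ∣ X ∣)                             ≡⟨ e₂ m ∣ X ∣ ⟩
        m * (63 * (3 * ∣ X ∣))                        ∎))
        where
        e₁ : ∀ m v → m * (63 * v) ≡ v * (63 * m)
        e₁ = solve-∀
        e₂ : ∀ m x → 189 * (m * x) ≡ m * (63 * (3 * x))
        e₂ = solve-∀

    extension : Extension X Z
    extension = record
      { X̂ = X̂
      ; X⊆X̂ = λ x h → cong (_∨ V x) h
      ; Z⊆∁X̂ = in-Z
      ; size = ≤-trans (∑-mono (cube m) X̂-split) (≤-trans (≤-reflexive (∑-+ (cube m) _ _)) (+-monoʳ-≤ ∣ X ∣ V-small))
      ; boundary = boundary-X̂
      }
      where
      in-Z : ∀ x → Z x ≡ true → X̂ x ≡ false
      in-Z x h with X x | Z x | disjoint x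
      ... | false | true | _ = refl

-- Expansion from canonical edges and typical blocks, without probability.

module BlockCounting where

  open FiniteSums
  open Isoperimetry
  open MajorityExtension
  open import Defs using (cube)
  open import Data.Bool using (Bool; true; false; not; _∧_; _∨_)
  open import Data.Bool.Properties using (not-involutive; ∨-comm; ∨-zeroʳ)
  open import Data.Nat
  open import Data.Nat.Properties
  open import Data.Nat.Tactic.RingSolver using (solve-∀)
  open import Data.Fin using (zero; suc)
  open import Data.List using (List; []; _∷_)
  open import Data.List.Membership.Propositional using (_∈_)
  open import Data.List.Relation.Unary.Any using (here; there)
  open import Data.Vec using ([]; _∷_)
  open import Data.Product using (∃-syntax; _×_; _,_)
  open import Data.Sum using (inj₁; inj₂)
  open import Relation.Binary.PropositionalEquality using (_≡_; refl; sym; trans; cong; cong₂; subst)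

  private
    variable
      I J : Set
      m k : ℕ

  some : List I → (I → Bool) → Bool
  some [] P = false
  some (x ∷ xs) P = P x ∨ some xs P

  some-intro : {xs : List I} (P : I → Bool) {x : I} → x ∈ xs → P x ≡ true → some xs P ≡ true
  some-intro {xs = _ ∷ xs} P (here refl) h = cong (_∨ some xs P) h
  some-intro {xs = y ∷ xs} P (there x∈) h = trans (cong (P y ∨_) (some-intro P x∈ h)) (∨-zeroʳ (P y))

  some-elim : (xs : List I) (P : I → Bool) → some xs P ≡ true → ∃[ x ] P x ≡ true
  some-elim (x ∷ xs) P h with P x in eq
  ... | true = x , eq
  ... | false = some-elim xs P h

  some-none : {xs : List I} (P : I → Bool) {x : I} → x ∈ xs → some xs P ≡ false → P x ≡ false
  some-none P {x} x∈ h with P x in eq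
  ... | false = refl
  ... | true with () ← trans (sym h) (some-intro P x∈ eq)

  -- The neighbours of a vertex are pairwise distinct: the one across the first coordinate lies in
  -- the other half-cube.
  ∑-flips : ∀ m (x : Q m) (g : Q m → ℕ) → ∑ (fins m) (λ i → g (flip i x)) ≤ ∑ (cube m) g
  ∑-flips zero [] g = z≤n
  ∑-flips (suc m) (true ∷ x) g = begin
    ∑ (fins (suc m)) (λ i → g (flip i (true ∷ x)))                      ≡⟨ ∑-fins-suc {m} _ ⟩
    g (false ∷ x) + ∑ (fins m) (λ i → g (true ∷ flip i x))              ≤⟨ +-mono-≤ (∑-∈ (λ y → g (false ∷ y)) (∈-cube x)) (∑-flips m x (λ y → g (true ∷ y))) ⟩
    ∑ (cube m) (λ y → g (false ∷ y)) + ∑ (cube m) (λ y → g (true ∷ y))  ≡⟨ trans (+-comm (∑ (cube m) (λ y → g (false ∷ y))) _) (sym (∑-cube-suc g)) ⟩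
    ∑ (cube (suc m)) g                                                  ∎
    where open ≤-Reasoning
  ∑-flips (suc m) (false ∷ x) g = begin
    ∑ (fins (suc m)) (λ i → g (flip i (false ∷ x)))                     ≡⟨ ∑-fins-suc {m} _ ⟩
    g (true ∷ x) + ∑ (fins m) (λ i → g (false ∷ flip i x))              ≤⟨ +-mono-≤ (∑-∈ (λ y → g (true ∷ y)) (∈-cube x)) (∑-flips m x (λ y → g (false ∷ y))) ⟩
    ∑ (cube m) (λ y → g (true ∷ y)) + ∑ (cube m) (λ y → g (false ∷ y))  ≡⟨ sym (∑-cube-suc g) ⟩
    ∑ (cube (suc m)) g                                                  ∎
    where open ≤-Reasoning

  ∣∣-mono : {X Y : Q m → Bool} → (∀ x → X x ≡ true → Y x ≡ true) → ∣ X ∣ ≤ ∣ Y ∣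
  ∣∣-mono {m} {X} {Y} h = ∑-mono (cube m) λ x → pt (X x) (Y x) (h x)
    where
    pt : ∀ a b → (a ≡ true → b ≡ true) → ι a ≤ ι b
    pt true b h rewrite h refl = ≤-refl
    pt false b h = z≤n

  ∣∣-∁ : (X : Q m → Bool) → ∣ X ∣ + ∣ ∁ X ∣ ≡ 2 ^ m
  ∣∣-∁ {m} X = trans (sym (∑-+ (cube m) _ _)) (trans (∑-cong (cube m) λ x → one (X x)) (trans (∑-cube-const m 1) (*-identityʳ _)))
    where
    one : ∀ b → ι b + ι (not b) ≡ 1
    one true = refl
    one false = refl

  Family : ℕ → ℕ → Set
  Family m k = Q m → Q k → Bool

  Adjacency : ℕ → ℕ → Set
  Adjacency m k = Q m → Q k → Q m → Q k → Bool

  ‖_‖ : Family m k → ℕ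
  ‖_‖ {m} {k} A = ∑ (cube m) (λ x → ∑ (cube k) (λ p → ι (A x p)))

  meets : Family m k → Q m → Bool
  meets {k = k} A x = some (cube k) (A x)

  crossing : Adjacency m k → Family m k → Family m k → Q m → Q m → ℕ
  crossing {k = k} adj A B x y = ∑ (cube k) (λ p → ∑ (cube k) (λ q → ι (A x p) * (ι (B y q) * ι (adj x p y q))))

  cut : Adjacency m k → Family m k → Family m k → ℕ
  cut {m} adj A B = ∑ (cube m) (λ x → ∑ (cube m) (crossing adj A B x))

  cut-sym : (adj : Adjacency m k) → (∀ x p y q → adj x p y q ≡ adj y q x p) →
            (A B : Family m k) → cut adj A B ≡ cut adj B A
  cut-sym {m} {k} adj adj-sym A B = trans (∑-swap (cube m) (cube m) _) (∑-cong (cube m) λ y → ∑-cong (cube m) λ x →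
    trans (∑-swap (cube k) (cube k) _) (∑-cong (cube k) λ q → ∑-cong (cube k) λ p →
      trans (cong (λ b → ι (A x p) * (ι (B y q) * ι b)) (adj-sym x p y q)) (rot (ι (A x p)) (ι (B y q)) (ι (adj y q x p)))))
    where
    rot : ∀ a b c → a * (b * c) ≡ b * (a * c)
    rot = solve-∀

  -- The interface between geometry and counting. The relation `adj` is fixed before `a` is chosen
  -- in `within`, so one set of edges serves all partitions.
  record CanonicalEdges (W : Family m k) (adj : Adjacency m k) : Set where
    field
      symmetric : ∀ x p y q → adj x p y q ≡ adj y q x p
      across : ∀ x p i → W x p ≡ true → ∃[ q ] (W (flip i x) q ≡ true) →
               ∃[ q ] (W (flip i x) q ≡ true × adj x p (flip i x) q ≡ true)
      within : ∀ x (a : Q k → Bool) {p q} → W x p ≡ true → a p ≡ true → W x q ≡ true → a q ≡ false →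
               ∃[ p ] ∃[ q ] (W x p ≡ true × a p ≡ true × W x q ≡ true × a q ≡ false × adj x p x q ≡ true)

  -- Both conditions concern neighbourhoods, since among 2^m blocks of constant expected size single
  -- ones may well be empty or overfull.
  record Typical (C : ℕ) (W : Family m k) : Set where
    field
      few-empty : ∀ x → 64 * deg (λ y → not (meets W y)) x ≤ m
      not-crowded : ∀ x → ∑ (fins m) (λ i → ∑ (cube k) (λ q → ι (W (flip i x) q))) ≤ C * m

  record Split (W A B : Family m k) : Set where
    field
      cover : ∀ x p → W x p ≡ A x p ∨ B x p
      disjoint : ∀ x p → A x p ∧ B x p ≡ false

    inˡ : ∀ x p → A x p ≡ true → W x p ≡ true
    inˡ x p h = trans (cover x p) (cong (_∨ B x p) h)

    inʳ : ∀ x p → B x p ≡ true → W x p ≡ true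
    inʳ x p h = trans (cover x p) (trans (cong (A x p ∨_) h) (∨-zeroʳ (A x p)))

    offˡ : ∀ x p → W x p ≡ true → A x p ≡ false → B x p ≡ true
    offˡ x p w a = trans (sym (cong (_∨ B x p) a)) (trans (sym (cover x p)) w)

    offʳ : ∀ x p → B x p ≡ true → A x p ≡ false
    offʳ x p b with A x p | B x p | disjoint x p
    ... | false | true | _ = refl

    meets-cover : ∀ x → meets W x ≡ meets A x ∨ meets B x
    meets-cover x = go (cube k)
      where
      or-swap : ∀ a b c d → (a ∨ b) ∨ (c ∨ d) ≡ (a ∨ c) ∨ (b ∨ d)
      or-swap true b c d = refl
      or-swap false true true d = refl
      or-swap false true false d = refl
      or-swap false false c d = refl
      go : ∀ ps → some ps (W x) ≡ some ps (A x) ∨ some ps (B x)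
      go [] = refl
      go (p ∷ ps) = trans (cong₂ _∨_ (cover x p) (go ps)) (or-swap (A x p) (B x p) _ _)

  Split-sym : {W A B : Family m k} → Split W A B → Split W B A
  Split-sym {W = W} {A} {B} s = record
    { cover = λ x p → trans (cover x p) (∨-comm (A x p) (B x p))
    ; disjoint = λ x p → and-comm (A x p) (B x p) (disjoint x p) }
    where
    open Split s
    and-comm : ∀ a b → a ∧ b ≡ false → b ∧ a ≡ false
    and-comm true false h = refl
    and-comm false true h = refl
    and-comm false false h = refl

  ∑∑-one : {xs : List I} {ys : List J} (f : I → J → ℕ) {x : I} {y : J} → x ∈ xs → y ∈ ys → 1 ≤ f x y →
           1 ≤ ∑ xs (λ x → ∑ ys (f x))
  ∑∑-one {ys = ys} f {x} x∈ y∈ h = ≤-trans h (≤-trans (∑-∈ (f x) y∈) (∑-∈ (λ x → ∑ ys (f x)) x∈))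

  ι-one : ∀ {a} → a ≡ true → 1 ≤ ι a
  ι-one refl = ≤-refl

  module _ {C : ℕ} {W : Family m k} {adj : Adjacency m k} (E : CanonicalEdges W adj) (typical : Typical C W) where
    open CanonicalEdges E
    open Typical typical

    module Side {A B : Family m k} (split : Split W A B) where
      open Split split
      open ≤-Reasoning

      X Y Z : Q m → Bool
      X = meets A
      Y = meets B
      Z x = meets B x ∧ not (meets A x)

      e : ℕ
      e = cut adj A B

      flips≤cut : ∑ (cube m) (λ x → ∑ (fins m) (λ i → crossing adj A B x (flip i x))) ≤ e
      flips≤cut = ∑-mono (cube m) λ x → ∑-flips m x (crossing adj A B x)

      one-crossing : ∀ {x y p q} → A x p ≡ true → B y q ≡ true → adj x p y q ≡ true → 1 ≤ crossing adj A B x y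
      one-crossing {x} {y} {p} {q} a b c = ∑∑-one (λ p q → ι (A x p) * (ι (B y q) * ι (adj x p y q)))
        (∈-cube p) (∈-cube q) (*-mono-≤ (ι-one a) (*-mono-≤ (ι-one b) (ι-one c)))

      -- The canonical edge from a point of A into a block of Z ends at a point outside A, because Z
      -- excludes the blocks that A meets; hence it is cut.
      boundary≤cut : ∂ X Z ≤ e
      boundary≤cut = ≤-trans (∑-mono (cube m) λ x → ∑-mono (fins m) λ i → pt x i) flips≤cut
        where
        pt : ∀ x i → ι (X x) * ι (Z (flip i x)) ≤ crossing adj A B x (flip i x)
        pt x i with X x in xX | meets B (flip i x) in yB | meets A (flip i x) in yA
        ... | false | _ | _ = z≤n
        ... | true | false | _ = z≤n
        ... | true | true | true = z≤n
        ... | true | true | false =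
          let p , ap = some-elim (cube k) (A x) xX
              q₀ , bq₀ = some-elim (cube k) (B (flip i x)) yB
              q , wq , adjq = across x p i (inˡ x p ap) (q₀ , inʳ (flip i x) q₀ bq₀)
          in one-crossing ap (offˡ (flip i x) q wq (some-none (A (flip i x)) (∈-cube q) yA)) adjq

      mixed≤cut : ∣ (λ x → X x ∧ Y x) ∣ ≤ e
      mixed≤cut = ∑-mono (cube m) λ x → ≤-trans (pt x) (∑-∈ (crossing adj A B x) (∈-cube x))
        where
        pt : ∀ x → ι (X x ∧ Y x) ≤ crossing adj A B x x
        pt x with X x in xA | Y x in xB
        ... | false | _ = z≤n
        ... | true | false = z≤n
        ... | true | true =
          let p₀ , ap₀ = some-elim (cube k) (A x) xA
              q₀ , bq₀ = some-elim (cube k) (B x) xB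
              p , q , wp , ap , wq , aq , adjpq = within x (A x) (inˡ x p₀ ap₀) ap₀ (inʳ x q₀ bq₀) (offʳ x q₀ bq₀)
          in one-crossing ap (offˡ x q wq aq) adjpq

      fibre : Q m → ℕ
      fibre x = ∑ (cube k) (λ p → ι (A x p))

      fibre≤ : ∀ x → fibre x ≤ ∑ (cube k) (λ p → ι (W x p))
      fibre≤ x = ∑-mono (cube k) λ p → subst (λ b → ι (A x p) ≤ ι b) (sym (cover x p)) (le (A x p) (B x p))
        where
        le : ∀ a b → ι a ≤ ι (a ∨ b)
        le true b = ≤-refl
        le false b = z≤n

      -- Every point of A has an edge into each nonempty neighbouring block; it is either cut or ends in a block met by A.
      size≤cut+blocks : 63 * m * ‖ A ‖ ≤ 64 * e + 64 * C * m * ∣ X ∣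
      size≤cut+blocks = begin
        63 * m * ‖ A ‖
          ≡⟨ trans (∑∑-*ˡ (63 * m)) refl ⟨
        ∑ (cube m) (λ x → ∑ (cube k) (λ p → 63 * m * ι (A x p)))
          ≤⟨ ∑-mono (cube m) (λ x → ∑-mono (cube k) (λ p → ≤-trans (*-monoˡ-≤ (ι (A x p)) (most x)) (≤-reflexive (r₁ (deg (meets W) x) (ι (A x p)))))) ⟩
        ∑ (cube m) (λ x → ∑ (cube k) (λ p → 64 * (ι (A x p) * deg (meets W) x)))
          ≡⟨ ∑∑-64 ⟩
        64 * ∑ (cube m) (λ x → ∑ (cube k) (λ p → ι (A x p) * deg (meets W) x))
          ≡⟨ cong (64 *_) (∑-cong (cube m) (λ x → ∑-cong (cube k) (λ p → sym (∑-*ˡ (ι (A x p)) (fins m) _)))) ⟩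
        64 * ∑ (cube m) (λ x → ∑ (cube k) (λ p → ∑ (fins m) (λ i → ι (A x p) * ι (meets W (flip i x)))))
          ≡⟨ cong (64 *_) (∑-cong (cube m) (λ x → ∑-swap (cube k) (fins m) _)) ⟩
        64 * ∑ (cube m) (λ x → ∑ (fins m) (λ i → ∑ (cube k) (λ p → ι (A x p) * ι (meets W (flip i x)))))
          ≤⟨ *-monoʳ-≤ 64 (∑-mono (cube m) (λ x → ∑-mono (fins m) (λ i → ∑-mono (cube k) (pt x i)))) ⟩
        64 * ∑ (cube m) (λ x → ∑ (fins m) (λ i → ∑ (cube k) (λ p → out x (flip i x) p + ι (A x p) * ι (X (flip i x)))))
          ≡⟨ cong (64 *_) (trans (∑-cong (cube m) (λ x → ∑∑-+ (fins m) (cube k) (λ i → out x (flip i x)) _)) (∑-+ (cube m) _ _)) ⟩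
        64 * (∑ (cube m) (λ x → ∑ (fins m) (λ i → crossing adj A B x (flip i x)))
              + ∑ (cube m) (λ x → ∑ (fins m) (λ i → ∑ (cube k) (λ p → ι (A x p) * ι (X (flip i x))))))
          ≤⟨ *-monoʳ-≤ 64 (+-mono-≤ flips≤cut into) ⟩
        64 * (e + C * m * ∣ X ∣)
          ≡⟨ r₂ e C m ∣ X ∣ ⟩
        64 * e + 64 * C * m * ∣ X ∣ ∎
        where
        out : Q m → Q m → Q k → ℕ
        out x y p = ∑ (cube k) (λ q → ι (A x p) * (ι (B y q) * ι (adj x p y q)))
        ∑∑-*ˡ : ∀ c → ∑ (cube m) (λ x → ∑ (cube k) (λ p → c * ι (A x p))) ≡ c * ‖ A ‖
        ∑∑-*ˡ c = trans (∑-cong (cube m) (λ x → ∑-*ˡ c (cube k) _)) (∑-*ˡ c (cube m) _)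
        ∑∑-64 : ∑ (cube m) (λ x → ∑ (cube k) (λ p → 64 * (ι (A x p) * deg (meets W) x)))
              ≡ 64 * ∑ (cube m) (λ x → ∑ (cube k) (λ p → ι (A x p) * deg (meets W) x))
        ∑∑-64 = trans (∑-cong (cube m) (λ x → ∑-*ˡ 64 (cube k) _)) (∑-*ˡ 64 (cube m) _)
        r₁ : ∀ d a → (64 * d) * a ≡ 64 * (a * d)
        r₁ = solve-∀
        r₂ : ∀ e C m x → 64 * (e + C * m * x) ≡ 64 * e + 64 * C * m * x
        r₂ = solve-∀
        ι+ι : ∀ b → ι b + ι (not b) ≡ 1
        ι+ι true = refl
        ι+ι false = refl
        most : ∀ x → 63 * m ≤ 64 * deg (meets W) x
        most x = +-cancelʳ-≤ (64 * deg (λ y → not (meets W y)) x) _ _ (begin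
          63 * m + 64 * deg (λ y → not (meets W y)) x                     ≤⟨ +-monoʳ-≤ (63 * m) (few-empty x) ⟩
          63 * m + m                                                      ≡⟨ +-comm (63 * m) m ⟩
          64 * m                                                          ≡⟨ cong (64 *_) (*-identityʳ m) ⟨
          64 * (m * 1)                                                    ≡⟨ cong (64 *_) (∑-fins-const m 1) ⟨
          64 * ∑ (fins m) (λ _ → 1)                                       ≡⟨ cong (64 *_) (∑-cong (fins m) (λ i → ι+ι (meets W (flip i x)))) ⟨
          64 * ∑ (fins m) (λ i → ι (meets W (flip i x)) + ι (not (meets W (flip i x))))
                                                                          ≡⟨ cong (64 *_) (∑-+ (fins m) _ _) ⟩
          64 * (deg (meets W) x + deg (λ y → not (meets W y)) x)          ≡⟨ *-distribˡ-+ 64 (deg (meets W) x) _ ⟩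
          64 * deg (meets W) x + 64 * deg (λ y → not (meets W y)) x       ∎)
        pt : ∀ x i p → ι (A x p) * ι (meets W (flip i x)) ≤ out x (flip i x) p + ι (A x p) * ι (X (flip i x))
        pt x i p with A x p in ap | meets W (flip i x) in yW | X (flip i x) in yA
        ... | false | _ | _ = z≤n
        ... | true | false | _ = z≤n
        ... | true | true | true = m≤n+m 1 _
        ... | true | true | false =
          let q₀ , wq₀ = some-elim (cube k) (W (flip i x)) yW
              q , wq , adjq = across x p i (inˡ x p ap) (q₀ , wq₀)
              bq = offˡ (flip i x) q wq (some-none (A (flip i x)) (∈-cube q) yA)
          in ≤-trans (≤-trans (*-monoʳ-≤ 1 (*-mono-≤ (ι-one bq) (ι-one adjq)))
               (∑-∈ (λ q → 1 * (ι (B (flip i x) q) * ι (adj x p (flip i x) q))) (∈-cube q))) (m≤m+n _ 0)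
        -- Regrouped by the target block: the blocks around it hold at most C m points altogether,
        -- so at most C m points of A.
        into : ∑ (cube m) (λ x → ∑ (fins m) (λ i → ∑ (cube k) (λ p → ι (A x p) * ι (X (flip i x))))) ≤ C * m * ∣ X ∣
        into = begin
          ∑ (cube m) (λ x → ∑ (fins m) (λ i → ∑ (cube k) (λ p → ι (A x p) * ι (X (flip i x)))))
            ≡⟨ ∑-cong (cube m) (λ x → ∑-cong (fins m) (λ i → ∑-*ʳ (ι (X (flip i x))) (cube k) _)) ⟩
          ∑ (cube m) (λ x → ∑ (fins m) (λ i → fibre x * ι (X (flip i x))))
            ≡⟨ ∑-edge-swap (λ x y → fibre x * ι (X y)) ⟩
          ∑ (cube m) (λ x → ∑ (fins m) (λ i → fibre (flip i x) * ι (X x)))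
            ≡⟨ ∑-cong (cube m) (λ x → ∑-*ʳ (ι (X x)) (fins m) _) ⟩
          ∑ (cube m) (λ x → ∑ (fins m) (λ i → fibre (flip i x)) * ι (X x))
            ≤⟨ ∑-mono (cube m) (λ x → *-monoˡ-≤ (ι (X x)) (≤-trans (∑-mono (fins m) (λ i → fibre≤ (flip i x))) (not-crowded x))) ⟩
          ∑ (cube m) (λ x → C * m * ι (X x))
            ≡⟨ ∑-*ˡ (C * m) (cube m) _ ⟩
          C * m * ∣ X ∣ ∎

      ∣X∣≤‖A‖ : ∣ X ∣ ≤ ‖ A ‖
      ∣X∣≤‖A‖ = ∑-mono (cube m) pt
        where
        pt : ∀ x → ι (X x) ≤ fibre x
        pt x with X x in xA
        ... | false = z≤n
        ... | true = let p , ap = some-elim (cube k) (A x) xA in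
                     ≤-trans (ι-one ap) (∑-∈ (λ p → ι (A x p)) (∈-cube p))

      X∨Z : ∀ x → X x ∨ Z x ≡ meets W x
      X∨Z x = trans (absorb (X x) (Y x)) (sym (meets-cover x))
        where
        absorb : ∀ a b → a ∨ (b ∧ not a) ≡ a ∨ b
        absorb true b = refl
        absorb false true = refl
        absorb false false = refl

      XZ-disjoint : ∀ x → X x ∧ Z x ≡ false
      XZ-disjoint x with X x | Y x
      ... | true | true = refl
      ... | true | false = refl
      ... | false | _ = refl

      ext : .{{_ : NonZero m}} → Extension X Z
      ext = extension X Z XZ-disjoint λ x →
        subst (λ d → 64 * d ≤ m) (∑-cong (fins m) λ i → cong (λ b → ι (not b)) (sym (X∨Z (flip i x)))) (few-empty x)

    -- Averaging `not-crowded` over the cube counts every block exactly m times.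
    ‖W‖≤ : .{{_ : NonZero m}} → ‖ W ‖ ≤ C * 2 ^ m
    ‖W‖≤ = *-cancelˡ-≤ m (begin
      m * ‖ W ‖                                                                          ≡⟨ ∑-fins-const m ‖ W ‖ ⟨
      ∑ (fins m) (λ _ → ‖ W ‖)                                                           ≡⟨ ∑-cong (fins m) (λ i → sym (∑-flip i (λ x → ∑ (cube k) (λ q → ι (W x q))))) ⟩
      ∑ (fins m) (λ i → ∑ (cube m) (λ x → ∑ (cube k) (λ q → ι (W (flip i x) q))))        ≡⟨ ∑-swap (fins m) (cube m) _ ⟩
      ∑ (cube m) (λ x → ∑ (fins m) (λ i → ∑ (cube k) (λ q → ι (W (flip i x) q))))        ≤⟨ ∑-mono (cube m) not-crowded ⟩
      ∑ (cube m) (λ _ → C * m)                                                           ≡⟨ ∑-cube-const m (C * m) ⟩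
      2 ^ m * (C * m)                                                                    ≡⟨ r (2 ^ m) C m ⟩
      m * (C * 2 ^ m)                                                                    ∎)
      where
      open ≤-Reasoning
      r : ∀ M C m → M * (C * m) ≡ m * (C * M)
      r = solve-∀

    module _ {A B : Family m k} (split : Split W A B) .{{_ : NonZero m}} where
      private
        module SA = Side split
        module SB = Side (Split-sym split)
        open SA using (X; Y; Z; e; size≤cut+blocks; ext)
        open Extension ext
        open ≤-Reasoning

        M : ℕ
        M = 2 ^ m

        X⊆ : ∣ X ∣ ≤ ∣ X̂ ∣
        X⊆ = ∣∣-mono X⊆X̂

        ∂X̂≤ : ∂ X̂ (∁ X̂) ≤ 2 * e
        ∂X̂≤ = ≤-trans boundary (*-monoʳ-≤ 2 SA.boundary≤cut)

      -- The isoperimetric inequality is applied to `X̂`: the factor 4 is the price in size, the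
      -- factor 2 the price in boundary.
      few-blocks : ∀ t → t ≤ m → 2 ^ t * (4 * ∣ X ∣) ≤ M → t * ∣ X ∣ ≤ 2 * e
      few-blocks t t≤m h = ≤-trans (*-monoʳ-≤ t X⊆)
        (≤-trans (edge-isoperimetry t X̂ t≤m (≤-trans (*-monoʳ-≤ (2 ^ t) size) h)) ∂X̂≤)

      few-blocks-expand : 8 * ∣ X ∣ ≤ M → ‖ A ‖ ≤ (64 + 128 * C) * e
      few-blocks-expand h = ≤-trans (m≤n*m ‖ A ‖ 63) (*-cancelˡ-≤ m (begin
        m * (63 * ‖ A ‖)                     ≡⟨ r₁ m ‖ A ‖ ⟩
        63 * m * ‖ A ‖                       ≤⟨ size≤cut+blocks ⟩
        64 * e + 64 * C * m * ∣ X ∣          ≤⟨ +-mono-≤ (m≤n*m (64 * e) m) (*-monoʳ-≤ (64 * C * m) X≤2e) ⟩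
        m * (64 * e) + 64 * C * m * (2 * e)  ≡⟨ r₂ m C e ⟩
        m * ((64 + 128 * C) * e)             ∎))
        where
        r₀ : ∀ x → 2 * (4 * x) ≡ 8 * x
        r₀ = solve-∀
        r₁ : ∀ m a → m * (63 * a) ≡ 63 * m * a
        r₁ = solve-∀
        r₂ : ∀ m C e → m * (64 * e) + 64 * C * m * (2 * e) ≡ m * ((64 + 128 * C) * e)
        r₂ = solve-∀
        X≤2e : ∣ X ∣ ≤ 2 * e
        X≤2e = ≤-trans (≤-reflexive (sym (*-identityˡ ∣ X ∣)))
          (few-blocks 1 (>-nonZero⁻¹ m) (≤-trans (≤-reflexive (r₀ ∣ X ∣)) h))

      -- It suffices that e ≥ M/32, as all of W has at most CM points. Unless M/32 blocks are mixed,
      -- Z has at least M/16 blocks. Then `X̂` contains the large set X and its complement contains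
      -- Z; whichever of the two fills at most half of the cube has a boundary at least as large as
      -- itself.
      many-blocks-expand : M ≤ 8 * ∣ X ∣ → M ≤ 8 * ∣ Y ∣ → ‖ A ‖ ≤ (64 + 128 * C) * e
      many-blocks-expand hX hY = begin
        ‖ A ‖                   ≤⟨ ∑-mono (cube m) SA.fibre≤ ⟩
        ‖ W ‖                   ≤⟨ ‖W‖≤ ⟩
        C * M                   ≤⟨ *-monoʳ-≤ C M≤32e ⟩
        C * (32 * e)            ≤⟨ m≤m+n _ _ ⟩
        C * (32 * e) + (64 * e + 96 * C * e)  ≡⟨ r C e ⟩
        (64 + 128 * C) * e      ∎
        where
        r : ∀ C e → C * (32 * e) + (64 * e + 96 * C * e) ≡ (64 + 128 * C) * e
        r = solve-∀
        r₁ : ∀ x z → 32 * (x + z) ≡ 32 * x + 2 * (16 * z)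
        r₁ = solve-∀
        r₂ : ∀ y → 4 * (8 * y) ≡ 32 * y
        r₂ = solve-∀
        r₃ : ∀ M → 2 * M + 2 * M ≡ 4 * M
        r₃ = solve-∀
        r₄ : ∀ x → 8 * (2 * x) ≡ 16 * x
        r₄ = solve-∀
        r₅ : ∀ x → 16 * (2 * x) ≡ 32 * x
        r₅ = solve-∀
        mixed : ℕ
        mixed = ∣ (λ x → X x ∧ Y x) ∣
        Y-split : ∣ Y ∣ ≤ mixed + ∣ Z ∣
        Y-split = ≤-trans (∑-mono (cube m) (λ x → pt (X x) (Y x))) (≤-reflexive (∑-+ (cube m) _ _))
          where
          pt : ∀ a b → ι b ≤ ι (a ∧ b) + ι (b ∧ not a)
          pt true true = s≤s z≤n
          pt true false = z≤n
          pt false true = s≤s z≤n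
          pt false false = z≤n
        Z⊆ : ∣ Z ∣ ≤ ∣ ∁ X̂ ∣
        Z⊆ = ∣∣-mono (λ x h → cong not (Z⊆∁X̂ x h))
        Z-large : 32 * mixed ≤ M → M ≤ 16 * ∣ Z ∣
        Z-large h = *-cancelˡ-≤ 2 (+-cancelˡ-≤ (2 * M) _ _ (begin
          2 * M + 2 * M                      ≡⟨ r₃ M ⟩
          4 * M                              ≤⟨ *-monoʳ-≤ 4 hY ⟩
          4 * (8 * ∣ Y ∣)                    ≡⟨ r₂ ∣ Y ∣ ⟩
          32 * ∣ Y ∣                         ≤⟨ *-monoʳ-≤ 32 Y-split ⟩
          32 * (mixed + ∣ Z ∣)               ≡⟨ r₁ mixed ∣ Z ∣ ⟩
          32 * mixed + 2 * (16 * ∣ Z ∣)      ≤⟨ +-monoˡ-≤ _ (≤-trans h (m≤m+n M _)) ⟩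
          2 * M + 2 * (16 * ∣ Z ∣)           ∎))
        half-bound : (V : Q m → Bool) → 2 * ∣ V ∣ ≤ M → ∂ V (∁ V) ≤ 2 * e → ∣ V ∣ ≤ 2 * e
        half-bound V h b = ≤-trans (≤-reflexive (sym (*-identityˡ ∣ V ∣))) (≤-trans (edge-isoperimetry 1 V (>-nonZero⁻¹ m) h) b)
        M≤32e : M ≤ 32 * e
        M≤32e with ≤-total M (32 * mixed)
        ... | inj₁ h = ≤-trans h (*-monoʳ-≤ 32 SA.mixed≤cut)
        ... | inj₂ h with ≤-total (2 * ∣ X̂ ∣) M
        ... | inj₁ small = begin
          M               ≤⟨ hX ⟩
          8 * ∣ X ∣       ≤⟨ *-monoʳ-≤ 8 (≤-trans X⊆ (half-bound X̂ small ∂X̂≤)) ⟩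
          8 * (2 * e)     ≡⟨ r₄ e ⟩
          16 * e          ≤⟨ *-monoˡ-≤ e (m≤m+n 16 16) ⟩
          32 * e          ∎
        ... | inj₂ large = begin
          M               ≤⟨ Z-large h ⟩
          16 * ∣ Z ∣      ≤⟨ *-monoʳ-≤ 16 (≤-trans Z⊆ (half-bound (∁ X̂) small' ∂∁≤)) ⟩
          16 * (2 * e)    ≡⟨ r₅ e ⟩
          32 * e          ∎
          where
          r₆ : ∀ x y → 2 * x + 2 * y ≡ (x + y) + (x + y)
          r₆ = solve-∀
          small' : 2 * ∣ ∁ X̂ ∣ ≤ M
          small' = +-cancelˡ-≤ M _ _ (begin
            M + 2 * ∣ ∁ X̂ ∣                                   ≤⟨ +-monoˡ-≤ (2 * ∣ ∁ X̂ ∣) large ⟩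
            2 * ∣ X̂ ∣ + 2 * ∣ ∁ X̂ ∣                           ≡⟨ r₆ ∣ X̂ ∣ ∣ ∁ X̂ ∣ ⟩
            (∣ X̂ ∣ + ∣ ∁ X̂ ∣) + (∣ X̂ ∣ + ∣ ∁ X̂ ∣)             ≡⟨ cong₂ _+_ (∣∣-∁ X̂) (∣∣-∁ X̂) ⟩
            M + M                                             ∎)
          ∂∁≤ : ∂ (∁ X̂) (∁ (∁ X̂)) ≤ 2 * e
          ∂∁≤ = ≤-trans (≤-reflexive (trans (∑-cong (cube m) λ x → ∑-cong (fins m) λ i →
            cong (λ b → ι (∁ X̂ x) * ι b) (not-involutive (X̂ (flip i x)))) (∂-sym (∁ X̂) X̂))) ∂X̂≤

      -- The bound on ‖A‖ passes to |X| and permits slope t = 4C, so 4C|X| ≤ 2e. Then 63m‖A‖ ≤ 64e +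
      -- 32me, and 64 ≤ 31m leaves exactly the constant 1.
      small-expand : 3 ≤ m → 4 * C ≤ m → .{{_ : NonZero C}} → ‖ A ‖ * (C * (4 * 2 ^ (4 * C))) ≤ ‖ W ‖ → ‖ A ‖ ≤ e
      small-expand 3≤m 4C≤m h = *-cancelˡ-≤ 63 (*-cancelˡ-≤ m (begin
        m * (63 * ‖ A ‖)                          ≡⟨ r₁ m ‖ A ‖ ⟩
        63 * m * ‖ A ‖                            ≤⟨ size≤cut+blocks ⟩
        64 * e + 64 * C * m * ∣ X ∣               ≡⟨ r₂ C m e ∣ X ∣ ⟩
        64 * e + 16 * m * (4 * C * ∣ X ∣)         ≤⟨ +-mono-≤ (*-monoˡ-≤ e (≤-trans (m≤m+n 64 29) (*-monoʳ-≤ 31 3≤m)))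
                                                       (*-monoʳ-≤ (16 * m) (few-blocks (4 * C) 4C≤m few)) ⟩
        31 * m * e + 16 * m * (2 * e)             ≡⟨ r₃ m e ⟩
        m * (63 * e)                              ∎))
        where
        r₁ : ∀ m a → m * (63 * a) ≡ 63 * m * a
        r₁ = solve-∀
        r₂ : ∀ C m e x → 64 * e + 64 * C * m * x ≡ 64 * e + 16 * m * (4 * C * x)
        r₂ = solve-∀
        r₃ : ∀ m e → 31 * m * e + 16 * m * (2 * e) ≡ m * (63 * e)
        r₃ = solve-∀
        r₄ : ∀ C p a → C * (p * (4 * a)) ≡ a * (C * (4 * p))
        r₄ = solve-∀
        few : 2 ^ (4 * C) * (4 * ∣ X ∣) ≤ M
        few = *-cancelˡ-≤ C (begin
          C * (2 ^ (4 * C) * (4 * ∣ X ∣))   ≤⟨ *-monoʳ-≤ C (*-monoʳ-≤ (2 ^ (4 * C)) (*-monoʳ-≤ 4 SA.∣X∣≤‖A‖)) ⟩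
          C * (2 ^ (4 * C) * (4 * ‖ A ‖))   ≡⟨ r₄ C (2 ^ (4 * C)) ‖ A ‖ ⟩
          ‖ A ‖ * (C * (4 * 2 ^ (4 * C)))   ≤⟨ ≤-trans h ‖W‖≤ ⟩
          C * M                             ∎)

    -- A may meet far more blocks than B although it has no more points. If B meets few blocks, the
    -- bound on ‖B‖ serves for ‖A‖, since the cut is symmetric.
    expand : {A B : Family m k} → Split W A B → .{{_ : NonZero m}} → ‖ A ‖ ≤ ‖ B ‖ → ‖ A ‖ ≤ (64 + 128 * C) * cut adj A B
    expand {A} {B} split A≤B with ≤-total (8 * ∣ meets A ∣) (2 ^ m) | ≤-total (8 * ∣ meets B ∣) (2 ^ m)
    ... | inj₁ fewA | _ = few-blocks-expand split fewA
    ... | inj₂ _ | inj₁ fewB = ≤-trans A≤B (subst (λ c → ‖ B ‖ ≤ (64 + 128 * C) * c) (cut-sym adj symmetric B A)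
                                 (few-blocks-expand (Split-sym split) fewB))
    ... | inj₂ manyA | inj₂ manyB = many-blocks-expand split manyA manyB

-- Natural numbers inside the rationals.

module Rationals where

  open import Defs using (ℕtoℚ)
  open import Data.Nat as ℕ using (ℕ)
  import Data.Nat.Properties as ℕ
  import Data.Integer as ℤ
  import Data.Integer.Properties as ℤ
  open import Data.Rational
  open import Data.Rational.Properties
  open import Data.Nat.Coprimality as Coprime using (1-coprimeTo)
  import Data.Rational.Unnormalised as ℚᵘ
  import Data.Rational.Unnormalised.Properties as ℚᵘ
  open import Relation.Nullary.Decidable using (dec⇒maybe)
  open import Relation.Binary.PropositionalEquality using (_≡_; refl; sym; trans; cong₂; subst₂)
  open import Data.Product using (∃-syntax; _×_; _,_)
  open import Tactic.RingSolver using () renaming (solve-∀ to ring-∀) public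
  import Tactic.RingSolver.Core.AlmostCommutativeRing as ACR

  ℚ-ring : ACR.AlmostCommutativeRing _ _
  ℚ-ring = ACR.fromCommutativeRing +-*-commutativeRing (λ q → dec⇒maybe (0ℚ ≟ q))

  -- The division in `ℕtoℚ` normalises by a gcd, which is stuck for a variable `k`; in this form
  -- order and arithmetic reduce to those of integers.
  ℕtoℚ-mk : ∀ k → ℕtoℚ k ≡ mkℚ (ℤ.+ k) 0 (Coprime.sym (1-coprimeTo k))
  ℕtoℚ-mk k = ↥p/↧p≡p (mkℚ (ℤ.+ k) 0 (Coprime.sym (1-coprimeTo k)))

  ℕtoℚ-mono : ∀ {a b} → a ℕ.≤ b → ℕtoℚ a ≤ ℕtoℚ b
  ℕtoℚ-mono {a} {b} h = subst₂ _≤_ (sym (ℕtoℚ-mk a)) (sym (ℕtoℚ-mk b))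
    (*≤* (subst₂ ℤ._≤_ (sym (ℤ.*-identityʳ _)) (sym (ℤ.*-identityʳ _)) (ℤ.+≤+ h)))

  ℕtoℚ-mono-< : ∀ {a b} → a ℕ.< b → ℕtoℚ a < ℕtoℚ b
  ℕtoℚ-mono-< {a} {b} h = subst₂ _<_ (sym (ℕtoℚ-mk a)) (sym (ℕtoℚ-mk b))
    (*<* (subst₂ ℤ._<_ (sym (ℤ.*-identityʳ _)) (sym (ℤ.*-identityʳ _)) (ℤ.+<+ h)))

  ℕtoℚ-cancel : ∀ {a b} → ℕtoℚ a ≤ ℕtoℚ b → a ℕ.≤ b
  ℕtoℚ-cancel {a} {b} h = ℕ.≮⇒≥ λ b<a → <-irrefl refl (<-≤-trans (ℕtoℚ-mono-< b<a) h)

  ℕtoℚ-+ : ∀ a b → ℕtoℚ (a ℕ.+ b) ≡ ℕtoℚ a + ℕtoℚ b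
  ℕtoℚ-+ a b = trans (ℕtoℚ-mk (a ℕ.+ b)) (trans (toℚᵘ-injective
    (ℚᵘ.≃-trans (ℚᵘ.*≡* (cong₂ ℤ._*_ (trans (ℤ.pos-+ a b) (sym (cong₂ ℤ._+_ (ℤ.*-identityʳ (ℤ.+ a)) (ℤ.*-identityʳ (ℤ.+ b))))) refl))
      (ℚᵘ.≃-sym (toℚᵘ-homo-+ (mkℚ (ℤ.+ a) 0 (Coprime.sym (1-coprimeTo a))) (mkℚ (ℤ.+ b) 0 (Coprime.sym (1-coprimeTo b)))))))
    (sym (cong₂ _+_ (ℕtoℚ-mk a) (ℕtoℚ-mk b))))

  ℕtoℚ-* : ∀ a b → ℕtoℚ (a ℕ.* b) ≡ ℕtoℚ a * ℕtoℚ b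
  ℕtoℚ-* a b = trans (ℕtoℚ-mk (a ℕ.* b)) (trans (toℚᵘ-injective
    (ℚᵘ.≃-trans (ℚᵘ.*≡* (cong₂ ℤ._*_ (ℤ.pos-* a b) refl))
      (ℚᵘ.≃-sym (toℚᵘ-homo-* (mkℚ (ℤ.+ a) 0 (Coprime.sym (1-coprimeTo a))) (mkℚ (ℤ.+ b) 0 (Coprime.sym (1-coprimeTo b)))))))
    (sym (cong₂ _*_ (ℕtoℚ-mk a) (ℕtoℚ-mk b))))

  reciprocal : ∀ M .{{_ : ℕ.NonZero M}} → ∃[ r ] (0ℚ < r × r * ℕtoℚ M ≡ 1ℚ)
  reciprocal M = 1/ q , positive⁻¹ (1/ q) {{1/pos⇒pos q}} , *-inverseˡ q
    where
    q = ℕtoℚ M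
    instance
      q>0 : Positive q
      q>0 = positive (ℕtoℚ-mono-< (ℕ.>-nonZero⁻¹ M))
      q≢0 : NonZero q
      q≢0 = pos⇒nonZero q

-- Supporting functionals for the canonical edges.

module PolytopeEdges where

  open FiniteSums
  open BlockCounting
  open import Defs using (cube; Point; dot; IsEdge; ℕtoℚ)
  open Rationals
  import Data.Rational as ℚ
  import Data.Rational.Properties as ℚ
  open import Data.Bool using (Bool; true; false; not; _∧_; _∨_) renaming (_≟_ to _≟ᵇ_)
  open import Data.Bool.Properties using (∨-comm)
  open import Data.Nat
  open import Data.Nat.Properties
  open import Data.Nat.Tactic.RingSolver using (solve-∀)
  open import Data.Fin using (Fin; zero; suc)
  open import Data.Fin.Properties using (any?)
  open import Data.List using (List; []; _∷_)
  open import Data.List.Membership.Propositional using (_∈_)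
  open import Data.List.Membership.Propositional.Properties using (∈-cartesianProduct⁺)
  open import Data.List.Relation.Unary.Any using (here; there)
  open import Data.List.Relation.Unary.All using (All; all?; lookup)
  import Data.List.Relation.Unary.All as All
  open import Data.Vec using (Vec; []; _∷_; splitAt) renaming (_++_ to _⊕_)
  open import Data.Vec.Properties using (≡-dec; ++-injectiveˡ; ++-injectiveʳ)
  open import Data.Product using (∃-syntax; _×_; _,_)
  open import Data.Sum using (_⊎_; inj₁; inj₂)
  open import Data.Empty using (⊥-elim)
  open import Relation.Nullary using (Dec; yes; no; ¬_; does; _×-dec_; _⊎-dec_; _→-dec_; ¬?; contradiction)
  open import Relation.Nullary.Decidable using (dec-true)
  open import Relation.Binary.PropositionalEquality using (_≡_; _≢_; refl; sym; trans; cong; cong₂; subst; subst₂; module ≡-Reasoning)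

  private
    variable
      I : Set
      m k n : ℕ

  pay : Bool → Bool → ℕ → ℕ
  pay true true o = 0
  pay true false o = o
  pay false true o = o
  pay false false o = 0

  dist : Q n → Q n → ℕ
  dist [] [] = 0
  dist (b ∷ u) (c ∷ w) = pay b c 1 + dist u w

  -- Number of coordinates where w differs from u, respectively outside and inside the set where u and v differ.
  out inn : Q n → Q n → Q n → ℕ
  out [] [] [] = 0
  out (b ∷ u) (c ∷ v) (d ∷ w) = pay b d (1 ∸ pay b c 1) + out u v w
  inn [] [] [] = 0
  inn (b ∷ u) (c ∷ v) (d ∷ w) = pay b d (pay b c 1) + inn u v w

  loss : Vec ℕ n → Q n → Q n → ℕ
  loss [] [] [] = 0
  loss (o ∷ ω) (b ∷ u) (c ∷ w) = pay b c o + loss ω u w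

  -- The weight is `a` where the two points agree and `b` where they differ, written with indicators
  -- so that `loss-mix` is linear in `out` and `inn`.
  mix : ℕ → ℕ → Q n → Q n → Vec ℕ n
  mix a b [] [] = []
  mix a b (c ∷ u) (d ∷ v) = (a * (1 ∸ pay c d 1) + b * pay c d 1) ∷ mix a b u v

  loss-++ : (ω₁ : Vec ℕ m) (ω₂ : Vec ℕ k) (x y : Q m) (p q : Q k) →
            loss (ω₁ ⊕ ω₂) (x ⊕ p) (y ⊕ q) ≡ loss ω₁ x y + loss ω₂ p q
  loss-++ [] ω₂ [] [] p q = refl
  loss-++ (o ∷ ω₁) ω₂ (b ∷ x) (c ∷ y) p q = trans (cong (pay b c o +_) (loss-++ ω₁ ω₂ x y p q)) (sym (+-assoc (pay b c o) _ _))

  pay-mix : ∀ a b c d e → pay c e (a * (1 ∸ pay c d 1) + b * pay c d 1) ≡ a * pay c e (1 ∸ pay c d 1) + b * pay c e (pay c d 1)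
  pay-mix a b true d true = sym (cong₂ _+_ (*-zeroʳ a) (*-zeroʳ b))
  pay-mix a b true d false = refl
  pay-mix a b false d true = refl
  pay-mix a b false d false = sym (cong₂ _+_ (*-zeroʳ a) (*-zeroʳ b))

  loss-mix : ∀ a b (u v w : Q n) → loss (mix a b u v) u w ≡ a * out u v w + b * inn u v w
  loss-mix a b [] [] [] = sym (cong₂ _+_ (*-zeroʳ a) (*-zeroʳ b))
  loss-mix a b (c ∷ u) (d ∷ v) (e ∷ w) = trans (cong₂ _+_ (pay-mix a b c d e) (loss-mix a b u v w))
    (r a b (pay c e (1 ∸ pay c d 1)) (pay c e (pay c d 1)) (out u v w) (inn u v w))
    where
    r : ∀ a b x y o i → (a * x + b * y) + (a * o + b * i) ≡ a * (x + o) + b * (y + i)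
    r = solve-∀

  swap-+ : ∀ a b c d → (a + b) + (c + d) ≡ (a + c) + (b + d)
  swap-+ = solve-∀

  dist-out-inn : (u v w : Q n) → dist u w ≡ out u v w + inn u v w
  dist-out-inn [] [] [] = refl
  dist-out-inn (c ∷ u) (d ∷ v) (e ∷ w) = trans (cong₂ _+_ (pt c d e) (dist-out-inn u v w)) (swap-+ (pay c e (1 ∸ pay c d 1)) _ _ _)
    where
    pt : ∀ c d e → pay c e 1 ≡ pay c e (1 ∸ pay c d 1) + pay c e (pay c d 1)
    pt true true true = refl
    pt true true false = refl
    pt true false true = refl
    pt true false false = refl
    pt false true true = refl
    pt false true false = refl
    pt false false true = refl
    pt false false false = refl

  inn≤dist : (u v w : Q n) → inn u v w ≤ dist u v
  inn≤dist [] [] [] = z≤n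
  inn≤dist (c ∷ u) (d ∷ v) (e ∷ w) = +-mono-≤ (pt c e (pay c d 1)) (inn≤dist u v w)
    where
    pt : ∀ c e o → pay c e o ≤ o
    pt true true o = z≤n
    pt true false o = ≤-refl
    pt false true o = ≤-refl
    pt false false o = z≤n

  out-end : (u v : Q n) → out u v v ≡ 0
  out-end [] [] = refl
  out-end (true ∷ u) (true ∷ v) = out-end u v
  out-end (true ∷ u) (false ∷ v) = out-end u v
  out-end (false ∷ u) (true ∷ v) = out-end u v
  out-end (false ∷ u) (false ∷ v) = out-end u v

  inn-end : (u v : Q n) → inn u v v ≡ dist u v
  inn-end u v = trans (sym (cong (_+ inn u v v) (out-end u v))) (sym (dist-out-inn u v v))

  inn-start : (u v : Q n) → inn u v u ≡ 0
  inn-start [] [] = refl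
  inn-start (true ∷ u) (c ∷ v) = inn-start u v
  inn-start (false ∷ u) (c ∷ v) = inn-start u v

  -- A point of the subcube spanned by `u` and `v` lies on a shortest path from `u` to `v`.
  between : (u v w : Q n) → out u v w ≡ 0 → dist u w + dist w v ≡ dist u v
  between [] [] [] h = refl
  between (true ∷ u) (true ∷ v) (true ∷ w) h = between u v w h
  between (true ∷ u) (false ∷ v) (true ∷ w) h = trans (+-suc _ _) (cong suc (between u v w h))
  between (true ∷ u) (false ∷ v) (false ∷ w) h = cong suc (between u v w h)
  between (false ∷ u) (true ∷ v) (true ∷ w) h = cong suc (between u v w h)
  between (false ∷ u) (true ∷ v) (false ∷ w) h = trans (+-suc _ _) (cong suc (between u v w h))
  between (false ∷ u) (false ∷ v) (false ∷ w) h = between u v w h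

  dist-0 : (u w : Q n) → dist u w ≡ 0 → u ≡ w
  dist-0 [] [] h = refl
  dist-0 (true ∷ u) (true ∷ w) h = cong (true ∷_) (dist-0 u w h)
  dist-0 (false ∷ u) (false ∷ w) h = cong (false ∷_) (dist-0 u w h)

  dist-refl : (u : Q n) → dist u u ≡ 0
  dist-refl [] = refl
  dist-refl (true ∷ u) = dist-refl u
  dist-refl (false ∷ u) = dist-refl u

  dist-flip : (i : Fin m) (x : Q m) → dist x (flip i x) ≡ 1
  dist-flip zero (true ∷ x) = cong suc (dist-refl x)
  dist-flip zero (false ∷ x) = cong suc (dist-refl x)
  dist-flip (suc i) (true ∷ x) = dist-flip i x
  dist-flip (suc i) (false ∷ x) = dist-flip i x

  out-same : (x y : Q m) → out x x y ≡ 0 → x ≡ y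
  out-same [] [] h = refl
  out-same (true ∷ x) (true ∷ y) h = cong (true ∷_) (out-same x y h)
  out-same (false ∷ x) (false ∷ y) h = cong (false ∷_) (out-same x y h)

  out-++ : (x y z : Q m) (p q r : Q k) → out (x ⊕ p) (y ⊕ q) (z ⊕ r) ≡ out x y z + out p q r
  out-++ [] [] [] p q r = refl
  out-++ (b ∷ x) (c ∷ y) (d ∷ z) p q r = trans (cong (_ +_) (out-++ x y z p q r)) (sym (+-assoc (pay b d (1 ∸ pay b c 1)) _ _))


  signed : Bool → ℚ.ℚ → ℚ.ℚ
  signed true c = c
  signed false c = ℚ.- c

  -- Coordinates are centred at `u`, the sign following the bit of `u`. A pair of natural vectors
  -- encodes signed weights, so that all comparisons of values stay in ℕ.
  functional : Vec ℕ n → Vec ℕ n → Q n → Vec ℚ.ℚ n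
  functional [] [] [] = []
  functional (a ∷ ω⁺) (b ∷ ω⁻) (c ∷ u) = signed c (ℕtoℚ a ℚ.- ℕtoℚ b) ∷ functional ω⁺ ω⁻ u

  entry : Bool → ℚ.ℚ → ℚ.ℚ
  entry true c = c
  entry false c = ℚ.0ℚ

  dot-∷ : ∀ c (cs : Vec ℚ.ℚ n) b w → dot (c ∷ cs) (b ∷ w) ≡ entry b c ℚ.+ dot cs w
  dot-∷ c cs true w = refl
  dot-∷ c cs false w = sym (ℚ.+-identityˡ _)

  -- Moving from u to w costs ω⁺ − ω⁻ on each coordinate changed.
  dot-loss : (ω⁺ ω⁻ : Vec ℕ n) (u w : Q n) → let c = functional ω⁺ ω⁻ u in
             dot c w ℚ.+ ℕtoℚ (loss ω⁺ u w) ≡ dot c u ℚ.+ ℕtoℚ (loss ω⁻ u w)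
  dot-loss [] [] [] [] = refl
  dot-loss (a ∷ ω⁺) (b ∷ ω⁻) (c ∷ u) (d ∷ w) = begin
    dot (_ ∷ cs) (d ∷ w) ℚ.+ ℕtoℚ (pay c d a + loss ω⁺ u w)
      ≡⟨ cong₂ ℚ._+_ (dot-∷ _ cs d w) (ℕtoℚ-+ (pay c d a) _) ⟩
    (entry d s ℚ.+ dot cs w) ℚ.+ (ℕtoℚ (pay c d a) ℚ.+ ℕtoℚ (loss ω⁺ u w))
      ≡⟨ r (entry d s) (dot cs w) (ℕtoℚ (pay c d a)) _ ⟩
    (entry d s ℚ.+ ℕtoℚ (pay c d a)) ℚ.+ (dot cs w ℚ.+ ℕtoℚ (loss ω⁺ u w))
      ≡⟨ cong₂ ℚ._+_ (pt c d) (dot-loss ω⁺ ω⁻ u w) ⟩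
    (entry c s ℚ.+ ℕtoℚ (pay c d b)) ℚ.+ (dot cs u ℚ.+ ℕtoℚ (loss ω⁻ u w))
      ≡⟨ r (entry c s) (dot cs u) (ℕtoℚ (pay c d b)) _ ⟨
    (entry c s ℚ.+ dot cs u) ℚ.+ (ℕtoℚ (pay c d b) ℚ.+ ℕtoℚ (loss ω⁻ u w))
      ≡⟨ cong₂ ℚ._+_ (dot-∷ _ cs c u) (ℕtoℚ-+ (pay c d b) _) ⟨
    dot (_ ∷ cs) (c ∷ u) ℚ.+ ℕtoℚ (pay c d b + loss ω⁻ u w) ∎
    where
    open ≡-Reasoning
    cs = functional ω⁺ ω⁻ u
    s = signed c (ℕtoℚ a ℚ.- ℕtoℚ b)
    r : ∀ x y z t → (x ℚ.+ y) ℚ.+ (z ℚ.+ t) ≡ (x ℚ.+ z) ℚ.+ (y ℚ.+ t)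
    r = ring-∀ ℚ-ring
    r₁ : ∀ a b → ℚ.0ℚ ℚ.+ a ≡ (a ℚ.- b) ℚ.+ b
    r₁ = ring-∀ ℚ-ring
    r₂ : ∀ a b → (ℚ.- (a ℚ.- b)) ℚ.+ a ≡ ℚ.0ℚ ℚ.+ b
    r₂ = ring-∀ ℚ-ring
    pt : ∀ c d → entry d (signed c (ℕtoℚ a ℚ.- ℕtoℚ b)) ℚ.+ ℕtoℚ (pay c d a)
               ≡ entry c (signed c (ℕtoℚ a ℚ.- ℕtoℚ b)) ℚ.+ ℕtoℚ (pay c d b)
    pt true true = refl
    pt true false = r₁ (ℕtoℚ a) (ℕtoℚ b)
    pt false true = r₂ (ℕtoℚ a) (ℕtoℚ b)
    pt false false = refl

  edge-by-loss : {U : List (Point n)} {u v : Point n} → u ∈ U → v ∈ U → u ≢ v → (ω⁺ ω⁻ : Vec ℕ n) →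
                 loss ω⁺ u v ≡ loss ω⁻ u v →
                 (∀ w → w ∈ U → w ≢ u → w ≢ v → loss ω⁻ u w < loss ω⁺ u w) → IsEdge U u v
  edge-by-loss {u = u} {v} u∈ v∈ u≢v ω⁺ ω⁻ eq lt = u∈ , v∈ , u≢v , c ,
    sym (cancel (trans (dot-loss ω⁺ ω⁻ u v) (cong (λ l → dot c u ℚ.+ ℕtoℚ l) (sym eq)))) ,
    λ w w∈ w≢u w≢v → drop (dot-loss ω⁺ ω⁻ u w) (ℕtoℚ-mono-< (lt w w∈ w≢u w≢v))
    where
    c = functional ω⁺ ω⁻ u
    back : ∀ x l → (x ℚ.+ l) ℚ.+ ℚ.- l ≡ x
    back = ring-∀ ℚ-ring
    cancel : ∀ {x y l} → x ℚ.+ l ≡ y ℚ.+ l → x ≡ y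
    cancel {x} {y} {l} h = trans (sym (back x l)) (trans (cong (ℚ._+ ℚ.- l) h) (back y l))
    drop : ∀ {x y l l'} → x ℚ.+ l ≡ y ℚ.+ l' → l' ℚ.< l → x ℚ.< y
    drop {x} {y} {l} {l'} h l'<l = subst₂ ℚ._<_ (trans (cong (ℚ._+ ℚ.- l) (sym h)) (back x l)) (back y l)
      (ℚ.+-monoˡ-< (ℚ.- l) (ℚ.+-monoʳ-< y l'<l))

  IsEdge-sym : {U : List (Point n)} {u v : Point n} → IsEdge U u v → IsEdge U v u
  IsEdge-sym (u∈ , v∈ , u≢v , c , eq , h) = v∈ , u∈ , (λ e → u≢v (sym e)) , c , sym eq ,
    λ w w∈ w≢v w≢u → subst (dot c w ℚ.<_) eq (h w w∈ w≢u w≢v)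

  minimise : (f : I → ℕ) (P : I → Bool) (xs : List I) →
             (∀ {x} → x ∈ xs → P x ≡ false) ⊎ ∃[ x ] (P x ≡ true × (∀ {y} → y ∈ xs → P y ≡ true → f x ≤ f y))
  minimise f P [] = inj₁ λ ()
  minimise f P (x ∷ xs) with P x in px | minimise f P xs
  ... | false | inj₁ none = inj₁ λ { (here refl) → px ; (there y∈) → none y∈ }
  ... | false | inj₂ (z , pz , h) = inj₂ (z , pz , λ { (here refl) py → contradiction (trans (sym px) py) λ () ; (there y∈) → h y∈ })
  ... | true | inj₁ none = inj₂ (x , px , λ { (here refl) _ → ≤-refl ; (there y∈) py → contradiction (trans (sym (none y∈)) py) λ () })
  ... | true | inj₂ (z , pz , h) with ≤-total (f x) (f z)
  ... | inj₁ le = inj₂ (x , px , λ { (here refl) _ → ≤-refl ; (there y∈) py → ≤-trans le (h y∈ py) })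
  ... | inj₂ le = inj₂ (z , pz , λ { (here refl) _ → le ; (there y∈) py → h y∈ py })

  minimum : (f : I → ℕ) (P : I → Bool) {xs : List I} {x₀ : I} → x₀ ∈ xs → P x₀ ≡ true →
            ∃[ x ] (P x ≡ true × (∀ {y} → y ∈ xs → P y ≡ true → f x ≤ f y))
  minimum f P {xs} x₀∈ h with minimise f P xs
  ... | inj₂ r = r
  ... | inj₁ none with () ← trans (sym (none x₀∈)) h

  _≟Q_ : (u v : Q n) → Dec (u ≡ v)
  _≟Q_ = ≡-dec _≟ᵇ_

  module Canonical (W : Family m k) where

    Nearest : Q m → Q k → Q m → Q k → Set
    Nearest x p y q = (∃[ i ] y ≡ flip i x) × All (λ r → W y r ≡ true → dist p q ≤ dist p r) (cube k)

    -- out p q r ≡ 0 says that r lies in the subcube spanned by p and q.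
    Alone : Q m → Q k → Q m → Q k → Set
    Alone x p y q = y ≡ x × p ≢ q × All (λ r → W x r ≡ true → out p q r ≡ 0 → r ≡ p ⊎ r ≡ q) (cube k)

    Joined : Q m → Q k → Q m → Q k → Set
    Joined x p y q = W x p ≡ true × W y q ≡ true × (Nearest x p y q ⊎ Alone x p y q)

    -- Opaque, so that type checking never unfolds this search through the cube.
    abstract
      joined? : ∀ x p y q → Dec (Joined x p y q)
      joined? x p y q = (W x p ≟ᵇ true) ×-dec (W y q ≟ᵇ true) ×-dec
        ((any? (λ i → y ≟Q flip i x) ×-dec all? (λ r → (W y r ≟ᵇ true) →-dec (dist p q ≤? dist p r)) (cube k))
        ⊎-dec ((y ≟Q x) ×-dec ¬? (p ≟Q q) ×-dec
          all? (λ r → (W x r ≟ᵇ true) →-dec ((out p q r ≟ 0) →-dec ((r ≟Q p) ⊎-dec (r ≟Q q)))) (cube k)))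

    -- Symmetrised, because being nearest is not a symmetric relation.
    adj : Adjacency m k
    adj x p y q = does (joined? x p y q) ∨ does (joined? y q x p)

    does-elim : ∀ {P : Set} (d : Dec P) → does d ≡ true → P
    does-elim (yes p) _ = p

    joined⇒adj : ∀ {x p y q} → Joined x p y q → adj x p y q ≡ true
    joined⇒adj {x} {p} {y} {q} j = cong (_∨ does (joined? y q x p)) (dec-true (joined? x p y q) j)

    adj⇒joined : ∀ {x p y q} → adj x p y q ≡ true → Joined x p y q ⊎ Joined y q x p
    adj⇒joined {x} {p} {y} {q} h with joined? x p y q
    ... | yes j = inj₁ j
    ... | no _ = inj₂ (does-elim (joined? y q x p) h)

    canonical : CanonicalEdges W adj
    canonical = record { symmetric = λ x p y q → ∨-comm (does (joined? x p y q)) _ ; across = across ; within = within }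
      where
      across : ∀ x p i → W x p ≡ true → ∃[ q ] (W (flip i x) q ≡ true) →
               ∃[ q ] (W (flip i x) q ≡ true × adj x p (flip i x) q ≡ true)
      across x p i wp (q₀ , wq₀) with minimum (dist p) (W (flip i x)) (∈-cube q₀) wq₀
      ... | q , wq , least = q , wq ,
            joined⇒adj (wp , wq , inj₁ ((i , refl) , All.tabulate (λ r∈ → least r∈)))
      ∧-intro : ∀ {a b c d} → a ≡ true → b ≡ true → c ≡ true → d ≡ false → (a ∧ b) ∧ (c ∧ not d) ≡ true
      ∧-intro refl refl refl refl = refl
      ∧-elim : ∀ a b c d → (a ∧ b) ∧ (c ∧ not d) ≡ true → a ≡ true × b ≡ true × c ≡ true × d ≡ false
      ∧-elim true true true false h = refl , refl , refl , refl
      within : ∀ x (a : Q k → Bool) {p q} → W x p ≡ true → a p ≡ true → W x q ≡ true → a q ≡ false →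
               ∃[ p ] ∃[ q ] (W x p ≡ true × a p ≡ true × W x q ≡ true × a q ≡ false × adj x p x q ≡ true)
      within x a {p₀} {q₀} wp₀ ap₀ wq₀ aq₀
        with minimum (λ (p , q) → dist p q) (λ (p , q) → (W x p ∧ a p) ∧ (W x q ∧ not (a q)))
               (∈-cartesianProduct⁺ (∈-cube p₀) (∈-cube q₀)) (∧-intro wp₀ ap₀ wq₀ aq₀)
      ... | (p , q) , good , least with ∧-elim (W x p) (a p) (W x q) (a q) good
      ... | wp , ap , wq , aq = p , q , wp , ap , wq , aq ,
            joined⇒adj (wp , wq , inj₂ (refl , p≢q , All.tabulate (λ {r} _ → alone r)))
        where
        p≢q : p ≢ q
        p≢q refl with () ← trans (sym ap) aq
        squeeze : ∀ {a b c} → a + b ≡ c → c ≤ b → a ≡ 0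
        squeeze {a} {b} refl h = n≤0⇒n≡0 (+-cancelʳ-≤ b a 0 h)
        -- Such an `r` can replace whichever of `p` and `q` is on its side of `a`. The new pair is
        -- no farther apart, so by minimality `r` coincides with the point it replaces.
        alone : ∀ r → W x r ≡ true → out p q r ≡ 0 → r ≡ p ⊎ r ≡ q
        alone r wr o with a r in ar
        ... | true = inj₁ (sym (dist-0 p r (squeeze (between p q r o)
                (least (∈-cartesianProduct⁺ (∈-cube r) (∈-cube q)) (∧-intro wr ar wq aq)))))
        ... | false = inj₂ (dist-0 r q (squeeze (trans (+-comm (dist r q) (dist p r)) (between p q r o))
                (least (∈-cartesianProduct⁺ (∈-cube p) (∈-cube r)) (∧-intro wp ap wr ar))))

    module _ {U : List (Point (m + k))} (U⇒W : ∀ {x p} → (x ⊕ p) ∈ U → W x p ≡ true)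
             (W⇒U : ∀ {x p} → W x p ≡ true → (x ⊕ p) ∈ U) where

      private
        splitting : (w : Q (m + k)) → ∃[ z ] ∃[ r ] w ≡ z ⊕ r
        splitting w with splitAt m w
        ... | z , r , eq = z , r , eq

      -- Weight 1 on the common coordinates of u and v exposes the face of the cube that they span,
      -- and U has no third point there.
      alone-edge : ∀ {x p q} → W x p ≡ true → W x q ≡ true → p ≢ q →
                   All (λ r → W x r ≡ true → out p q r ≡ 0 → r ≡ p ⊎ r ≡ q) (cube k) → IsEdge U (x ⊕ p) (x ⊕ q)
      alone-edge {x} {p} {q} wp wq p≢q alone = edge-by-loss (W⇒U wp) (W⇒U wq) u≢v (mix 1 0 u v) (mix 0 0 u v)
        (trans (loss-mix 1 0 u v v) (trans (cong (λ o → 1 * o + 0) (out-end u v)) (sym (loss-mix 0 0 u v v)))) lt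
        where
        u = x ⊕ p
        v = x ⊕ q
        u≢v : u ≢ v
        u≢v e = p≢q (++-injectiveʳ x x e)
        lt : ∀ w → w ∈ U → w ≢ u → w ≢ v → loss (mix 0 0 u v) u w < loss (mix 1 0 u v) u w
        lt w w∈ w≢u w≢v with splitting w
        ... | z , r , refl rewrite loss-mix 0 0 u v (z ⊕ r) | loss-mix 1 0 u v (z ⊕ r) with out u v (z ⊕ r) in o
        ... | suc _ = s≤s z≤n
        ... | zero with out-same x z (m+n≡0⇒m≡0 _ (trans (sym (out-++ x x z p q r)) o))
        ... | refl with lookup alone (∈-cube r) (U⇒W w∈) (m+n≡0⇒n≡0 (out x x x) (trans (sym (out-++ x x x p q r)) o))
        ... | inj₁ refl = ⊥-elim (w≢u refl)
        ... | inj₂ refl = ⊥-elim (w≢v refl)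

      -- The weights on the common coordinates of the two blocks exclude all other blocks, the weight −d on the flipped
      -- coordinate balances u against v, and the weights 1 and 2 on the fibre break the ties among nearest points.
      nearest-edge : ∀ {x p q} i → let y = flip i x in W x p ≡ true → W y q ≡ true →
                     All (λ r → W y r ≡ true → dist p q ≤ dist p r) (cube k) → IsEdge U (x ⊕ p) (y ⊕ q)
      nearest-edge {x} {p} {q} i wp wq near = edge-by-loss (W⇒U wp) (W⇒U wq) u≢v ω⁺ ω⁻ balanced lt
        where
        open ≤-Reasoning
        y = flip i x
        u = x ⊕ p
        v = y ⊕ q
        d = dist p q
        ω⁺ = mix (suc d) 0 x y ⊕ mix 2 1 p q
        ω⁻ = mix 0 d x y ⊕ mix 0 0 p q
        u≢v : u ≢ v
        u≢v e with () ← trans (sym (trans (cong (dist x) (++-injectiveˡ x y e)) (dist-flip i x))) (dist-refl x)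
        loss⁺ : ∀ z r → loss ω⁺ u (z ⊕ r) ≡ (suc d * out x y z + 0) + (2 * out p q r + 1 * inn p q r)
        loss⁺ z r = trans (loss-++ (mix (suc d) 0 x y) (mix 2 1 p q) x z p r) (cong₂ _+_ (loss-mix (suc d) 0 x y z) (loss-mix 2 1 p q r))
        loss⁻ : ∀ z r → loss ω⁻ u (z ⊕ r) ≡ d * inn x y z
        loss⁻ z r = trans (loss-++ (mix 0 d x y) (mix 0 0 p q) x z p r)
          (trans (cong₂ _+_ (loss-mix 0 d x y z) (loss-mix 0 0 p q r)) (+-identityʳ _))
        balanced : loss ω⁺ u v ≡ loss ω⁻ u v
        balanced = trans (loss⁺ y q) (trans (cong₂ _+_ (cong (λ o → suc d * o + 0) (out-end x y))
          (cong₂ (λ o e → 2 * o + 1 * e) (out-end p q) (inn-end p q)))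
          (trans (e₁ d) (sym (trans (loss⁻ y q) (cong (d *_) (trans (inn-end x y) (dist-flip i x)))))))
          where
          e₁ : ∀ d → (suc d * 0 + 0) + (2 * 0 + 1 * d) ≡ d * 1
          e₁ = solve-∀
        2out : ∀ r → 2 * out p q r + 1 * inn p q r ≡ out p q r + dist p r
        2out r = trans (e₁ (out p q r) (inn p q r)) (cong (out p q r +_) (sym (dist-out-inn p q r)))
          where
          e₁ : ∀ o i → 2 * o + 1 * i ≡ o + (o + i)
          e₁ = solve-∀
        lt : ∀ w → w ∈ U → w ≢ u → w ≢ v → loss ω⁻ u w < loss ω⁺ u w
        lt w w∈ w≢u w≢v with splitting w
        ... | z , r , refl = subst₂ _<_ (sym (loss⁻ z r)) (sym (trans (loss⁺ z r) (cong ((suc d * out x y z + 0) +_) (2out r)))) (go (out x y z) refl)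
          where
          inn≤1 : inn x y z ≤ 1
          inn≤1 = ≤-trans (inn≤dist x y z) (≤-reflexive (dist-flip i x))
          go : ∀ o → out x y z ≡ o → d * inn x y z < (suc d * out x y z + 0) + (out p q r + dist p r)
          go (suc o) eq rewrite eq = begin-strict
            d * inn x y z                                          ≤⟨ *-monoʳ-≤ d inn≤1 ⟩
            d * 1                                                  ≡⟨ *-identityʳ d ⟩
            d                                                      <⟨ n<1+n d ⟩
            suc d                                                  ≤⟨ m≤m*n (suc d) (suc o) ⟩
            suc d * suc o                                          ≤⟨ ≤-trans (m≤m+n _ 0) (m≤m+n _ _) ⟩
            (suc d * suc o + 0) + (out p q r + dist p r)           ∎
          -- Now `z` lies in the subcube spanned by two adjacent vertices, so it is `x` or `y`.
          go zero eq rewrite eq | *-zeroʳ d = side (dist x z) refl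
            where
            apart : dist x z + dist z y ≡ 1
            apart = trans (between x y z eq) (dist-flip i x)
            side : ∀ t → dist x z ≡ t → d * inn x y z < out p q r + dist p r
            side zero e₀ with dist-0 x z e₀
            ... | refl rewrite inn-start x y | *-zeroʳ d = ≤-trans (pos (dist p r) refl) (m≤n+m _ (out p q r))
              where
              pos : ∀ s → dist p r ≡ s → 1 ≤ dist p r
              pos (suc s) e rewrite e = s≤s z≤n
              pos zero e with dist-0 p r e
              ... | refl = ⊥-elim (w≢u refl)
            side (suc t) e₀ with dist-0 z y (m+n≡0⇒n≡0 t (suc-injective (trans (sym (cong (_+ dist z y) e₀)) apart)))
            ... | refl rewrite inn-end x y | dist-flip i x | *-identityʳ d = far (out p q r) refl
              where
              d≤ : d ≤ dist p r
              d≤ = lookup near (∈-cube r) (U⇒W w∈)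
              far : ∀ o → out p q r ≡ o → d < out p q r + dist p r
              far (suc o) e rewrite e = s≤s (≤-trans d≤ (m≤n+m _ o))
              -- Here `r` is on a shortest path from `p` to `q` and no nearer to `p` than `q` is;
              -- only `q` itself attains equality.
              far zero e with m≤n⇒m<n∨m≡n d≤
              ... | inj₁ d< rewrite e = d<
              ... | inj₂ d≡ with dist-0 r q (+-cancelˡ-≡ (dist p r) _ _
                                   (trans (between p q r e) (trans d≡ (sym (+-identityʳ (dist p r))))))
              ... | refl = ⊥-elim (w≢v refl)

      joined-edge : ∀ {x p y q} → Joined x p y q → IsEdge U (x ⊕ p) (y ⊕ q)
      joined-edge (wp , wq , inj₁ ((i , refl) , near)) = nearest-edge i wp wq near
      joined-edge (wp , wq , inj₂ (refl , p≢q , alone)) = alone-edge wp wq p≢q alone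

      adj-edge : ∀ {x p y q} → adj x p y q ≡ true → IsEdge U (x ⊕ p) (y ⊕ q)
      adj-edge h with adj⇒joined h
      ... | inj₁ j = joined-edge j
      ... | inj₂ j = IsEdge-sym (joined-edge j)

-- Subsets as lists, seen as families of blocks.

module TypicalSubsets where

  open import Defs
  open FiniteSums
  open BlockCounting
  open PolytopeEdges
  open Rationals
  open MajorityExtension using (≤ᵇ-true)
  import Data.Rational as ℚ
  import Data.Rational.Properties as ℚ
  open import Data.Bool using (Bool; true; false; not; _∧_; _∨_)
  open import Data.Bool.Properties using (T?; T-≡)
  open import Data.Nat
  open import Data.Nat.Properties
  open import Data.Fin using (zero; suc)
  open import Data.List using (List; []; _∷_; _++_; map; length; filterᵇ; cartesianProduct)
  open import Data.List.Membership.Propositional using (_∈_)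
  open import Data.List.Membership.Propositional.Properties using (∈-map⁻; ∈-++⁻; ∈-filter⁻)
  open import Data.List.Relation.Unary.Any using (here; there)
  open import Data.List.Relation.Unary.All as All using ([]; _∷_)
  open import Data.List.Relation.Unary.AllPairs using ([]; _∷_)
  open import Data.List.Relation.Unary.Unique.Propositional using (Unique)
  import Data.List.Relation.Unary.Unique.Propositional.Properties as Unique
  open import Data.Vec using ([]; _∷_) renaming (_++_ to _⊕_)
  open import Data.Vec.Properties using (∷-injectiveʳ)
  open import Data.Product using (_×_; _,_; proj₁; proj₂)
  open import Data.Sum using (inj₁; inj₂)
  open import Data.Empty using (⊥; ⊥-elim)
  open import Function using (_∘_; Equivalence)
  open import Relation.Binary.PropositionalEquality using (_≡_; refl; sym; trans; cong; cong₂; subst; subst₂; module ≡-Reasoning)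

  private
    variable
      I J : Set
      m k n : ℕ

  eq : Q n → Q n → Bool
  eq [] [] = true
  eq (true ∷ u) (true ∷ w) = eq u w
  eq (true ∷ u) (false ∷ w) = false
  eq (false ∷ u) (true ∷ w) = false
  eq (false ∷ u) (false ∷ w) = eq u w

  eq-refl : (u : Q n) → eq u u ≡ true
  eq-refl [] = refl
  eq-refl (true ∷ u) = eq-refl u
  eq-refl (false ∷ u) = eq-refl u

  eq-sound : (u w : Q n) → eq u w ≡ true → u ≡ w
  eq-sound [] [] h = refl
  eq-sound (true ∷ u) (true ∷ w) h = cong (true ∷_) (eq-sound u w h)
  eq-sound (false ∷ u) (false ∷ w) h = cong (false ∷_) (eq-sound u w h)

  ∑-delta : ∀ n (u : Q n) (f : Q n → ℕ) → ∑ (cube n) (λ w → ι (eq w u) * f w) ≡ f u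
  ∑-delta zero [] f = trans (+-identityʳ _) (*-identityˡ (f []))
  ∑-delta (suc n) (true ∷ u) f = trans (∑-cube-suc {n} _) (trans (cong₂ _+_ (∑-delta n u (λ w → f (true ∷ w))) (∑-0 (cube n))) (+-identityʳ _))
  ∑-delta (suc n) (false ∷ u) f = trans (∑-cube-suc {n} _) (cong₂ _+_ (∑-0 (cube n)) (∑-delta n u (λ w → f (false ∷ w))))

  mem : List (Q n) → Q n → Bool
  mem U w = some U (eq w)

  mem-sound : (U : List (Q n)) {w : Q n} → mem U w ≡ true → w ∈ U
  mem-sound (u ∷ U) {w} h with eq w u in e
  ... | true = here (eq-sound w u e)
  ... | false = there (mem-sound U h)

  mem-complete : {U : List (Q n)} {w : Q n} → w ∈ U → mem U w ≡ true
  mem-complete {w = w} w∈ = some-intro (eq w) w∈ (eq-refl w)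

  -- The bridge from lists to indicator functions: without repetitions, the indicator of `U` is the
  -- sum of the deltas at its entries.
  ∑-unique : {U : List (Q n)} → Unique U → (f : Q n → ℕ) → ∑ U f ≡ ∑ (cube n) (λ w → ι (mem U w) * f w)
  ∑-unique {n} {[]} _ f = sym (∑-0 (cube n))
  ∑-unique {n} {u ∷ U} (u∉ ∷ uniq) f = begin
    f u + ∑ U f
      ≡⟨ cong₂ _+_ (sym (∑-delta n u f)) (∑-unique uniq f) ⟩
    ∑ (cube n) (λ w → ι (eq w u) * f w) + ∑ (cube n) (λ w → ι (mem U w) * f w)
      ≡⟨ ∑-+ (cube n) _ _ ⟨
    ∑ (cube n) (λ w → ι (eq w u) * f w + ι (mem U w) * f w)
      ≡⟨ ∑-cong (cube n) (λ w → trans (sym (*-distribʳ-+ (f w) (ι (eq w u)) _)) (cong (_* f w) (pt w))) ⟩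
    ∑ (cube n) (λ w → ι (mem (u ∷ U) w) * f w) ∎
    where
    open ≡-Reasoning
    pt : ∀ w → ι (eq w u) + ι (mem U w) ≡ ι (eq w u ∨ mem U w)
    pt w with eq w u in e | mem U w in e'
    ... | false | _ = refl
    ... | true | false = refl
    ... | true | true = ⊥-elim (All.lookup u∉ (mem-sound U e') (sym (eq-sound w u e)))

  ∈-sublists : {xs U : List I} → U ∈ sublists xs → ∀ {z} → z ∈ U → z ∈ xs
  ∈-sublists {xs = []} (here refl) ()
  ∈-sublists {xs = x ∷ xs} U∈ z∈ with ∈-++⁻ (map (x ∷_) (sublists xs)) U∈
  ... | inj₂ U∈' = there (∈-sublists U∈' z∈)
  ... | inj₁ U∈' with ∈-map⁻ (x ∷_) U∈'
  ... | V , V∈ , refl with z∈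
  ... | here z≡x = here z≡x
  ... | there z∈V = there (∈-sublists V∈ z∈V)

  sublists-unique : {xs U : List I} → Unique xs → U ∈ sublists xs → Unique U
  sublists-unique {xs = []} _ (here refl) = []
  sublists-unique {xs = x ∷ xs} (x∉ ∷ uniq) U∈ with ∈-++⁻ (map (x ∷_) (sublists xs)) U∈
  ... | inj₂ U∈' = sublists-unique uniq U∈'
  ... | inj₁ U∈' with ∈-map⁻ (x ∷_) U∈'
  ... | V , V∈ , refl = All.tabulate (λ z∈ → All.lookup x∉ (∈-sublists V∈ z∈)) ∷ sublists-unique uniq V∈

  cube-unique : ∀ n → Unique (cube n)
  cube-unique zero = [] ∷ []
  cube-unique (suc n) = Unique.++⁺ (Unique.map⁺ ∷-injectiveʳ (cube-unique n)) (Unique.map⁺ ∷-injectiveʳ (cube-unique n)) apart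
    where
    apart : ∀ {v} → v ∈ map (true ∷_) (cube n) × v ∈ map (false ∷_) (cube n) → ⊥
    apart (v∈ , v∈') with ∈-map⁻ (true ∷_) v∈ | ∈-map⁻ (false ∷_) v∈'
    ... | _ , _ , refl | _ , _ , ()

  length-filterᵇ : (P : I → Bool) (xs : List I) → length (filterᵇ P xs) ≡ ∑ xs (λ x → ι (P x))
  length-filterᵇ P [] = refl
  length-filterᵇ P (x ∷ xs) with P x
  ... | true = cong suc (length-filterᵇ P xs)
  ... | false = length-filterᵇ P xs

  ∑-cartesian : (xs : List I) (ys : List J) (f : I × J → ℕ) →
                ∑ (cartesianProduct xs ys) f ≡ ∑ xs (λ x → ∑ ys (λ y → f (x , y)))
  ∑-cartesian [] ys f = refl
  ∑-cartesian (x ∷ xs) ys f = trans (∑-++ (map (x ,_) ys) _ f) (cong₂ _+_ (∑-map (x ,_) ys f) (∑-cartesian xs ys f))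

  ∧-elim : ∀ {a b} → a ∧ b ≡ true → a ≡ true × b ≡ true
  ∧-elim {true} {true} h = refl , refl

  not-elim : ∀ {a} → not a ≡ true → a ≡ false
  not-elim {false} h = refl

  not-false : ∀ {a} → not a ≡ false → a ≡ true
  not-false {true} h = refl

  block : ∀ m → Q (m + k) → Q m
  block zero u = []
  block (suc m) (b ∷ u) = b ∷ block m u

  rest : ∀ m → Q (m + k) → Q k
  rest zero u = u
  rest (suc m) (b ∷ u) = rest m u

  block-rest : ∀ m (u : Q (m + k)) → block m u ⊕ rest m u ≡ u
  block-rest zero u = refl
  block-rest (suc m) (b ∷ u) = cong (b ∷_) (block-rest m u)

  block-⊕ : (x : Q m) (p : Q k) → block m (x ⊕ p) ≡ x
  block-⊕ [] p = refl
  block-⊕ (b ∷ x) p = cong (b ∷_) (block-⊕ x p)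

  rest-⊕ : (x : Q m) (p : Q k) → rest m (x ⊕ p) ≡ p
  rest-⊕ [] p = refl
  rest-⊕ (b ∷ x) p = rest-⊕ x p

  -- A sum over the list, not over the block: expectations are computed by adding points to `U` one
  -- at a time, which needs exponents additive in `U`.
  load : ∀ m → List (Q (m + k)) → Q m → ℕ
  load m U y = ∑ U (λ u → ι (eq (block m u) y))

  isZero : ℕ → ℕ
  isZero zero = 1
  isZero (suc _) = 0

  sparseAt crowdedAt : ∀ m → List (Q (m + k)) → Q m → ℕ
  sparseAt m U x = ∑ (fins m) (λ i → isZero (load m U (flip i x)))
  crowdedAt m U x = ∑ (fins m) (λ i → load m U (flip i x))

  -- Boolean-valued, since `ProbAtLeast` asks for a Boolean selector of outcomes.
  typicalAt : ∀ C m → List (Q (m + k)) → Q m → Bool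
  typicalAt C m U x = (64 * sparseAt m U x ≤ᵇ m) ∧ (crowdedAt m U x ≤ᵇ C * m)

  every : List I → (I → Bool) → Bool
  every xs P = not (some xs (λ x → not (P x)))

  every-elim : {xs : List I} (P : I → Bool) {x : I} → x ∈ xs → every xs P ≡ true → P x ≡ true
  every-elim P {x} x∈ h = not-false (some-none (λ x → not (P x)) x∈ (not-elim h))

  module _ {m k : ℕ} {U : List (Q (m + k))} (U∈ : U ∈ sublists (cube (m + k))) where

    private
      uniq : Unique U
      uniq = sublists-unique (cube-unique (m + k)) U∈

    W : Family m k
    W x p = mem U (x ⊕ p)

    load≡ : ∀ y → load m U y ≡ ∑ (cube k) (λ q → ι (W y q))
    load≡ y = begin
      load m U y
        ≡⟨ ∑-unique uniq _ ⟩
      ∑ (cube (m + k)) (λ u → ι (mem U u) * ι (eq (block m u) y))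
        ≡⟨ ∑-cube-+ m _ ⟩
      ∑ (cube m) (λ x → ∑ (cube k) (λ p → ι (W x p) * ι (eq (block m (x ⊕ p)) y)))
        ≡⟨ ∑-cong (cube m) (λ x → ∑-cong (cube k) (λ p → cong (λ b → ι (W x p) * ι (eq b y)) (block-⊕ x p))) ⟩
      ∑ (cube m) (λ x → ∑ (cube k) (λ p → ι (W x p) * ι (eq x y)))
        ≡⟨ ∑-cong (cube m) (λ x → trans (∑-*ʳ (ι (eq x y)) (cube k) _) (*-comm _ (ι (eq x y)))) ⟩
      ∑ (cube m) (λ x → ι (eq x y) * ∑ (cube k) (λ p → ι (W x p)))
        ≡⟨ ∑-delta m y _ ⟩
      ∑ (cube k) (λ q → ι (W y q)) ∎
      where open ≡-Reasoning

    empty≤ : ∀ y → ι (not (meets W y)) ≤ isZero (load m U y)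
    empty≤ y with meets W y in e
    ... | true = z≤n
    ... | false rewrite load≡ y = ≤-reflexive (sym (cong isZero (trans
            (∑-cong (cube k) (λ q → cong ι (some-none (W y) (∈-cube q) e))) (∑-0 (cube k)))))

    typical : ∀ {C} → every (cube m) (typicalAt C m U) ≡ true → Typical C W
    typical {C} h = record
      { few-empty = λ x → ≤-trans (*-monoʳ-≤ 64 (∑-mono (fins m) (λ i → empty≤ (flip i x)))) (≤ᵇ-true (proj₁ (at x)))
      ; not-crowded = λ x → subst (_≤ C * m) (∑-cong (fins m) (λ i → load≡ (flip i x))) (≤ᵇ-true (proj₂ (at x)))
      }
      where
      at : ∀ x → (64 * sparseAt m U x ≤ᵇ m) ≡ true × (crowdedAt m U x ≤ᵇ C * m) ≡ true
      at x = ∧-elim (every-elim (typicalAt C m U) (∈-cube x) h)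

    module Selected (a : Point (m + k) → Bool) where

      A B : Family m k
      A x p = W x p ∧ a (x ⊕ p)
      B x p = W x p ∧ not (a (x ⊕ p))

      split : Split W A B
      split = record { cover = λ x p → cov (W x p) (a (x ⊕ p)) ; disjoint = λ x p → dis (W x p) (a (x ⊕ p)) }
        where
        cov : ∀ w a → w ≡ (w ∧ a) ∨ (w ∧ not a)
        cov true true = refl
        cov true false = refl
        cov false a = refl
        dis : ∀ w a → (w ∧ a) ∧ (w ∧ not a) ≡ false
        dis true true = refl
        dis true false = refl
        dis false a = refl

      ‖A‖≡ : ‖ A ‖ ≡ length (sub a U)
      ‖A‖≡ = sym (trans (length-filterᵇ a U) (trans (∑-unique uniq _) (trans (∑-cube-+ m _)
        (∑-cong (cube m) λ x → ∑-cong (cube k) λ p → sym (ι-∧ (W x p) (a (x ⊕ p)))))))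

      ‖W‖≡ : ‖ W ‖ ≡ length U
      ‖W‖≡ = trans (sym (trans (∑-unique uniq (λ _ → 1)) (trans (∑-cube-+ m _)
        (∑-cong (cube m) λ x → ∑-cong (cube k) λ p → *-identityʳ (ι (W x p))))))
        (trans (∑-const U 1) (*-identityʳ (length U)))

      ‖A‖+‖B‖ : ‖ A ‖ + ‖ B ‖ ≡ ‖ W ‖
      ‖A‖+‖B‖ = trans (sym (∑∑-+ (cube m) (cube k) _ _)) (∑-cong (cube m) λ x → ∑-cong (cube k) λ p → pt (W x p) (a (x ⊕ p)))
        where
        pt : ∀ w a → ι (w ∧ a) + ι (w ∧ not a) ≡ ι w
        pt true true = refl
        pt true false = refl
        pt false a = refl

      open Canonical W using (adj; canonical; adj-edge)

      good : Point (m + k) × Point (m + k) → Bool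
      good (u , v) = (mem U u ∧ a u) ∧ ((mem U v ∧ not (a v)) ∧ adj (block m u) (rest m u) (block m v) (rest m v))

      -- Filtering the list of all ordered pairs makes distinctness automatic and turns the length
      -- into a double sum, namely `cut`.
      edges : List (Point (m + k) × Point (m + k))
      edges = filterᵇ good (cartesianProduct (cube (m + k)) (cube (m + k)))

      length-edges : length edges ≡ cut adj A B
      length-edges = begin
        length edges
          ≡⟨ length-filterᵇ good (cartesianProduct (cube (m + k)) (cube (m + k))) ⟩
        ∑ (cartesianProduct (cube (m + k)) (cube (m + k))) (λ e → ι (good e))
          ≡⟨ ∑-cartesian (cube (m + k)) (cube (m + k)) _ ⟩
        ∑ (cube (m + k)) (λ u → ∑ (cube (m + k)) (λ v → ι (good (u , v))))
          ≡⟨ ∑-cube-+ m _ ⟩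
        ∑ (cube m) (λ x → ∑ (cube k) (λ p → ∑ (cube (m + k)) (λ v → ι (good (x ⊕ p , v)))))
          ≡⟨ ∑-cong (cube m) (λ x → ∑-cong (cube k) (λ p → ∑-cube-+ m _)) ⟩
        ∑ (cube m) (λ x → ∑ (cube k) (λ p → ∑ (cube m) (λ y → ∑ (cube k) (λ q → ι (good (x ⊕ p , y ⊕ q))))))
          ≡⟨ ∑-cong (cube m) (λ x → ∑-swap (cube k) (cube m) _) ⟩
        ∑ (cube m) (λ x → ∑ (cube m) (λ y → ∑ (cube k) (λ p → ∑ (cube k) (λ q → ι (good (x ⊕ p , y ⊕ q))))))
          ≡⟨ ∑-cong (cube m) (λ x → ∑-cong (cube m) (λ y → ∑-cong (cube k) (λ p → ∑-cong (cube k) (pt x y p)))) ⟩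
        cut adj A B ∎
        where
        open ≡-Reasoning
        pt : ∀ x y p q → ι (good (x ⊕ p , y ⊕ q)) ≡ ι (A x p) * (ι (B y q) * ι (adj x p y q))
        pt x y p q rewrite block-⊕ x p | rest-⊕ x p | block-⊕ y q | rest-⊕ y q =
          trans (ι-∧ (A x p) _) (cong (ι (A x p) *_) (ι-∧ (B y q) _))

      edges-sound : ∀ u v → (u , v) ∈ edges → a u ≡ true × a v ≡ false × IsEdge U u v
      edges-sound u v uv∈ =
        let h = Equivalence.to T-≡ (proj₂ (∈-filter⁻ (T? ∘ good) {xs = cartesianProduct (cube (m + k)) (cube (m + k))} uv∈))
            hu , h' = ∧-elim {mem U u ∧ a u} h
            hv , hadj = ∧-elim {mem U v ∧ not (a v)} h'
        in proj₂ (∧-elim {mem U u} hu) , not-elim (proj₂ (∧-elim {mem U v} hv)) ,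
           subst₂ (IsEdge U) (block-rest m u) (block-rest m v)
             (adj-edge mem-complete (mem-sound U) {block m u} {rest m u} {block m v} {rest m v} hadj)

      edges-at-least : ∀ {t} → t ≤ cut adj A B → EdgesAtLeast U a t
      edges-at-least t≤ = edges ,
        Unique.filter⁺ (T? ∘ good) (Unique.cartesianProduct⁺ (cube-unique (m + k)) (cube-unique (m + k))) ,
        ≤-trans t≤ (≤-reflexive (sym length-edges)) , edges-sound

    typical⇒good : ∀ {C β η} → every (cube m) (typicalAt C m U) ≡ true →
                   .{{_ : NonZero m}} → .{{_ : NonZero C}} → 3 ≤ m → 4 * C ≤ m →
                   ℚ.0ℚ ℚ.< β → β ℚ.* ℕtoℚ (64 + 128 * C) ≡ ℚ.1ℚ →
                   η ℚ.* ℕtoℚ (C * (4 * 2 ^ (4 * C))) ≡ ℚ.1ℚ → GoodEvent β η U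
    typical⇒good {C} {β} {η} sel 3≤m 4C≤m β>0 βK ηR = expansion , small
      where
      K = 64 + 128 * C
      R = C * (4 * 2 ^ (4 * C))
      typ : Typical C W
      typ = typical sel
      open Canonical W using (canonical)

      expansion : ExpansionAtLeast U β
      expansion a _ 2A≤U = e , βA≤ , edges-at-least ≤-refl
        where
        open Selected a
        A≤B : ‖ A ‖ ≤ ‖ B ‖
        A≤B = +-cancelˡ-≤ ‖ A ‖ _ _ (≤-trans (≤-reflexive (sym (cong (‖ A ‖ +_) (+-identityʳ ‖ A ‖))))
          (subst₂ _≤_ (cong (2 *_) (sym ‖A‖≡)) (sym (trans ‖A‖+‖B‖ ‖W‖≡)) 2A≤U))
        e = cut (Canonical.adj W) A B
        bound : length (sub a U) ≤ K * e
        bound = subst (_≤ K * e) ‖A‖≡ (expand canonical typ split A≤B)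
        βA≤ : β ℚ.* ℕtoℚ (length (sub a U)) ℚ.≤ ℕtoℚ e
        βA≤ = ℚ.≤-trans (ℚ.*-monoˡ-≤-nonNeg β {{ℚ.nonNegative (ℚ.<⇒≤ β>0)}} (ℕtoℚ-mono bound)) (ℚ.≤-reflexive
          (trans (cong (β ℚ.*_) (ℕtoℚ-* K e)) (trans (sym (ℚ.*-assoc β (ℕtoℚ K) (ℕtoℚ e))) (trans (cong (ℚ._* ℕtoℚ e) βK) (ℚ.*-identityˡ (ℕtoℚ e))))))

      small : SmallSetsExpand U η
      small a A≤ηU = edges-at-least (subst (_≤ cut (Canonical.adj W) A B) ‖A‖≡ (small-expand canonical typ split 3≤m 4C≤m AR≤))
        where
        open Selected a
        AR≤ : ‖ A ‖ * R ≤ ‖ W ‖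
        AR≤ = subst₂ (λ s t → s * R ≤ t) (sym ‖A‖≡) (sym ‖W‖≡) (ℕtoℚ-cancel (subst₂ ℚ._≤_
          (sym (ℕtoℚ-* (length (sub a U)) R))
          (trans (r η (ℕtoℚ (length U)) (ℕtoℚ R)) (trans (cong (ℚ._* ℕtoℚ (length U)) ηR) (ℚ.*-identityˡ (ℕtoℚ (length U)))))
          (ℚ.*-monoʳ-≤-nonNeg (ℕtoℚ R) {{ℚ.nonNegative (ℕtoℚ-mono {0} {R} z≤n)}} A≤ηU)))
          where
          r : ∀ x y z → (x ℚ.* y) ℚ.* z ≡ (x ℚ.* z) ℚ.* y
          r = ring-∀ ℚ-ring

-- Expectation over random subsets.

module RandomSubsets where

  open import Defs
  open FiniteSums
  open TypicalSubsets
  open Rationals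
  open import Data.Nat as ℕ using (ℕ; zero; suc; z≤n; s≤s)
  import Data.Nat.Properties as ℕ
  import Data.Integer
  open import Data.Rational
  open import Data.Rational.Properties
  open import Data.Bool using (Bool; true; false)
  open import Data.Fin using (Fin; zero; suc)
  open import Data.List using (List; []; _∷_; _++_; map; length; foldr)
  open import Data.List.Membership.Propositional using (_∈_)
  open import Data.List.Membership.Propositional.Properties using (∈-map⁻; ∈-++⁻)
  open import Data.List.Relation.Unary.Any using (here; there)
  open import Data.Vec using ([]; _∷_; lookup)
  open import Data.Product using (∃-syntax; _,_; proj₁)
  open import Data.Sum using (inj₁; inj₂)
  open import Relation.Binary.PropositionalEquality using (_≡_; refl; sym; trans; cong; cong₂; subst; subst₂; module ≡-Reasoning)

  private
    variable
      I J : Set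
      m k n : ℕ

  ≤-by : ∀ {a b d} → 0ℚ ≤ d → b ≡ a + d → a ≤ b
  ≤-by {a} {b} {d} d≥0 eq = subst₂ _≤_ (+-identityʳ a) (sym eq) (+-monoʳ-≤ a d≥0)

  0≤* : ∀ {a b} → 0ℚ ≤ a → 0ℚ ≤ b → 0ℚ ≤ a * b
  0≤* {a} {b} ha hb = subst (_≤ a * b) (*-zeroʳ a) (*-monoˡ-≤-nonNeg a {{nonNegative ha}} hb)

  0≤+ : ∀ {a b} → 0ℚ ≤ a → 0ℚ ≤ b → 0ℚ ≤ a + b
  0≤+ ha hb = +-mono-≤ ha hb

  *-mono : ∀ {a b c d} → 0ℚ ≤ b → 0ℚ ≤ c → a ≤ b → c ≤ d → a * c ≤ b * d
  *-mono {a} {b} {c} {d} hb hc ab cd = ≤-trans (*-monoʳ-≤-nonNeg c {{nonNegative hc}} ab) (*-monoˡ-≤-nonNeg b {{nonNegative hb}} cd)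

  *-monoˡ : ∀ {a c d} → 0ℚ ≤ a → c ≤ d → a * c ≤ a * d
  *-monoˡ {a} ha cd = *-monoˡ-≤-nonNeg a {{nonNegative ha}} cd

  0≤- : ∀ {a b} → a ≤ b → 0ℚ ≤ b - a
  0≤- {a} {b} h = subst (_≤ b - a) (+-inverseʳ a) (+-monoˡ-≤ (- a) h)

  0≤1 : 0ℚ ≤ 1ℚ
  0≤1 = *≤* (Data.Integer.+≤+ z≤n)

  2ℚ : ℚ
  2ℚ = 1ℚ + 1ℚ

  0≤2 : 0ℚ ≤ 2ℚ
  0≤2 = 0≤+ 0≤1 0≤1

  0≤½ : 0ℚ ≤ ½
  0≤½ = *≤* (Data.Integer.+≤+ z≤n)

  pow-nonneg : ∀ {q} → 0ℚ ≤ q → ∀ k → 0ℚ ≤ pow q k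
  pow-nonneg h zero = 0≤1
  pow-nonneg h (suc k) = 0≤* h (pow-nonneg h k)

  pow-mono : ∀ {a b} → 0ℚ ≤ a → a ≤ b → ∀ k → pow a k ≤ pow b k
  pow-mono ha ab zero = ≤-refl
  pow-mono ha ab (suc k) = *-mono (≤-trans ha ab) (pow-nonneg ha k) ab (pow-mono ha ab k)

  pow-1 : ∀ k → pow 1ℚ k ≡ 1ℚ
  pow-1 zero = refl
  pow-1 (suc k) = trans (*-identityˡ _) (pow-1 k)

  pow-≥1 : ∀ {a} → 1ℚ ≤ a → ∀ k → 1ℚ ≤ pow a k
  pow-≥1 {a} h k = subst (_≤ pow a k) (pow-1 k) (pow-mono 0≤1 h k)

  pow-≤1 : ∀ {a} → 0ℚ ≤ a → a ≤ 1ℚ → ∀ k → pow a k ≤ 1ℚ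
  pow-≤1 {a} h h' k = subst (pow a k ≤_) (pow-1 k) (pow-mono h h' k)

  pow-+ : ∀ q a b → pow q (a ℕ.+ b) ≡ pow q a * pow q b
  pow-+ q zero b = sym (*-identityˡ _)
  pow-+ q (suc a) b = trans (cong (q *_) (pow-+ q a b)) (sym (*-assoc q (pow q a) (pow q b)))

  pow-*-base : ∀ a b k → pow (a * b) k ≡ pow a k * pow b k
  pow-*-base a b zero = sym (*-identityˡ 1ℚ)
  pow-*-base a b (suc k) = trans (cong (a * b *_) (pow-*-base a b k)) (r a b (pow a k) (pow b k))
    where
    r : ∀ a b x y → (a * b) * (x * y) ≡ (a * x) * (b * y)
    r = ring-∀ ℚ-ring

  pow-* : ∀ q a b → pow q (a ℕ.* b) ≡ pow (pow q b) a
  pow-* q zero b = refl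
  pow-* q (suc a) b = trans (pow-+ q b (a ℕ.* b)) (cong (pow q b *_) (pow-* q a b))

  pow-incr : ∀ {q} → 1ℚ ≤ q → ∀ {a b} → a ℕ.≤ b → pow q a ≤ pow q b
  pow-incr {q} h {a} {b} a≤b = subst₂ _≤_ (*-identityʳ _) (trans (sym (pow-+ q a (b ℕ.∸ a))) (cong (pow q) (ℕ.m+[n∸m]≡n a≤b)))
    (*-monoˡ (pow-nonneg (≤-trans 0≤1 h) a) (pow-≥1 h (b ℕ.∸ a)))

  pow-half : ∀ k → pow ½ k * pow 2ℚ k ≡ 1ℚ
  pow-half k = trans (sym (pow-*-base ½ 2ℚ k)) (pow-1 k)

  bernoulli : ∀ x → 0ℚ ≤ 1ℚ + x → ∀ N → 1ℚ + ℕtoℚ N * x ≤ pow (1ℚ + x) N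
  bernoulli x h zero = ≤-reflexive (r x)
    where
    r : ∀ x → 1ℚ + 0ℚ * x ≡ 1ℚ
    r = ring-∀ ℚ-ring
  bernoulli x h (suc N) = ≤-trans (≤-by (0≤* (ℕtoℚ-mono {0} {N} z≤n) (square x))
    (trans (r x (ℕtoℚ N)) (cong (λ M → 1ℚ + M * x + ℕtoℚ N * (x * x)) (sym (ℕtoℚ-+ 1 N)))))
    (*-monoˡ h (bernoulli x h N))
    where
    r : ∀ x n → (1ℚ + x) * (1ℚ + n * x) ≡ (1ℚ + (1ℚ + n) * x) + n * (x * x)
    r = ring-∀ ℚ-ring
    square : ∀ x → 0ℚ ≤ x * x
    square x with ≤-total 0ℚ x
    ... | inj₁ h = 0≤* h h
    ... | inj₂ h = subst (0ℚ ≤_) (minus² x) (0≤* (neg-antimono-≤ h) (neg-antimono-≤ h))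
      where
      minus² : ∀ x → (- x) * (- x) ≡ x * x
      minus² = ring-∀ ℚ-ring

  -- Each factor (1 - x)(1 + x) is at most 1. Together with Bernoulli's inequality this stands in
  -- for the exponential function.
  pow-conj : ∀ x → 0ℚ ≤ x → x ≤ 1ℚ → ∀ N → pow (1ℚ - x) N * pow (1ℚ + x) N ≤ 1ℚ
  pow-conj x h h' N = subst (_≤ 1ℚ) (pow-*-base (1ℚ - x) (1ℚ + x) N)
    (pow-≤1 (0≤* (0≤- h') (0≤+ 0≤1 h)) (≤-by (0≤* h h) (r x)) N)
    where
    r : ∀ x → 1ℚ ≡ (1ℚ - x) * (1ℚ + x) + x * x
    r = ring-∀ ℚ-ring

  Σ : List I → (I → ℚ) → ℚ
  Σ [] f = 0ℚ
  Σ (x ∷ xs) f = f x + Σ xs f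

  Σ-cong : (xs : List I) {f g : I → ℚ} → (∀ x → f x ≡ g x) → Σ xs f ≡ Σ xs g
  Σ-cong [] h = refl
  Σ-cong (x ∷ xs) h = cong₂ _+_ (h x) (Σ-cong xs h)

  Σ-mono : (xs : List I) {f g : I → ℚ} → (∀ x → f x ≤ g x) → Σ xs f ≤ Σ xs g
  Σ-mono [] h = ≤-refl
  Σ-mono (x ∷ xs) h = +-mono-≤ (h x) (Σ-mono xs h)

  Σ-* : (c : ℚ) (xs : List I) (f : I → ℚ) → Σ xs (λ x → c * f x) ≡ c * Σ xs f
  Σ-* c [] f = sym (*-zeroʳ c)
  Σ-* c (x ∷ xs) f = trans (cong (c * f x +_) (Σ-* c xs f)) (sym (*-distribˡ-+ c (f x) (Σ xs f)))

  Σ-++ : (xs ys : List I) (f : I → ℚ) → Σ (xs ++ ys) f ≡ Σ xs f + Σ ys f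
  Σ-++ [] ys f = sym (+-identityˡ _)
  Σ-++ (x ∷ xs) ys f = trans (cong (f x +_) (Σ-++ xs ys f)) (sym (+-assoc (f x) _ _))

  Σ-map : (g : I → J) (xs : List I) (f : J → ℚ) → Σ (map g xs) f ≡ Σ xs (λ x → f (g x))
  Σ-map g [] f = refl
  Σ-map g (x ∷ xs) f = cong (f (g x) +_) (Σ-map g xs f)

  Σ-cube-suc : (f : Q (suc m) → ℚ) → Σ (cube (suc m)) f ≡ Σ (cube m) (λ x → f (true ∷ x)) + Σ (cube m) (λ x → f (false ∷ x))
  Σ-cube-suc {m} f = trans (Σ-++ (map (true ∷_) (cube m)) (map (false ∷_) (cube m)) f)
    (cong₂ _+_ (Σ-map (true ∷_) (cube m) f) (Σ-map (false ∷_) (cube m) f))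

  Σ-nonneg : (xs : List I) {f : I → ℚ} → (∀ x → 0ℚ ≤ f x) → 0ℚ ≤ Σ xs f
  Σ-nonneg [] h = ≤-refl
  Σ-nonneg (x ∷ xs) h = 0≤+ (h x) (Σ-nonneg xs h)

  Σ-∈ : {xs : List I} {f : I → ℚ} → (∀ x → 0ℚ ≤ f x) → ∀ {x} → x ∈ xs → f x ≤ Σ xs f
  Σ-∈ {xs = x ∷ xs} {f} h (here refl) = ≤-by (Σ-nonneg xs h) refl
  Σ-∈ {xs = y ∷ xs} {f} h (there x∈) = ≤-trans (Σ-∈ h x∈) (≤-by (h y) (+-comm (f y) (Σ xs f)))

  Σ-cube-const : ∀ m c → Σ (cube m) (λ _ → c) ≡ pow 2ℚ m * c
  Σ-cube-const zero c = trans (+-identityʳ c) (sym (*-identityˡ c))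
  Σ-cube-const (suc m) c = trans (Σ-cube-suc {m} _) (trans (cong₂ _+_ (Σ-cube-const m c) (Σ-cube-const m c)) (r (pow 2ℚ m) c))
    where
    r : ∀ x c → x * c + x * c ≡ ((1ℚ + 1ℚ) * x) * c
    r = ring-∀ ℚ-ring

  ones : Q m → ℕ
  ones [] = 0
  ones (b ∷ S) = ι b ℕ.+ ones S

  binomial : ∀ m θ q → Σ (cube m) (λ S → pow θ (ones S) * pow q (ones S)) ≡ pow (1ℚ + θ * q) m
  binomial zero θ q = refl
  binomial (suc m) θ q = trans (Σ-cube-suc {m} _) (trans (cong (_+ T) (trans
    (Σ-cong (cube m) (λ S → r₁ θ q (pow θ (ones S)) (pow q (ones S)))) (Σ-* (θ * q) (cube m) _)))
    (trans (r₂ (θ * q) T) (cong ((1ℚ + θ * q) *_) (binomial m θ q))))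
    where
    T = Σ (cube m) (λ S → pow θ (ones S) * pow q (ones S))
    r₁ : ∀ θ q x y → (θ * x) * (q * y) ≡ (θ * q) * (x * y)
    r₁ = ring-∀ ℚ-ring
    r₂ : ∀ t s → t * s + s ≡ (1ℚ + t) * s
    r₂ = ring-∀ ℚ-ring

  chosen : Q m → (Fin m → ℕ) → ℕ
  chosen {m} S f = ∑ (fins m) (λ i → ι (lookup S i) ℕ.* f i)

  -- Expanding the product of the factors 1 + θ [f i = 0] over subsets S of the index set.
  expand-zeros : ∀ m θ (f : Fin m → ℕ) →
    pow (1ℚ + θ) (∑ (fins m) (λ i → isZero (f i))) ≡ Σ (cube m) (λ S → pow θ (ones S) * pow 0ℚ (chosen S f))
  expand-zeros zero θ f = refl
  expand-zeros (suc m) θ f = begin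
    pow (1ℚ + θ) (∑ (fins (suc m)) (λ i → isZero (f i)))
      ≡⟨ cong (pow (1ℚ + θ)) (∑-fins-suc {m} (λ i → isZero (f i))) ⟩
    pow (1ℚ + θ) (isZero (f zero) ℕ.+ ∑ (fins m) (λ i → isZero (f (suc i))))
      ≡⟨ trans (pow-+ (1ℚ + θ) (isZero (f zero)) _) (cong₂ _*_ (first (f zero)) (expand-zeros m θ (λ i → f (suc i)))) ⟩
    (θ * pow 0ℚ (f zero) + 1ℚ) * T
      ≡⟨ r₂ (θ * pow 0ℚ (f zero)) T ⟩
    (θ * pow 0ℚ (f zero)) * T + T
      ≡⟨ cong₂ _+_ (trans (sym (Σ-* (θ * pow 0ℚ (f zero)) (cube m) _)) (Σ-cong (cube m) yes-term)) (Σ-cong (cube m) no-term) ⟩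
    Σ (cube m) (λ S → pow θ (ones (true ∷ S)) * pow 0ℚ (chosen (true ∷ S) f)) + Σ (cube m) (λ S → pow θ (ones (false ∷ S)) * pow 0ℚ (chosen (false ∷ S) f))
      ≡⟨ Σ-cube-suc {m} _ ⟨
    Σ (cube (suc m)) (λ S → pow θ (ones S) * pow 0ℚ (chosen S f)) ∎
    where
    open ≡-Reasoning
    T = Σ (cube m) (λ S → pow θ (ones S) * pow 0ℚ (chosen S (λ i → f (suc i))))
    r₀ : ∀ θ → (1ℚ + θ) * 1ℚ ≡ θ * 1ℚ + 1ℚ
    r₀ = ring-∀ ℚ-ring
    r₁ : ∀ θ x → 1ℚ ≡ θ * (0ℚ * x) + 1ℚ
    r₁ = ring-∀ ℚ-ring
    r₂ : ∀ t s → (t + 1ℚ) * s ≡ t * s + s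
    r₂ = ring-∀ ℚ-ring
    r₃ : ∀ θ z x y → (θ * z) * (x * y) ≡ (θ * x) * (z * y)
    r₃ = ring-∀ ℚ-ring
    -- Since the zeroth power of 0 is 1, `pow 0ℚ a` is the indicator of a = 0.
    first : ∀ a → pow (1ℚ + θ) (isZero a) ≡ θ * pow 0ℚ a + 1ℚ
    first zero = r₀ θ
    first (suc a) = r₁ θ (pow 0ℚ a)
    yes-term : ∀ S → (θ * pow 0ℚ (f zero)) * (pow θ (ones S) * pow 0ℚ (chosen S (λ i → f (suc i))))
                   ≡ pow θ (ones (true ∷ S)) * pow 0ℚ (chosen (true ∷ S) f)
    yes-term S = trans (r₃ θ (pow 0ℚ (f zero)) (pow θ (ones S)) _) (cong ((θ * pow θ (ones S)) *_)
      (trans (sym (pow-+ 0ℚ (f zero) _)) (cong (pow 0ℚ) (trans (cong (ℕ._+ chosen S (λ i → f (suc i))) (sym (ℕ.+-identityʳ (f zero)))) (sym (∑-fins-suc {m} (λ i → ι (lookup (true ∷ S) i) ℕ.* f i)))))))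
    no-term : ∀ S → pow θ (ones S) * pow 0ℚ (chosen S (λ i → f (suc i)))
                  ≡ pow θ (ones (false ∷ S)) * pow 0ℚ (chosen (false ∷ S) f)
    no-term S = cong (λ s → pow θ (ones S) * pow 0ℚ s) (sym (∑-fins-suc {m} (λ i → ι (lookup (false ∷ S) i) ℕ.* f i)))

  module Expectation (p : ℚ) (0≤p : 0ℚ ≤ p) (p≤1 : p ≤ 1ℚ) where

    0≤q : 0ℚ ≤ 1ℚ - p
    0≤q = 0≤- p≤1

    -- The points are exposed one at a time, so their independence is built into the recursion;
    -- `E-weights` identifies this with the weighted sum over sublists.
    E : List I → (List I → ℚ) → ℚ
    E [] f = f []
    E (x ∷ xs) f = p * E xs (λ U → f (x ∷ U)) + (1ℚ - p) * E xs f

    E-cong : (xs : List I) {f g : List I → ℚ} → (∀ U → f U ≡ g U) → E xs f ≡ E xs g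
    E-cong [] h = h []
    E-cong (x ∷ xs) h = cong₂ (λ a b → p * a + (1ℚ - p) * b) (E-cong xs (λ U → h (x ∷ U))) (E-cong xs h)

    E-const : (xs : List I) (c : ℚ) → E xs (λ _ → c) ≡ c
    E-const [] c = refl
    E-const (x ∷ xs) c = trans (cong₂ (λ a b → p * a + (1ℚ - p) * b) (E-const xs c) (E-const xs c)) (r p c)
      where
      r : ∀ p c → p * c + (1ℚ - p) * c ≡ c
      r = ring-∀ ℚ-ring

    E-+ : (xs : List I) (f g : List I → ℚ) → E xs (λ U → f U + g U) ≡ E xs f + E xs g
    E-+ [] f g = refl
    E-+ (x ∷ xs) f g = trans (cong₂ (λ a b → p * a + (1ℚ - p) * b) (E-+ xs _ _) (E-+ xs f g))
      (r p (E xs (λ U → f (x ∷ U))) (E xs (λ U → g (x ∷ U))) (E xs f) (E xs g))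
      where
      r : ∀ p a b c d → p * (a + b) + (1ℚ - p) * (c + d) ≡ (p * a + (1ℚ - p) * c) + (p * b + (1ℚ - p) * d)
      r = ring-∀ ℚ-ring

    E-* : (c : ℚ) (xs : List I) (f : List I → ℚ) → E xs (λ U → c * f U) ≡ c * E xs f
    E-* c [] f = refl
    E-* c (x ∷ xs) f = trans (cong₂ (λ a b → p * a + (1ℚ - p) * b) (E-* c xs _) (E-* c xs f))
      (r p c (E xs (λ U → f (x ∷ U))) (E xs f))
      where
      r : ∀ p c a b → p * (c * a) + (1ℚ - p) * (c * b) ≡ c * (p * a + (1ℚ - p) * b)
      r = ring-∀ ℚ-ring

    E-Σ : (xs : List I) (ys : List J) (f : J → List I → ℚ) → E xs (λ U → Σ ys (λ y → f y U)) ≡ Σ ys (λ y → E xs (f y))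
    E-Σ xs [] f = E-const xs 0ℚ
    E-Σ xs (y ∷ ys) f = trans (E-+ xs (f y) _) (cong (E xs (f y) +_) (E-Σ xs ys f))

    -- Each point with j = 1 contributes an independent factor 1 - p + pr. The value r = 0 will give
    -- probabilities of emptiness, r = 2 the exponential moment of a load.
    generating-function : (xs : List I) (j : I → ℕ) → (∀ x → j x ℕ.≤ 1) → ∀ r →
                          E xs (λ U → pow r (∑ U j)) ≡ pow (1ℚ - p + p * r) (∑ xs j)
    generating-function [] j j≤1 r = refl
    generating-function (x ∷ xs) j j≤1 r with j x | j≤1 x
    ... | zero | _ = trans (e p _) (generating-function xs j j≤1 r)
      where
      e : ∀ p a → p * a + (1ℚ - p) * a ≡ a
      e = ring-∀ ℚ-ring
    ... | suc zero | _ = trans (cong (λ a → p * a + (1ℚ - p) * E xs (λ U → pow r (∑ U j))) (E-* r xs _))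
      (trans (e p r (E xs (λ U → pow r (∑ U j)))) (cong ((1ℚ - p + p * r) *_) (generating-function xs j j≤1 r)))
      where
      e : ∀ p r a → p * (r * a) + (1ℚ - p) * a ≡ (1ℚ - p + p * r) * a
      e = ring-∀ ℚ-ring
    ... | suc (suc _) | s≤s ()

    length-sublists : (xs : List I) {U : List I} → U ∈ sublists xs → length U ℕ.≤ length xs
    length-sublists [] (here refl) = z≤n
    length-sublists (x ∷ xs) U∈ with ∈-++⁻ (map (x ∷_) (sublists xs)) U∈
    ... | inj₂ U∈' = ℕ.m≤n⇒m≤1+n (length-sublists xs U∈')
    ... | inj₁ U∈' with ∈-map⁻ (x ∷_) U∈'
    ... | V , V∈ , refl = s≤s (length-sublists xs V∈)

    Σ-cong-∈ : (xs : List J) {f g : J → ℚ} → (∀ {x} → x ∈ xs → f x ≡ g x) → Σ xs f ≡ Σ xs g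
    Σ-cong-∈ [] h = refl
    Σ-cong-∈ (x ∷ xs) h = cong₂ _+_ (h (here refl)) (Σ-cong-∈ xs (λ x∈ → h (there x∈)))

    E-weights : (xs : List I) (f : List I → ℚ) →
                Σ (sublists xs) (λ U → (pow p (length U) * pow (1ℚ - p) (length xs ℕ.∸ length U)) * f U) ≡ E xs f
    E-weights [] f = r (f [])
      where
      r : ∀ a → (1ℚ * 1ℚ) * a + 0ℚ ≡ a
      r = ring-∀ ℚ-ring
    E-weights (x ∷ xs) f = trans (Σ-++ (map (x ∷_) (sublists xs)) (sublists xs) _) (cong₂ _+_
      (trans (Σ-map (x ∷_) (sublists xs) _) (trans (Σ-cong (sublists xs) (λ U → r₁ p (pow p (length U)) _ (f (x ∷ U))))
        (trans (Σ-* p (sublists xs) _) (cong (p *_) (E-weights xs (λ U → f (x ∷ U)))))))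
      (trans (Σ-cong-∈ (sublists xs) skip) (trans (Σ-* (1ℚ - p) (sublists xs) _) (cong ((1ℚ - p) *_) (E-weights xs f)))))
      where
      r₁ : ∀ p a b c → ((p * a) * b) * c ≡ p * ((a * b) * c)
      r₁ = ring-∀ ℚ-ring
      r₂ : ∀ q a b c → (a * (q * b)) * c ≡ q * ((a * b) * c)
      r₂ = ring-∀ ℚ-ring
      -- The subtraction is truncated, so the exponent grows by one only because `U` is no longer
      -- than `xs`.
      skip : ∀ {U} → U ∈ sublists xs → (pow p (length U) * pow (1ℚ - p) (suc (length xs) ℕ.∸ length U)) * f U
           ≡ (1ℚ - p) * ((pow p (length U) * pow (1ℚ - p) (length xs ℕ.∸ length U)) * f U)
      skip {U} U∈ = trans (cong (λ t → (pow p (length U) * pow (1ℚ - p) t) * f U) (ℕ.+-∸-assoc 1 (length-sublists xs U∈)))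
        (r₂ (1ℚ - p) (pow p (length U)) _ (f U))

    foldr-bound : (Us : List J) {h : J → ℚ} (g : J → ℚ → ℚ) → (∀ U {a b} → a ≤ b → h U + a ≤ g U b) → Σ Us h ≤ foldr g 0ℚ Us
    foldr-bound [] g step = ≤-refl
    foldr-bound (U ∷ Us) g step = step U (foldr-bound Us g step)

    -- The folding function inside `selectedWeight` uses a local conditional; unification recovers
    -- it as an anonymous witness.
    folded : (sel : List (Point n) → Bool) → ∃[ g ] selectedWeight n p sel ≡ foldr g 0ℚ (sublists (cube n))
    folded sel = _ , refl

    -- Here `f` is any minorant of the indicator of `sel`. It will be 1 minus a sum of penalties, so
    -- that the union bound holds pointwise, before expectations are taken.
    E≤selectedWeight : (sel : List (Point n) → Bool) (f : List (Point n) → ℚ) → (∀ U → f U ≤ 1ℚ) →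
                       (∀ U → sel U ≡ false → f U ≤ 0ℚ) → E (cube n) f ≤ selectedWeight n p sel
    E≤selectedWeight {n} sel f f≤1 f≤0 = subst (_≤ selectedWeight n p sel)
      (trans (Σ-cong (sublists (cube n)) (λ U → cong (λ N → (pow p (length U) * pow (1ℚ - p) (N ℕ.∸ length U)) * f U) (sym (length-cube n))))
        (E-weights (cube n) f))
      (foldr-bound (sublists (cube n)) {λ U → weight n p U * f U} (proj₁ (folded sel)) step)
      where
      weight≥0 : ∀ U → 0ℚ ≤ weight n p U
      weight≥0 U = 0≤* (pow-nonneg 0≤p (length U)) (pow-nonneg 0≤q (2 ℕ.^ n ℕ.∸ length U))
      step : ∀ U {a b} → a ≤ b → weight n p U * f U + a ≤ proj₁ (folded sel) U b
      step U a≤b with sel U in e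
      ... | true = +-mono-≤ (subst (weight n p U * f U ≤_) (*-identityʳ (weight n p U)) (*-monoˡ (weight≥0 U) (f≤1 U))) a≤b
      ... | false = +-mono-≤ (subst (weight n p U * f U ≤_) (*-zeroʳ (weight n p U)) (*-monoˡ (weight≥0 U) (f≤0 U e))) a≤b

-- Exponential moments of the neighbourhoods.

module TailBounds where

  open import Defs
  open FiniteSums
  open BlockCounting using (some-elim)
  open TypicalSubsets
  open Rationals
  open MajorityExtension using (≤ᵇ-false)
  import Data.Integer
  open RandomSubsets
  open import Data.Nat as ℕ using (ℕ; zero; suc; z≤n; s≤s)
  import Data.Nat.Properties as ℕ
  open import Data.Nat.Tactic.RingSolver using (solve-∀)
  open import Data.Rational
  open import Data.Rational.Properties
  open import Data.Bool using (Bool; true; false; not)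
  open import Data.Fin using (Fin; zero; suc)
  open import Data.List using (List; []; _∷_)
  open import Data.Vec using ([]; _∷_; lookup)
  open import Data.Product using (_,_)
  open import Relation.Binary.PropositionalEquality using (_≡_; refl; sym; trans; cong; cong₂; subst; subst₂; module ≡-Reasoning)

  private
    variable
      m k : ℕ

  -- A point lies in at most one of the blocks around `x`; this supplies the exponents 0 or 1 of
  -- `generating-function`.
  flips-once : (y x : Q m) → ∑ (fins m) (λ i → ι (eq y (flip i x))) ℕ.≤ 1
  flips-once [] [] = z≤n
  flips-once {suc m} (b ∷ y) (c ∷ x) = ℕ.≤-trans (ℕ.≤-reflexive (∑-fins-suc {m} (λ i → ι (eq (b ∷ y) (flip i (c ∷ x)))))) (pt b c)
    where
    pt : ∀ b c → ι (eq (b ∷ y) (not c ∷ x)) ℕ.+ ∑ (fins m) (λ i → ι (eq (b ∷ y) (c ∷ flip i x))) ℕ.≤ 1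
    pt true true = flips-once y x
    pt false false = flips-once y x
    pt true false = ℕ.≤-trans (ℕ.≤-reflexive (trans (cong (ι (eq y x) ℕ.+_) (∑-0 (fins m))) (ℕ.+-identityʳ _))) (ι≤1 (eq y x))
    pt false true = ℕ.≤-trans (ℕ.≤-reflexive (trans (cong (ι (eq y x) ℕ.+_) (∑-0 (fins m))) (ℕ.+-identityʳ _))) (ι≤1 (eq y x))

  ∑-lookup : (S : Q m) → ∑ (fins m) (λ i → ι (lookup S i)) ≡ ones S
  ∑-lookup [] = refl
  ∑-lookup {suc m} (b ∷ S) = trans (∑-fins-suc {m} (λ i → ι (lookup (b ∷ S) i))) (cong (ι b ℕ.+_) (∑-lookup S))

  block-size : ∀ m k (y : Q m) → ∑ (cube (m ℕ.+ k)) (λ w → ι (eq (block m w) y)) ≡ 2 ℕ.^ k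
  block-size m k y = trans (∑-cube-+ m _) (trans
    (∑-cong (cube m) λ x → trans (∑-cong (cube k) λ p → cong (λ z → ι (eq z y)) (block-⊕ x p))
      (trans (∑-cube-const k (ι (eq x y))) (ℕ.*-comm (2 ℕ.^ k) (ι (eq x y)))))
    (∑-delta m y (λ _ → 2 ℕ.^ k)))

  weighted-load : ∀ m (U : List (Q (m ℕ.+ k))) (x : Q m) (w : Fin m → ℕ) →
    ∑ (fins m) (λ i → w i ℕ.* load m U (flip i x)) ≡ ∑ U (λ u → ∑ (fins m) (λ i → w i ℕ.* ι (eq (block m u) (flip i x))))
  weighted-load m U x w = trans (∑-cong (fins m) λ i → sym (∑-*ˡ (w i) U _)) (∑-swap (fins m) U _)

  pow-half-+ : ∀ a b → pow ½ (a ℕ.+ b) * pow 2ℚ b ≡ pow ½ a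
  pow-half-+ a b = trans (cong (_* pow 2ℚ b) (pow-+ ½ a b)) (trans (*-assoc (pow ½ a) (pow ½ b) (pow 2ℚ b))
    (trans (cong (pow ½ a *_) (pow-half b)) (*-identityʳ (pow ½ a))))

  1≤2 : 1ℚ ≤ 2ℚ
  1≤2 = ≤-by 0≤1 refl

  one≤half-two : ∀ {a b} → a ℕ.≤ b → 1ℚ ≤ pow ½ a * pow 2ℚ b
  one≤half-two {a} {b} h = subst (_≤ pow ½ a * pow 2ℚ b) (pow-half a) (*-monoˡ (pow-nonneg 0≤½ a) (pow-incr 1≤2 h))

  halve : ∀ {x} → x * 2ℚ ≤ 1ℚ → x ≤ ½
  halve {x} h = subst₂ _≤_ (trans (*-assoc x 2ℚ ½) (*-identityʳ x)) (*-identityˡ ½) (*-monoʳ-≤-nonNeg ½ {{nonNegative 0≤½}} h)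

  module Estimates (p : ℚ) (0≤p : 0ℚ ≤ p) (p≤1 : p ≤ 1ℚ) (N : ℕ) (lower : 1ℚ ≤ ℕtoℚ N * p) (upper : ℕtoℚ N * p ≤ 2ℚ) where
    open Expectation p 0≤p p≤1

    -- (1 − p)^N (1 + p)^N ≤ 1, and (1 + p)^N ≥ 1 + N p ≥ 2 by Bernoulli's inequality.
    miss : pow (1ℚ - p) N ≤ ½
    miss = halve (≤-trans (*-monoˡ (pow-nonneg 0≤q N) (≤-trans (+-monoʳ-≤ 1ℚ lower) (bernoulli p (0≤+ 0≤1 0≤p) N)))
      (pow-conj p 0≤p p≤1 N))

    -- One quarter of `p`. As Np may reach 2, Bernoulli's lower bound 1 - Np for (1 - p)^N can be
    -- void, whereas 1 - Ns is at least 1/2.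
    s : ℚ
    s = p * (½ * ½)

    0≤s : 0ℚ ≤ s
    0≤s = 0≤* 0≤p (0≤* 0≤½ 0≤½)

    s≤1 : s ≤ 1ℚ
    s≤1 = *-mono {p} {1ℚ} {½ * ½} {1ℚ} 0≤1 (0≤* 0≤½ 0≤½) p≤1 (*≤* (Data.Integer.+≤+ (s≤s z≤n)))

    quarter : pow (1ℚ + s) N ≤ 2ℚ
    quarter = subst₂ _≤_ (e (pow (1ℚ + s) N)) (*-identityʳ 2ℚ) (*-monoˡ 0≤2 (≤-trans
      (*-monoʳ-≤-nonNeg (pow (1ℚ + s) N) {{nonNegative (pow-nonneg (0≤+ 0≤1 0≤s) N)}} half≤) (pow-conj s 0≤s s≤1 N)))
      where
      e' : ∀ n p h → 1ℚ + n * (- (p * (h * h))) ≡ 1ℚ - (n * p) * (h * h)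
      e' = ring-∀ ℚ-ring
      e : ∀ x → 2ℚ * (½ * x) ≡ x
      e x = trans (sym (*-assoc 2ℚ ½ x)) (*-identityˡ x)
      half≤ : ½ ≤ pow (1ℚ - s) N
      half≤ = ≤-trans (subst (½ ≤_) (sym (e' (ℕtoℚ N) p ½))
        (+-monoʳ-≤ 1ℚ (neg-antimono-≤ (*-monoʳ-≤-nonNeg (½ * ½) {{nonNegative (0≤* 0≤½ 0≤½)}} upper))))
        (bernoulli (- s) (0≤- s≤1) N)

    -- Bernoulli gives 1 + p = 1 + 4s ≤ (1 + s)^4; then `quarter` is raised to the fourth power.
    grow : pow (1ℚ + p) N ≤ pow 2ℚ 4
    grow = ≤-trans (pow-mono (0≤+ 0≤1 0≤p) (subst (_≤ pow (1ℚ + s) 4) (cong (1ℚ +_) four) (bernoulli s (0≤+ 0≤1 0≤s) 4)) N)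
      (≤-trans (≤-reflexive (trans (sym (pow-* (1ℚ + s) N 4)) (trans (cong (pow (1ℚ + s)) (ℕ.*-comm N 4)) (pow-* (1ℚ + s) 4 N))))
        (pow-mono (pow-nonneg (0≤+ 0≤1 0≤s) N) quarter 4))
      where
      four : ℕtoℚ 4 * s ≡ p
      four = trans (*-comm (ℕtoℚ 4) s) (trans (*-assoc p (½ * ½) (ℕtoℚ 4)) (*-identityʳ p))

    module _ (m k L : ℕ) (2^k : 2 ℕ.^ k ≡ L ℕ.* N) where

      weighted-generating-function : (x : Q m) (w : Fin m → ℕ) → (∀ i → w i ℕ.≤ 1) → ∀ r →
        E (cube (m ℕ.+ k)) (λ U → pow r (∑ (fins m) (λ i → w i ℕ.* load {k} m U (flip i x))))
          ≡ pow (1ℚ - p + p * r) (∑ (fins m) w ℕ.* 2 ℕ.^ k)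
      weighted-generating-function x w w≤1 r = trans
        (E-cong (cube (m ℕ.+ k)) (λ U → cong (pow r) (weighted-load {k} m U x w)))
        (trans (generating-function (cube (m ℕ.+ k)) j j≤1 r) (cong (pow (1ℚ - p + p * r)) total))
        where
        j : Q (m ℕ.+ k) → ℕ
        j u = ∑ (fins m) (λ i → w i ℕ.* ι (eq (block {k} m u) (flip i x)))
        j≤1 : ∀ u → j u ℕ.≤ 1
        j≤1 u = ℕ.≤-trans (∑-mono (fins m) λ i → ℕ.≤-trans (ℕ.*-monoˡ-≤ (ι (eq (block {k} m u) (flip i x))) (w≤1 i))
          (ℕ.≤-reflexive (ℕ.*-identityˡ _))) (flips-once (block {k} m u) x)
        total : ∑ (cube (m ℕ.+ k)) j ≡ ∑ (fins m) w ℕ.* 2 ℕ.^ k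
        total = trans (∑-swap (cube (m ℕ.+ k)) (fins m) _) (trans
          (∑-cong (fins m) λ i → trans (∑-*ˡ (w i) (cube (m ℕ.+ k)) _) (cong (w i ℕ.*_) (block-size m k (flip i x))))
          (∑-*ʳ (2 ℕ.^ k) (fins m) w))

      -- A block has L N points and is empty with probability at most 2^(-L), so an empty neighbour
      -- can carry weight 2^L at bounded cost.
      base : ℚ
      base = pow 2ℚ L

      -- After expansion over sets S of directions, the term of S contains the probability that all
      -- its blocks are empty, the case r = 0 of the generating function. The sum factors again,
      -- into m factors 1 + θq₀ ≤ 2.
      empties : (x : Q m) → E (cube (m ℕ.+ k)) (λ U → pow base (sparseAt {k} m U x)) ≤ pow 2ℚ m
      empties x = subst (_≤ pow 2ℚ m) (sym eval) (pow-mono (0≤+ 0≤1 (0≤* 0≤θ 0≤q₀)) (+-monoʳ-≤ 1ℚ θq₀≤1) m)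
        where
        θ q₀ : ℚ
        θ = base - 1ℚ
        q₀ = pow (1ℚ - p) (2 ℕ.^ k)
        0≤θ : 0ℚ ≤ θ
        0≤θ = 0≤- (pow-≥1 1≤2 L)
        0≤q₀ : 0ℚ ≤ q₀
        0≤q₀ = pow-nonneg 0≤q (2 ℕ.^ k)
        e₀ : ∀ b → b ≡ 1ℚ + (b - 1ℚ)
        e₀ = ring-∀ ℚ-ring
        e₁ : ∀ p → 1ℚ - p + p * 0ℚ ≡ 1ℚ - p
        e₁ = ring-∀ ℚ-ring
        q₀≤ : q₀ ≤ pow ½ L
        q₀≤ = subst (_≤ pow ½ L) (sym (trans (cong (pow (1ℚ - p)) 2^k) (pow-* (1ℚ - p) L N)))
          (pow-mono (pow-nonneg 0≤q N) miss L)
        θ≤ : θ ≤ base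
        θ≤ = ≤-by 0≤1 (e₂ base)
          where
          e₂ : ∀ b → b ≡ (b - 1ℚ) + 1ℚ
          e₂ = ring-∀ ℚ-ring
        θq₀≤1 : θ * q₀ ≤ 1ℚ
        θq₀≤1 = ≤-trans (*-mono (pow-nonneg 0≤2 L) 0≤q₀ θ≤ q₀≤) (≤-reflexive (trans (*-comm base (pow ½ L)) (pow-half L)))
        term : ∀ S → E (cube (m ℕ.+ k)) (λ U → pow θ (ones S) * pow 0ℚ (chosen S (λ i → load {k} m U (flip i x))))
                   ≡ pow θ (ones S) * pow q₀ (ones S)
        term S = trans (E-* (pow θ (ones S)) (cube (m ℕ.+ k)) _) (cong (pow θ (ones S) *_)
          (trans (weighted-generating-function x (λ i → ι (lookup S i)) (λ i → ι≤1 (lookup S i)) 0ℚ)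
            (trans (cong₂ pow (e₁ p) (cong (ℕ._* 2 ℕ.^ k) (∑-lookup S))) (pow-* (1ℚ - p) (ones S) (2 ℕ.^ k)))))
        eval : E (cube (m ℕ.+ k)) (λ U → pow base (sparseAt {k} m U x)) ≡ pow (1ℚ + θ * q₀) m
        eval = begin
          E (cube (m ℕ.+ k)) (λ U → pow base (sparseAt {k} m U x))
            ≡⟨ E-cong (cube (m ℕ.+ k)) (λ U → trans (cong (λ b → pow b (sparseAt {k} m U x)) (e₀ base)) (expand-zeros m θ (λ i → load {k} m U (flip i x)))) ⟩
          E (cube (m ℕ.+ k)) (λ U → Σ (cube m) (λ S → pow θ (ones S) * pow 0ℚ (chosen S (λ i → load {k} m U (flip i x)))))
            ≡⟨ E-Σ (cube (m ℕ.+ k)) (cube m) _ ⟩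
          Σ (cube m) (λ S → E (cube (m ℕ.+ k)) (λ U → pow θ (ones S) * pow 0ℚ (chosen S (λ i → load {k} m U (flip i x)))))
            ≡⟨ Σ-cong (cube m) term ⟩
          Σ (cube m) (λ S → pow θ (ones S) * pow q₀ (ones S))
            ≡⟨ binomial m θ q₀ ⟩
          pow (1ℚ + θ * q₀) m ∎
          where open ≡-Reasoning

      crowds : (x : Q m) → E (cube (m ℕ.+ k)) (λ U → pow 2ℚ (crowdedAt {k} m U x)) ≤ pow 2ℚ (m ℕ.* (L ℕ.* 4))
      crowds x = subst₂ _≤_ (sym eval) (sym (trans (pow-* 2ℚ m (L ℕ.* 4)) (cong (λ b → pow b m) (pow-* 2ℚ L 4))))
        (pow-mono (pow-nonneg (pow-nonneg (0≤+ 0≤1 0≤p) N) L) (pow-mono (pow-nonneg (0≤+ 0≤1 0≤p) N) grow L) m)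
        where
        e₁ : ∀ p → 1ℚ - p + p * (1ℚ + 1ℚ) ≡ 1ℚ + p
        e₁ = ring-∀ ℚ-ring
        eval : E (cube (m ℕ.+ k)) (λ U → pow 2ℚ (crowdedAt {k} m U x)) ≡ pow (pow (pow (1ℚ + p) N) L) m
        eval = begin
          E (cube (m ℕ.+ k)) (λ U → pow 2ℚ (crowdedAt {k} m U x))
            ≡⟨ E-cong (cube (m ℕ.+ k)) (λ U → cong (pow 2ℚ) (∑-cong (fins m) (λ i → sym (ℕ.*-identityˡ (load {k} m U (flip i x)))))) ⟩
          E (cube (m ℕ.+ k)) (λ U → pow 2ℚ (∑ (fins m) (λ i → 1 ℕ.* load {k} m U (flip i x))))
            ≡⟨ weighted-generating-function x (λ _ → 1) (λ _ → ℕ.≤-refl) 2ℚ ⟩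
          pow (1ℚ - p + p * 2ℚ) (∑ (fins m) (λ _ → 1) ℕ.* 2 ℕ.^ k)
            ≡⟨ cong₂ pow (e₁ p) (cong₂ ℕ._*_ (trans (∑-fins-const m 1) (ℕ.*-identityʳ m)) 2^k) ⟩
          pow (1ℚ + p) (m ℕ.* (L ℕ.* N))
            ≡⟨ trans (pow-* (1ℚ + p) m (L ℕ.* N)) (cong (λ b → pow b m) (pow-* (1ℚ + p) L N)) ⟩
          pow (pow (pow (1ℚ + p) N) L) m ∎
          where open ≡-Reasoning

      -- `crowds` costs 4L in the exponent per direction; the extra 2 leaves a tail of 2^(-2m).
      C : ℕ
      C = L ℕ.* 4 ℕ.+ 2

      -- Normalised to be at least 1 wherever `x` is not typical, while its expectation is at most 2
      -- · 2^(-2m).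
      penalty : Q m → List (Q (m ℕ.+ k)) → ℚ
      penalty x U = pow ½ (3 ℕ.* m) * pow base (sparseAt {k} m U x) + pow ½ (C ℕ.* m) * pow 2ℚ (crowdedAt {k} m U x)

      penalty₁≥0 : ∀ x U → 0ℚ ≤ pow ½ (3 ℕ.* m) * pow base (sparseAt {k} m U x)
      penalty₁≥0 x U = 0≤* (pow-nonneg 0≤½ (3 ℕ.* m)) (pow-nonneg (pow-nonneg 0≤2 L) (sparseAt {k} m U x))

      penalty₂≥0 : ∀ x U → 0ℚ ≤ pow ½ (C ℕ.* m) * pow 2ℚ (crowdedAt {k} m U x)
      penalty₂≥0 x U = 0≤* (pow-nonneg 0≤½ (C ℕ.* m)) (pow-nonneg 0≤2 (crowdedAt {k} m U x))

      E-penalty : ∀ x → E (cube (m ℕ.+ k)) (penalty x) ≤ pow ½ (2 ℕ.* m) * 2ℚ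
      E-penalty x = ≤-trans (≤-reflexive (trans (E-+ (cube (m ℕ.+ k)) _ _) (cong₂ _+_
        (E-* (pow ½ (3 ℕ.* m)) (cube (m ℕ.+ k)) _) (E-* (pow ½ (C ℕ.* m)) (cube (m ℕ.+ k)) _))))
        (≤-trans (+-mono-≤
          (≤-trans (*-monoˡ (pow-nonneg 0≤½ (3 ℕ.* m)) (empties x))
            (≤-reflexive (trans (cong (λ a → pow ½ a * pow 2ℚ m) (n₁ m)) (pow-half-+ (2 ℕ.* m) m))))
          (≤-trans (*-monoˡ (pow-nonneg 0≤½ (C ℕ.* m)) (crowds x))
            (≤-reflexive (trans (cong (λ a → pow ½ a * pow 2ℚ (m ℕ.* (L ℕ.* 4))) (n₂ m L)) (pow-half-+ (2 ℕ.* m) (m ℕ.* (L ℕ.* 4)))))))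
        (≤-reflexive (e (pow ½ (2 ℕ.* m)))))
        where
        n₁ : ∀ m → 3 ℕ.* m ≡ 2 ℕ.* m ℕ.+ m
        n₁ = solve-∀
        n₂ : ∀ m L → (L ℕ.* 4 ℕ.+ 2) ℕ.* m ≡ 2 ℕ.* m ℕ.+ m ℕ.* (L ℕ.* 4)
        n₂ = solve-∀
        e : ∀ x → x + x ≡ x * (1ℚ + 1ℚ)
        e = ring-∀ ℚ-ring

      select : List (Q (m ℕ.+ k)) → Bool
      select U = every (cube m) (typicalAt {k} C m U)

      module _ (L≥ : 192 ℕ.≤ L) where

        -- Markov's inequality for the exponential moments, and a union bound over the blocks.
        penalty-large : ∀ x U → typicalAt {k} C m U x ≡ false → 1ℚ ≤ penalty x U
        penalty-large x U h with 64 ℕ.* sparseAt {k} m U x ℕ.≤ᵇ m in e₁ | crowdedAt {k} m U x ℕ.≤ᵇ C ℕ.* m in e₂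
        ... | false | _ = ≤-trans (subst (λ b → 1ℚ ≤ pow ½ (3 ℕ.* m) * b) (trans (cong (pow 2ℚ) (ℕ.*-comm L (sparseAt {k} m U x))) (pow-* 2ℚ (sparseAt {k} m U x) L))
                (one≤half-two {3 ℕ.* m} many)) (≤-by (penalty₂≥0 x U) refl)
          where
          n : ∀ s → 3 ℕ.* (64 ℕ.* s) ≡ 192 ℕ.* s
          n = solve-∀
          many : 3 ℕ.* m ℕ.≤ L ℕ.* sparseAt {k} m U x
          many = ℕ.≤-trans (ℕ.*-monoʳ-≤ 3 (≤ᵇ-false {64 ℕ.* sparseAt {k} m U x} {m} e₁)) (ℕ.≤-trans (ℕ.≤-reflexive (n (sparseAt {k} m U x))) (ℕ.*-monoˡ-≤ (sparseAt {k} m U x) L≥))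
        ... | true | false = ≤-trans (one≤half-two {C ℕ.* m} {crowdedAt {k} m U x} (≤ᵇ-false {crowdedAt {k} m U x} {C ℕ.* m} e₂))
          (≤-by (penalty₁≥0 x U) (+-comm (pow ½ (3 ℕ.* m) * pow base (sparseAt {k} m U x)) (pow ½ (C ℕ.* m) * pow 2ℚ (crowdedAt {k} m U x))))

        tail : 1ℚ - pow ½ m * 2ℚ ≤ selectedWeight (m ℕ.+ k) p select
        tail = ≤-trans bound (E≤selectedWeight select (λ U → 1ℚ - total U)
            (λ U → ≤-by (total≥0 U) (e₀ (total U)))
            (λ U h → subst (_≤ 0ℚ) (e₁ (total U)) (neg-antimono-≤ (0≤- (total≥1 U h)))))
          where
          total : List (Q (m ℕ.+ k)) → ℚ
          total U = Σ (cube m) (λ x → penalty x U)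
          e₀ : ∀ t → 1ℚ ≡ (1ℚ - t) + t
          e₀ = ring-∀ ℚ-ring
          e₁ : ∀ t → - (t - 1ℚ) ≡ 1ℚ - t
          e₁ = ring-∀ ℚ-ring
          e₂ : ∀ t → - 1ℚ * t ≡ - t
          e₂ = ring-∀ ℚ-ring
          penalty≥0 : ∀ U x → 0ℚ ≤ penalty x U
          penalty≥0 U x = 0≤+ (penalty₁≥0 x U) (penalty₂≥0 x U)
          total≥0 : ∀ U → 0ℚ ≤ total U
          total≥0 U = Σ-nonneg (cube m) (penalty≥0 U)
          total≥1 : ∀ U → select U ≡ false → 1ℚ ≤ total U
          total≥1 U h = let x , hx = some-elim (cube m) (λ x → not (typicalAt {k} C m U x)) (not-false h) in
            ≤-trans (penalty-large x U (not-elim hx)) (Σ-∈ (penalty≥0 U) (∈-cube x))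
          E-total : E (cube (m ℕ.+ k)) total ≤ pow ½ m * 2ℚ
          E-total = ≤-trans (≤-reflexive (E-Σ (cube (m ℕ.+ k)) (cube m) penalty)) (≤-trans (Σ-mono (cube m) E-penalty)
            (≤-reflexive (trans (Σ-cube-const m (pow ½ (2 ℕ.* m) * 2ℚ)) (trans (e₃ (pow 2ℚ m) (pow ½ (2 ℕ.* m)) 2ℚ)
              (cong (_* 2ℚ) (trans (cong (λ a → pow ½ a * pow 2ℚ m) (cong (m ℕ.+_) (ℕ.+-identityʳ m))) (pow-half-+ m m)))))))
            where
            e₃ : ∀ a b c → a * (b * c) ≡ (b * a) * c
            e₃ = ring-∀ ℚ-ring
          bound : 1ℚ - pow ½ m * 2ℚ ≤ E (cube (m ℕ.+ k)) (λ U → 1ℚ - total U)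
          bound = subst (1ℚ - pow ½ m * 2ℚ ≤_) (sym (trans (E-+ (cube (m ℕ.+ k)) (λ _ → 1ℚ) (λ U → - total U))
            (cong₂ _+_ (E-const (cube (m ℕ.+ k)) 1ℚ) (trans (E-cong (cube (m ℕ.+ k)) (λ U → sym (e₂ (total U))))
              (trans (E-* (- 1ℚ) (cube (m ℕ.+ k)) total) (e₂ (E (cube (m ℕ.+ k)) total)))))))
            (+-monoʳ-≤ 1ℚ (neg-antimono-≤ E-total))

-- The choice of the scale and of the constants.

module Conclusion where

  open import Defs
  open Rationals
  open RandomSubsets
  open TypicalSubsets
  open TailBounds
  open import Data.Nat as ℕ using (ℕ; zero; suc; _≥_; z≤n; s≤s)
  import Data.Nat.Properties as ℕ
  open import Data.Nat.Tactic.RingSolver using (solve-∀)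
  import Data.Integer as ℤ
  import Data.Integer.Properties as ℤ
  open import Data.Rational hiding (_≥_)
  open import Data.Rational.Properties
  import Data.Rational.Unnormalised as ℚᵘ
  import Data.Rational.Unnormalised.Properties as ℚᵘ
  open import Data.Product using (∃-syntax; _×_; _,_; proj₁; proj₂)
  open import Data.Sum using (inj₁; inj₂)
  open import Data.Nat.Coprimality as Coprime using (1-coprimeTo)
  open import Relation.Binary.PropositionalEquality using (_≡_; refl; sym; trans; cong; subst; subst₂)

  ℕtoℚ-2^ : ∀ a → ℕtoℚ (2 ℕ.^ a) ≡ pow 2ℚ a
  ℕtoℚ-2^ zero = refl
  ℕtoℚ-2^ (suc a) = trans (ℕtoℚ-* 2 (2 ℕ.^ a)) (cong (2ℚ *_) (ℕtoℚ-2^ a))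

  0≤pow2 : ∀ a → 0ℚ ≤ pow 2ℚ a
  0≤pow2 = pow-nonneg 0≤2

  exponent-cancel : ∀ a b → pow 2ℚ a ≤ pow 2ℚ b → a ℕ.≤ b
  exponent-cancel a b h = ℕ.≮⇒≥ λ b<a → ℕ.<⇒≱ (ℕ.^-monoʳ-< 2 (s≤s (s≤s z≤n)) b<a)
    (ℕtoℚ-cancel (subst₂ _≤_ (sym (ℕtoℚ-2^ a)) (sym (ℕtoℚ-2^ b)) h))

  root-≥1 : ∀ {x} → 0ℚ ≤ x → ∀ k → 1ℚ ≤ pow x (suc k) → 1ℚ ≤ x
  root-≥1 {x} 0≤x k h with ≤-total 1ℚ x
  ... | inj₁ h' = h'
  ... | inj₂ x≤1 = ≤-trans h (subst (pow x (suc k) ≤_) (*-identityʳ x) (*-monoˡ 0≤x (pow-≤1 0≤x x≤1 k)))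

  -- Start at the exponent `n` and halve until the next halving would fall to 1 or below; the value
  -- reached is then at most 2. At exponent 0 the bound p ≤ 1 suffices.
  scale : ∀ p → p ≤ 1ℚ → ∀ n → 1ℚ ≤ pow 2ℚ n * p → ∃[ a ] (1ℚ ≤ pow 2ℚ a * p × pow 2ℚ a * p ≤ 2ℚ)
  scale p p≤1 zero h = 0 , h , ≤-trans (≤-reflexive (*-identityˡ p)) (≤-trans p≤1 1≤2)
  scale p p≤1 (suc n) h with ≤-total 1ℚ (pow 2ℚ n * p)
  ... | inj₁ h' = scale p p≤1 n h'
  ... | inj₂ h' = suc n , h , subst₂ _≤_ (sym (*-assoc 2ℚ (pow 2ℚ n) p)) (*-identityʳ 2ℚ) (*-monoˡ 0≤2 h')

  archimedean : ∀ ε → 0ℚ < ε → ∃[ D ] 1ℚ ≤ ℕtoℚ D * ε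
  archimedean ε@(mkℚ (ℤ.+ zero) d c) (*<* (ℤ.+<+ ()))
  -- Here ε is (a + 1)/(d + 1), so its denominator serves.
  archimedean ε@(mkℚ ℤ.+[1+ a ] d c) _ = suc d , subst (λ x → 1ℚ ≤ x * ε) (sym (ℕtoℚ-mk (suc d)))
    (toℚᵘ-cancel-≤ (ℚᵘ.≤-trans (ℚᵘ.*≤* bound) (ℚᵘ.≤-reflexive (ℚᵘ.≃-sym (toℚᵘ-homo-* D ε)))))
    where
    D : ℚ
    D = mkℚ (ℤ.+ suc d) 0 (Coprime.sym (1-coprimeTo (suc d)))
    ineq : 1 ℕ.* (1 ℕ.* suc d) ℕ.≤ (suc d ℕ.* suc a) ℕ.* 1
    ineq = ℕ.≤-trans (ℕ.≤-reflexive (trans (ℕ.*-identityˡ (1 ℕ.* suc d)) (ℕ.*-identityˡ (suc d))))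
      (ℕ.≤-trans (ℕ.m≤m*n (suc d) (suc a)) (ℕ.≤-reflexive (sym (ℕ.*-identityʳ (suc d ℕ.* suc a)))))
    bound : ℤ.+ 1 ℤ.* ℤ.+ (1 ℕ.* suc d) ℤ.≤ (ℤ.+ suc d ℤ.* ℤ.+ suc a) ℤ.* ℤ.+ 1
    bound = ℤ.+≤+ ineq

  -- `dense` is p ≥ 2^(-jn/(j+1)) raised to the power j + 1, a form without roots.
  module _ (p : ℚ) (0≤p : 0ℚ ≤ p) (n j : ℕ) (dense : 1ℚ ≤ pow p (suc j) * ℕtoℚ (2 ℕ.^ (j ℕ.* n))) where

    private
      dense' : 1ℚ ≤ pow p (suc j) * pow 2ℚ (j ℕ.* n)
      dense' = subst (λ x → 1ℚ ≤ pow p (suc j) * x) (ℕtoℚ-2^ (j ℕ.* n)) dense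

    cube-dense : 1ℚ ≤ pow 2ℚ n * p
    cube-dense = root-≥1 (0≤* (0≤pow2 n) 0≤p) j (≤-trans dense' (subst (pow p (suc j) * pow 2ℚ (j ℕ.* n) ≤_)
      (trans (*-comm (pow p (suc j)) (pow 2ℚ (suc j ℕ.* n))) (trans (cong (_* pow p (suc j)) (pow-* 2ℚ (suc j) n))
        (sym (pow-*-base (pow 2ℚ n) p (suc j)))))
      (*-monoˡ (pow-nonneg 0≤p (suc j)) (pow-incr 1≤2 (ℕ.m≤n+m (j ℕ.* n) n)))))

    -- Raise 2^a p ≤ 2 to the power j + 1 and compare with `dense`. The outcome a ≤ 1 + jn/(j+1) is
    -- what makes m grow linearly in n.
    scale-small : ∀ a → pow 2ℚ a * p ≤ 2ℚ → suc j ℕ.* a ℕ.≤ suc j ℕ.+ j ℕ.* n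
    scale-small a h = exponent-cancel (suc j ℕ.* a) (suc j ℕ.+ j ℕ.* n) (subst₂ _≤_
      (trans (*-identityʳ (pow (pow 2ℚ a) (suc j))) (sym (pow-* 2ℚ (suc j) a)))
      (sym (pow-+ 2ℚ (suc j) (j ℕ.* n)))
      (≤-trans (*-monoˡ (pow-nonneg (0≤pow2 a) (suc j)) dense')
        (≤-trans (≤-reflexive (trans (sym (*-assoc (pow (pow 2ℚ a) (suc j)) (pow p (suc j)) (pow 2ℚ (j ℕ.* n))))
            (cong (_* pow 2ℚ (j ℕ.* n)) (sym (pow-*-base (pow 2ℚ a) p (suc j))))))
          (*-monoʳ-≤-nonNeg (pow 2ℚ (j ℕ.* n)) {{nonNegative (0≤pow2 (j ℕ.* n))}} (pow-mono (0≤* (0≤pow2 a) 0≤p) h (suc j))))))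

  -- Bernoulli gives 2^m ≥ 1 + m > 2D, and Dε ≥ 1.
  half-small : ∀ {ε} → 0ℚ < ε → ∀ D → 1ℚ ≤ ℕtoℚ D * ε → ∀ m → 2 ℕ.* D ℕ.≤ m → pow ½ m * 2ℚ ≤ ε
  half-small {ε} ε>0 D h m 2D≤m = ≤-trans (*-monoˡ (pow-nonneg 0≤½ m) (≤-trans
      (subst₂ _≤_ (*-identityʳ 2ℚ) (e₁ (ℕtoℚ D) ε) (*-monoˡ 0≤2 h))
      (*-monoʳ-≤-nonNeg ε {{nonNegative (<⇒≤ ε>0)}} exponential)))
    (≤-reflexive (trans (sym (*-assoc (pow ½ m) (pow 2ℚ m) ε)) (trans (cong (_* ε) (pow-half m)) (*-identityˡ ε))))
    where
    e₁ : ∀ d e → (1ℚ + 1ℚ) * (d * e) ≡ ((1ℚ + 1ℚ) * d) * e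
    e₁ = ring-∀ ℚ-ring
    e₂ : ∀ x → 1ℚ + x * 1ℚ ≡ x + 1ℚ
    e₂ = ring-∀ ℚ-ring
    exponential : 2ℚ * ℕtoℚ D ≤ pow 2ℚ m
    exponential = ≤-trans (≤-reflexive (sym (ℕtoℚ-* 2 D))) (≤-trans (ℕtoℚ-mono 2D≤m)
      (≤-trans (≤-by 0≤1 (e₂ (ℕtoℚ m))) (bernoulli 1ℚ 0≤2 m)))

  module _ (c L : ℕ) (2^c : 2 ℕ.^ c ≡ L) (L≥ : 192 ℕ.≤ L) where

    crowding : ℕ
    crowding = L ℕ.* 4 ℕ.+ 2

    expansion-constant small-set-constant : ℕ
    expansion-constant = 64 ℕ.+ 128 ℕ.* crowding
    small-set-constant = crowding ℕ.* (4 ℕ.* 2 ℕ.^ (4 ℕ.* crowding))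

    instance
      crowding≢0 : ℕ.NonZero crowding
      crowding≢0 = ℕ.>-nonZero (ℕ.≤-trans (s≤s z≤n) (ℕ.m≤n+m 2 (L ℕ.* 4)))

      small-set-constant≢0 : ℕ.NonZero small-set-constant
      small-set-constant≢0 = ℕ.m*n≢0 crowding (4 ℕ.* 2 ℕ.^ (4 ℕ.* crowding)) {{crowding≢0}} {{ℕ.m*n≢0 4 (2 ℕ.^ (4 ℕ.* crowding)) {{_}} {{ℕ.m^n≢0 2 (4 ℕ.* crowding)}}}}

    module _ (β η : ℚ) (β>0 : 0ℚ < β) (β≡ : β * ℕtoℚ expansion-constant ≡ 1ℚ) (η≡ : η * ℕtoℚ small-set-constant ≡ 1ℚ) where

      good-probability : ∀ p → 0ℚ < p → p < 1ℚ → ∀ {ε} → 0ℚ < ε → ∀ D → 1ℚ ≤ ℕtoℚ D * ε →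
        ∀ m a → 4 ℕ.* crowding ℕ.+ (3 ℕ.+ 2 ℕ.* D) ℕ.≤ m → 1ℚ ≤ pow 2ℚ a * p → pow 2ℚ a * p ≤ 2ℚ →
        ProbAtLeast (m ℕ.+ (c ℕ.+ a)) p (GoodEvent β η) (1ℚ - ε)
      good-probability p p>0 p<1 {ε} ε>0 D D≥ m a m≥ lower upper =
        select m k L split-size ,
        (λ U U∈ sel → typical⇒good U∈ {C = crowding} {β} {η} sel {{ℕ.>-nonZero (ℕ.≤-trans (s≤s z≤n) 3≤m)}} 3≤m (ℕ.≤-trans (ℕ.m≤m+n _ _) m≥) β>0 β≡ η≡) ,
        ≤-trans (+-monoʳ-≤ 1ℚ (neg-antimono-≤ (half-small ε>0 D D≥ m (ℕ.≤-trans (ℕ.m≤n+m (2 ℕ.* D) 3) tail≤m)))) (tail m k L split-size L≥)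
        where
        k : ℕ
        k = c ℕ.+ a
        N : ℕ
        N = 2 ℕ.^ a
        open Estimates p (<⇒≤ p>0) (<⇒≤ p<1) N (subst (λ x → 1ℚ ≤ x * p) (sym (ℕtoℚ-2^ a)) lower) (subst (λ x → x * p ≤ 2ℚ) (sym (ℕtoℚ-2^ a)) upper)
        split-size : 2 ℕ.^ k ≡ L ℕ.* N
        split-size = trans (ℕ.^-distribˡ-+-* 2 c a) (cong (ℕ._* N) 2^c)
        tail≤m : 3 ℕ.+ 2 ℕ.* D ℕ.≤ m
        tail≤m = ℕ.≤-trans (ℕ.m≤n+m _ (4 ℕ.* crowding)) m≥
        3≤m : 3 ℕ.≤ m
        3≤m = ℕ.≤-trans (ℕ.m≤m+n 3 (2 ℕ.* D)) tail≤m

      whp : (j : ℕ) (p : ℕ → ℚ) → ((n : ℕ) → 0ℚ < p n × p n < 1ℚ) →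
            ((n : ℕ) → n ≥ 1 → 1ℚ ≤ pow (p n) (suc j) * ℕtoℚ (2 ℕ.^ (j ℕ.* n))) →
            (ε : ℚ) → 0ℚ < ε → ∃[ N ] ((n : ℕ) → n ≥ N → ProbAtLeast n (p n) (GoodEvent β η) (1ℚ - ε))
      -- From n ≥ (j + 1)(M + c + 1), removing c coordinates and a ≤ 1 + jn/(j+1) further ones
      -- leaves at least M for the blocks.
      whp j p p∈ dense ε ε>0 = suc j ℕ.* (M ℕ.+ suc c) , λ n n≥ → result n n≥ (scale (p n) (<⇒≤ (proj₂ (p∈ n))) n
              (cube-dense (p n) (<⇒≤ (proj₁ (p∈ n))) n j (dense n (positive-n n n≥))))
        where
        D : ℕ
        D = proj₁ (archimedean ε ε>0)
        D≥ : 1ℚ ≤ ℕtoℚ D * ε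
        D≥ = proj₂ (archimedean ε ε>0)
        M : ℕ
        M = 4 ℕ.* crowding ℕ.+ (3 ℕ.+ 2 ℕ.* D)
        positive-n : ∀ n → n ≥ suc j ℕ.* (M ℕ.+ suc c) → n ≥ 1
        positive-n n n≥ = ℕ.≤-trans (ℕ.≤-trans (ℕ.m≤n+m 1 (M ℕ.+ c)) (ℕ.≤-reflexive (e M c))) (ℕ.≤-trans (ℕ.m≤n*m (M ℕ.+ suc c) (suc j)) n≥)
          where
          e : ∀ M c → M ℕ.+ c ℕ.+ 1 ≡ M ℕ.+ suc c
          e = solve-∀
        result : ∀ n → n ≥ suc j ℕ.* (M ℕ.+ suc c) → ∃[ a ] (1ℚ ≤ pow 2ℚ a * p n × pow 2ℚ a * p n ≤ 2ℚ) →
                 ProbAtLeast n (p n) (GoodEvent β η) (1ℚ - ε)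
        result n n≥ (a , lower , upper) = subst (λ N → ProbAtLeast N (p n) (GoodEvent β η) (1ℚ - ε)) (ℕ.m∸n+n≡m (ℕ.≤-trans (ℕ.m≤n+m k M) room))
          (good-probability (p n) (proj₁ (p∈ n)) (proj₂ (p∈ n)) ε>0 D D≥ (n ℕ.∸ k) a M≤ lower upper)
          where
          k : ℕ
          k = c ℕ.+ a
          open ℕ.≤-Reasoning
          e₁ : ∀ j M c a → suc j ℕ.* (M ℕ.+ (c ℕ.+ a)) ≡ suc j ℕ.* (M ℕ.+ c) ℕ.+ suc j ℕ.* a
          e₁ = solve-∀
          e₂ : ∀ j M c n → suc j ℕ.* (M ℕ.+ c) ℕ.+ (suc j ℕ.+ j ℕ.* n) ≡ suc j ℕ.* (M ℕ.+ suc c) ℕ.+ j ℕ.* n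
          e₂ = solve-∀
          room : M ℕ.+ k ℕ.≤ n
          room = ℕ.*-cancelˡ-≤ (suc j) (begin
            suc j ℕ.* (M ℕ.+ (c ℕ.+ a))                    ≡⟨ e₁ j M c a ⟩
            suc j ℕ.* (M ℕ.+ c) ℕ.+ suc j ℕ.* a              ≤⟨ ℕ.+-monoʳ-≤ (suc j ℕ.* (M ℕ.+ c))
                                                              (scale-small (p n) (<⇒≤ (proj₁ (p∈ n))) n j (dense n (positive-n n n≥)) a upper) ⟩
            suc j ℕ.* (M ℕ.+ c) ℕ.+ (suc j ℕ.+ j ℕ.* n)     ≡⟨ e₂ j M c n ⟩
            suc j ℕ.* (M ℕ.+ suc c) ℕ.+ j ℕ.* n           ≤⟨ ℕ.+-monoˡ-≤ (j ℕ.* n) n≥ ⟩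
            n ℕ.+ j ℕ.* n                               ∎)
          M≤ : M ℕ.≤ n ℕ.∸ k
          M≤ = ℕ.+-cancelʳ-≤ k M (n ℕ.∸ k) (ℕ.≤-trans room (ℕ.≤-reflexive (sym (ℕ.m∸n+n≡m (ℕ.≤-trans (ℕ.m≤n+m k M) room)))))

  -- With `c`, `L` and `j` as variables, the enormous constants built from `L` stay symbolic
  -- throughout the proof.
  expansion-theorem : ∀ c L → 2 ℕ.^ c ≡ L → 192 ℕ.≤ L → ∀ j → ∃[ β ] ∃[ η ] (0ℚ < β × 0ℚ < η ×
    ((p : ℕ → ℚ) → ((n : ℕ) → 0ℚ < p n × p n < 1ℚ) →
     ((n : ℕ) → n ≥ 1 → 1ℚ ≤ pow (p n) (suc j) * ℕtoℚ (2 ℕ.^ (j ℕ.* n))) →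
     (ε : ℚ) → 0ℚ < ε → ∃[ N ] ((n : ℕ) → n ≥ N → ProbAtLeast n (p n) (GoodEvent β η) (1ℚ - ε))))
  expansion-theorem c L 2^c L≥ j =
    let β , β>0 , β≡ = reciprocal (expansion-constant c L 2^c L≥)
        η , η>0 , η≡ = reciprocal (small-set-constant c L 2^c L≥) {{small-set-constant≢0 c L 2^c L≥}}
    in β , η , β>0 , η>0 , whp c L 2^c L≥ β η β>0 β≡ η≡ j

open import Defs
open import Data.Nat as ℕ using (ℕ; _≥_)
open import Data.Rational using (ℚ; 0ℚ; 1ℚ; _<_; _≤_; _-_; _*_)
open import Data.Product using (_×_; ∃-syntax)
open import Data.Nat.Properties using (m≤m+n)
open import Relation.Binary.PropositionalEquality using (refl)

-- Blocks of expected size between 256 and 512; the union bound needs 192 = 3 · 64.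
theorem1p2 : ∃[ β ] ∃[ η ] (0ℚ < β × 0ℚ < η ×
    ((p : ℕ → ℚ) →
    ((n : ℕ) → 0ℚ < p n × p n < 1ℚ) →
    ((n : ℕ) → n ≥ 1 → 1ℚ ≤ pow (p n) 100 * ℕtoℚ (2 ℕ.^ (99 ℕ.* n))) →
    (ε : ℚ) → 0ℚ < ε →
    ∃[ N ] ((n : ℕ) → n ≥ N →
    ProbAtLeast n (p n) (GoodEvent β η) (1ℚ - ε))))
theorem1p2 = Conclusion.expansion-theorem 8 256 refl (m≤m+n 192 64) 99
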